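{- Let $\pi$ be a sorted permutation with $k$ descents, and let $\mathcal B^\pi$ and $\mathbf y^\pi=(y_I^\pi)_{I\in\mathcal B^\pi}$ be the binary building set on $[k+1]$ and the tuple of positive integers constructed from the canonical hook configuration of $\pi$ as described in the context. Then the fertilitope of $\pi$ satisfies \[\mathrm{Fer}_\pi=\sum_{I\in\mathcal B^\pi}y_I^\pi\,\Delta_I,\] where the sum is a Minkowski sum.
   Context: A permutation of size $n\ge 1$ is an ordering $\pi=\pi_1\cdots\pi_n$ of a set of $n$ distinct positive integers. A descent of $\pi$ is an index $i\in[n-1]$ with $\pi_i>\pi_{i+1}$. The plot of $\pi$ is the set of points $(i,\pi_i)$, $i\in[n]$. A hook of $\pi$ with southwest endpoint $(i,\pi_i)$ and northeast endpoint $(j,\pi_j)$, where $i<j$ and $\pi_i<\pi_j$, is the union of the vertical segment from $(i,\pi_i)$ to $(i,\pi_j)$ and the horizontal segment from $(i,\pi_j)$ to $(j,\pi_j)$. A point $(m,\pi_m)$ lies directly above (respectively, below) this hook if $i<m<j$ and $\pi_m>\pi_j$ (respectively, $\pi_m<\pi_j$). It lies weakly below the hook if it lies below it or is its northeast endpoint. Let $d_1<\cdots<d_k$ be the descents of $\pi$. A valid hook configuration of $\pi$ is a tuple $\mathcal H=(H_1,\ldots,H_k)$ of hooks of $\pi$ such that: (1) $H_i$ has southwest endpoint $(d_i,\pi_{d_i})$ for each $i$; (2) no point of the plot lies directly above a hook of $\mathcal H$; (3) no two hooks of $\mathcal H$ intersect or overlap, except that the northeast endpoint of one may be the southwest endpoint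 of another. (If $k=0$, there is exactly one, the empty configuration.) Let $\mathrm{VHC}(\pi)$ be the set of valid hook configurations of $\pi$. Each $\mathcal H\in\mathrm{VHC}(\pi)$ induces a coloring of the $n-k$ points of the plot that are not northeast endpoints of hooks of $\mathcal H$: such a point $(m,\pi_m)$ gets the color of the lowest hook of $\mathcal H$ lying above it (i.e. among the hooks of $\mathcal H$ below which it lies, the one whose northeast endpoint has smallest height; a hook is not considered to lie above its own southwest endpoint), and the color of the "sky" if there is no such hook. Let $q_i$ be the number of points with the color of $H_i$ ($1\le i\le k$) and $q_0$ the number with the color of the sky. Then $\mathbf q^{\mathcal H}=(q_0,\ldots,q_k)$ is a composition of $n-k$ into $k+1$ (positive) parts. Set $\mathcal V(\pi)=\{\mathbf q^{\mathcal H}:\mathcal H\in\mathrm{VHC}(\pi)\}$ and $\mathrm{Fer}_\pi=\mathrm{conv}(\mathcal V(\pi))\subseteq\mathbb R^{k+1}$ (the fertilitope of $\pi$). The stack-sorting map $s$ fixes the empty word and satisfies $s(LmR)=s(L)s(R)m$, where $m$ is the largest entry of $LmR$. A permutation is sorted if it is in the image of $s$; it is known that $\pi$ is sorted if and only if $\mathcal V(\pi)\neq\emptyset$. The canonical hook configuration $\mathcal H^*=(H_1^*,\ldots,H_k^*)$ of $\pi$, which exists when $\mathrm{VHC}(\pi)\ne\emptyset$, is constructed in the order $H_k^*,\ldots,H_1^*$: $H_\ell^*$ is the hook with southwest endpoint $(d_\ell,\pi_{d_\ell})$ whose northeast endpoint is the lowest point of the plot that is above and to the right of $(d_\ell,\pi_{d_\ell})$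 and does not lie weakly below any of $H_k^*,\ldots,H_{\ell+1}^*$. A binary plane tree is a rooted tree in which each vertex has at most two children and each child is designated as a left or right child (possibly a vertex has only one child, left or right). It is full if each vertex has $0$ or $2$ children. Given $\mathcal H\in\mathrm{VHC}(\pi)$, let $\Theta(\mathcal H)$ be the binary plane tree with vertices labeled by the entries of $\pi$ (root $\pi_n$) in which, for each $i\in[n-1]$: if $i$ is a descent of $\pi$, then $\pi_i$ is the left child of $\pi_j$, where $(j,\pi_j)$ is the northeast endpoint of the hook of $\mathcal H$ with southwest endpoint $(i,\pi_i)$; otherwise $\pi_i$ is the right child of $\pi_{i+1}$. Construction of $\mathcal B^\pi,\mathbf y^\pi$: let $T^\pi$ be $\Theta(\mathcal H^*)$ with its labels removed. Assign each leaf the new label $1$ and each internal vertex the new label $0$. Repeatedly: whenever a vertex $v$ has no left child and has a right child $u$ that is either a leaf or has two children, contract the edge $uv$ to a single vertex, identified with $u$, and increase the label of $u$ by $1$. Stop when the tree is full; call it $\widehat T^\pi$ (it does not depend on the choices made, and has $k+1$ leaves). Identify the leaves of $\widehat T^\pi$ with $\{1\},\ldots,\{k+1\}$ from left to right and each internal vertex with the union of the leaves below it. For each vertex $I$ let $y_I^\pi$ be its label; $\mathcal B^\pi$ is the set of vertices $I$ with $y_I^\pi>0$. For $I\subseteq[k+1]$, $\Delta_I=\mathrm{conv}(\{e_i:i\in I\})\subseteq\mathbb R^{k+1}$, with $e_1,\ldots,e_{k+1}$ the standard basis. -}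

module Defs where

open import Level using (Level; _⊔_) renaming (suc to lsuc)
open import Algebra.Apartness.Bundles using (HeytingField; HeytingCommutativeRing)
open import Algebra.Bundles using (CommutativeRing)
open import Data.Bool.Base using (if_then_else_)
open import Data.Fin.Base using (Fin; zero; suc; toℕ) renaming (_<_ to _<ᶠ_)
import Data.Fin.Properties as Fin
open import Data.Fin.Subset using (Subset; _∪_) renaming (_∈_ to _∈ˢ_)
open import Data.List.Base
  using (List; []; _∷_; _++_; [_]; length; lookup; filter; allFin; map)
open import Data.List.Relation.Unary.All using (All)
open import Data.List.Relation.Unary.Unique.Propositional using (Unique)
open import Data.Nat.Base using (ℕ; suc; _+_; _≤_; _<_)
open import Data.Nat.Properties using (_≟_; _≤?_; _<?_)
open import Data.Product.Base using (_×_; _,_; ∃-syntax; Σ-syntax; proj₂)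
open import Data.Sum.Base using (_⊎_)
open import Data.Vec.Base using (tabulate)
open import Data.Vec.Functional using (Vector)
open import Relation.Binary.Construct.Closure.ReflexiveTransitive using (Star)
open import Relation.Binary.Core using (Rel)
open import Relation.Binary.PropositionalEquality.Core using (_≡_; _≢_)
open import Relation.Binary.Structures using (IsStrictPartialOrder)
open import Relation.Nullary.Decidable.Core
  using (Dec; does; ¬?; _×-dec_; _→-dec_)
open import Relation.Nullary.Negation.Core using (¬_)
open import Relation.Unary using (Pred)

record IsPermutation (π : List ℕ) : Set where
  field
    nonEmpty : 1 ≤ length π
    positive : All (1 ≤_) π
    distinct : Unique π

infix 4 _⟶ₛ_

-- σ ⟶ₛ τ is the graph of the stack-sorting map: s(σ) = τ.
data _⟶ₛ_ : List ℕ → List ℕ → Set where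
  s-empty : [] ⟶ₛ []
  s-LmR   : ∀ {L R L′ R′ m} → All (_< m) L → All (_< m) R →
            L ⟶ₛ L′ → R ⟶ₛ R′ →
            L ++ m ∷ R ⟶ₛ L′ ++ R′ ++ [ m ]

Sorted : List ℕ → Set
Sorted π = ∃[ σ ] IsPermutation σ × (σ ⟶ₛ π)

-- Positions and descents are counted from 0, so the descents d₁ < ⋯ < d_k
-- are d π 0, …, d π (k - 1); the plot is translated accordingly.
module _ (π : List ℕ) where

  Position : Set
  Position = Fin (length π)

  height : Position → ℕ
  height = lookup π

  point : Position → ℕ × ℕ
  point i = toℕ i , height i

  IsDescent : Position → Set
  IsDescent i = ∃[ j ] toℕ j ≡ suc (toℕ i) × height j < height i

  isDescent? : ∀ i → Dec (IsDescent i)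
  isDescent? i = Fin.any? λ j →
    (toℕ j ≟ suc (toℕ i)) ×-dec (height j <? height i)

  descents : List Position
  descents = filter isDescent? (allFin (length π))

  #descents : ℕ
  #descents = length descents

  d : Fin #descents → Position
  d = lookup descents

  record Hook : Set where
    field
      sw    : Position
      ne    : Position
      sw<ne : sw <ᶠ ne
      rises : height sw < height ne

  open Hook

  -- The lattice points of the vertical and of the horizontal segment of a
  -- hook.  These segments are axis-parallel with endpoints in ℕ × ℕ, so each
  -- component of the intersection of two hooks in the plane is a lattice
  -- point or a segment with distinct lattice endpoints; for the condition
  -- `disjoint` below, lattice points therefore suffice.
  OnHook : Hook → ℕ × ℕ → Set
  OnHook h (x , y) =
      (x ≡ toℕ (sw h) × height (sw h) ≤ y × y ≤ height (ne h))
    ⊎ (y ≡ height (ne h) × toℕ (sw h) ≤ x × x ≤ toℕ (ne h))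

  Above : Hook → Position → Set
  Above h m = sw h <ᶠ m × m <ᶠ ne h × height (ne h) < height m

  Below : Hook → Position → Set
  Below h m = sw h <ᶠ m × m <ᶠ ne h × height m < height (ne h)

  WeaklyBelow : Hook → Position → Set
  WeaklyBelow h m = Below h m ⊎ m ≡ ne h

  record VHC : Set where
    field
      hooks     : Vector Hook #descents
      sw≡d      : ∀ i → sw (hooks i) ≡ d i
      noneAbove : ∀ i m → ¬ Above (hooks i) m
      disjoint  : ∀ {i j} → i ≢ j → ∀ p →
                  OnHook (hooks i) p → OnHook (hooks j) p →
                    (p ≡ point (ne (hooks i)) × p ≡ point (sw (hooks j)))
                  ⊎ (p ≡ point (sw (hooks i)) × p ≡ point (ne (hooks j)))

  open VHC

  below? : ∀ h m → Dec (Below h m)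
  below? h m =
    (sw h Fin.<? m) ×-dec (m Fin.<? ne h) ×-dec (height m <? height (ne h))

  -- Color zero is the sky, color (suc i) is that of the hook with index i.
  Color : Set
  Color = Fin (suc #descents)

  HasColor : VHC → Position → Color → Set
  HasColor H m zero    = ∀ j → ¬ Below (hooks H j) m
  HasColor H m (suc i) =
    Below (hooks H i) m ×
    (∀ j → Below (hooks H j) m →
       height (ne (hooks H i)) ≤ height (ne (hooks H j)))

  hasColor? : ∀ H m c → Dec (HasColor H m c)
  hasColor? H m zero    = Fin.all? λ j → ¬? (below? (hooks H j) m)
  hasColor? H m (suc i) =
    below? (hooks H i) m ×-dec
    (Fin.all? λ j → below? (hooks H j) m →-dec
       (height (ne (hooks H i)) ≤? height (ne (hooks H j))))

  IsNE : VHC → Position → Set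
  IsNE H m = ∃[ i ] ne (hooks H i) ≡ m

  isNE? : ∀ H m → Dec (IsNE H m)
  isNE? H m = Fin.any? λ i → ne (hooks H i) Fin.≟ m

  q : VHC → Color → ℕ
  q H c = length
    (filter (λ m → ¬? (isNE? H m) ×-dec hasColor? H m c) (allFin (length π)))

  Candidate : VHC → Fin #descents → Position → Set
  Candidate H ℓ p =
    d ℓ <ᶠ p × height (d ℓ) < height p ×
    (∀ j → ℓ <ᶠ j → ¬ WeaklyBelow (hooks H j) p)

  IsCanonical : VHC → Set
  IsCanonical H = ∀ ℓ →
    Candidate H ℓ (ne (hooks H ℓ)) ×
    (∀ p → Candidate H ℓ p → height (ne (hooks H ℓ)) ≤ height p)

-- Constructors: no child, only a left child, only a right child, both.
data BinTree {a} (A : Set a) : Set a where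
  leaf   : A → BinTree A
  nodeL  : A → BinTree A → BinTree A
  nodeR  : A → BinTree A → BinTree A
  nodeLR : A → BinTree A → BinTree A → BinTree A

data Full {a} {A : Set a} : BinTree A → Set a where
  leaf   : ∀ {x} → Full (leaf x)
  nodeLR : ∀ {x l r} → Full l → Full r → Full (nodeLR x l r)

module _ {π : List ℕ} (H : VHC π) where

  open Hook
  open VHC

  LeftChild : Position π → Position π → Set
  LeftChild i j = ∃[ ℓ ] sw (hooks H ℓ) ≡ i × ne (hooks H ℓ) ≡ j

  RightChild : Position π → Position π → Set
  RightChild i j = suc (toℕ i) ≡ toℕ j × ¬ IsDescent π i

  -- ΘAt j t : t is the subtree of Θ(H) rooted at the vertex labeled π_j.
  data ΘAt (j : Position π) : BinTree ℕ → Set where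
    leaf   : (∀ i → ¬ LeftChild i j) → (∀ i → ¬ RightChild i j) →
             ΘAt j (leaf (height π j))
    nodeL  : ∀ {i l} → LeftChild i j → ΘAt i l →
             (∀ i′ → ¬ RightChild i′ j) →
             ΘAt j (nodeL (height π j) l)
    nodeR  : ∀ {i r} → (∀ i′ → ¬ LeftChild i′ j) →
             RightChild i j → ΘAt i r →
             ΘAt j (nodeR (height π j) r)
    nodeLR : ∀ {i i′ l r} → LeftChild i j → ΘAt i l →
             RightChild i′ j → ΘAt i′ r →
             ΘAt j (nodeLR (height π j) l r)

  IsΘ : BinTree ℕ → Set
  IsΘ t = ∃[ j ] suc (toℕ j) ≡ length π × ΘAt j t

-- Discards the labels; leaves become 1 and internal vertices 0.
relabel : ∀ {a} {A : Set a} → BinTree A → BinTree ℕ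
relabel (leaf _)       = leaf 1
relabel (nodeL _ l)    = nodeL 0 (relabel l)
relabel (nodeR _ r)    = nodeR 0 (relabel r)
relabel (nodeLR _ l r) = nodeLR 0 (relabel l) (relabel r)

infix 4 _⇝_

-- The contracted vertex v is the one labeled x; its label is still 0.
data _⇝_ : BinTree ℕ → BinTree ℕ → Set where
  contract-leaf : ∀ {x y} → nodeR x (leaf y) ⇝ leaf (suc y)
  contract-LR   : ∀ {x y l r} →
                  nodeR x (nodeLR y l r) ⇝ nodeLR (suc y) l r
  in-L          : ∀ {x l l′} → l ⇝ l′ → nodeL x l ⇝ nodeL x l′
  in-R          : ∀ {x r r′} → r ⇝ r′ → nodeR x r ⇝ nodeR x r′
  in-LRˡ        : ∀ {x l l′ r} → l ⇝ l′ → nodeLR x l r ⇝ nodeLR x l′ r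
  in-LRʳ        : ∀ {x l r r′} → r ⇝ r′ → nodeLR x l r ⇝ nodeLR x l r′

#leaves : ∀ {a} {A : Set a} → BinTree A → ℕ
#leaves (leaf _)       = 1
#leaves (nodeL _ l)    = #leaves l
#leaves (nodeR _ r)    = #leaves r
#leaves (nodeLR _ l r) = #leaves l + #leaves r

-- The set of leaves of a tree whose leftmost leaf has (0-based) number a.
leafSet : ∀ {b} {A : Set b} (N a : ℕ) → BinTree A → Subset N
leafSet N a (leaf _)       = tabulate λ c → does (toℕ c ≟ a)
leafSet N a (nodeL _ l)    = leafSet N a l
leafSet N a (nodeR _ r)    = leafSet N a r
leafSet N a (nodeLR _ l r) = leafSet N a l ∪ leafSet N (a + #leaves l) r

-- In a full tree distinct vertices have distinct leaf sets, so no subset is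
-- listed twice and the list represents the family of labels y_I.
vertices : ∀ {b} {A : Set b} (N a : ℕ) → BinTree A → List (Subset N × A)
vertices N a t@(leaf y)       = [ leafSet N a t , y ]
vertices N a t@(nodeL y l)    = (leafSet N a t , y) ∷ vertices N a l
vertices N a t@(nodeR y r)    = (leafSet N a t , y) ∷ vertices N a r
vertices N a t@(nodeLR y l r) =
  (leafSet N a t , y) ∷ vertices N a l ++ vertices N (a + #leaves l) r

-- One run of the construction, with an arbitrary choice of contractions.
record Construction (π : List ℕ) : Set where
  field
    H*        : VHC π
    canonical : IsCanonical π H*
    Θ*        : BinTree ℕ
    isΘ       : IsΘ H* Θ*
    T̂         : BinTree ℕ
    steps     : Star _⇝_ (relabel Θ*) T̂
    full      : Full T̂

  -- The pairs (I , y_I^π) with I ∈ 𝓑^π.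
  𝓑 : List (Subset (suc (#descents π)) × ℕ)
  𝓑 = filter (λ v → 1 ≤? proj₂ v) (vertices (suc (#descents π)) 0 T̂)

-- Classically these are the usual ordered fields; phrased with < and an
-- apartness so that constructive real numbers are covered as well.
record OrderedField c ℓ₁ ℓ₂ ℓ₃ : Set (lsuc (c ⊔ ℓ₁ ⊔ ℓ₂ ⊔ ℓ₃)) where
  field
    heytingField : HeytingField c ℓ₁ ℓ₂

  open HeytingField heytingField public
    using (Carrier; _≈_; _#_; 0#; 1#; heytingCommutativeRing)
    renaming (_+_ to _+ᶠ_; _*_ to _*ᶠ_)

  infix 4 _<ᴷ_ _≤ᴷ_

  field
    _<ᴷ_                 : Rel Carrier ℓ₃
    isStrictPartialOrder : IsStrictPartialOrder _≈_ _<ᴷ_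
    <⇒#                  : ∀ {x y} → x <ᴷ y → x # y
    #⇒<⊎>                : ∀ {x y} → x # y → x <ᴷ y ⊎ y <ᴷ x
    0<1                  : 0# <ᴷ 1#
    +-monoˡ-<            : ∀ {x y} z → x <ᴷ y → x +ᶠ z <ᴷ y +ᶠ z
    *-pos                : ∀ {x y} → 0# <ᴷ x → 0# <ᴷ y → 0# <ᴷ x *ᶠ y

  _≤ᴷ_ : Rel Carrier ℓ₃
  x ≤ᴷ y = ¬ (y <ᴷ x)

  commutativeRing : CommutativeRing c ℓ₁
  commutativeRing = HeytingCommutativeRing.commutativeRing heytingCommutativeRing

  open import Algebra.Properties.Semiring.Sum
    (CommutativeRing.semiring commutativeRing) public using (sum)
  open import Algebra.Properties.Semiring.Mult
    (CommutativeRing.semiring commutativeRing) public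
    using () renaming (_×_ to _·_)

module _ {c ℓ₁ ℓ₂ ℓ₃} (F : OrderedField c ℓ₁ ℓ₂ ℓ₃) where

  open OrderedField F

  Point : ℕ → Set c
  Point N = Vector Carrier N

  _≋_ : ∀ {N} → Rel (Point N) ℓ₁
  x ≋ y = ∀ i → x i ≈ y i

  conv : ∀ {N ℓ} → Pred (Point N) ℓ → Pred (Point N) (c ⊔ ℓ₁ ⊔ ℓ₃ ⊔ ℓ)
  conv {N} S x =
    ∃[ m ] Σ[ p ∈ Vector (Point N) m ] Σ[ w ∈ Vector Carrier m ]
      (∀ j → S (p j)) × (∀ j → 0# ≤ᴷ w j) × sum w ≈ 1# ×
      x ≋ (λ i → sum λ j → w j *ᶠ p j i)

  e : ∀ {N} → Fin N → Point N
  e i j = if does (i Fin.≟ j) then 1# else 0#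

  Δ : ∀ {N} → Subset N → Pred (Point N) (c ⊔ ℓ₁ ⊔ ℓ₃)
  Δ I = conv λ x → ∃[ i ] i ∈ˢ I × x ≋ e i

  dilate : ∀ {N ℓ} → ℕ → Pred (Point N) ℓ → Pred (Point N) (c ⊔ ℓ₁ ⊔ ℓ)
  dilate y S x = ∃[ p ] S p × x ≋ (λ i → y · p i)

  minkowskiSum : ∀ {N ℓ} → List (Pred (Point N) ℓ) → Pred (Point N) (c ⊔ ℓ₁ ⊔ ℓ)
  minkowskiSum {ℓ = ℓ} [] x = Level.Lift (c ⊔ ℓ) (x ≋ λ _ → 0#)
  minkowskiSum (S ∷ Ss) x =
    ∃[ u ] ∃[ v ] S u × minkowskiSum Ss v × x ≋ (λ i → u i +ᶠ v i)

  𝓥 : (π : List ℕ) → Pred (Point (suc (#descents π))) ℓ₁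
  𝓥 π x = ∃[ H ] x ≋ (λ i → q π H i · 1#)

  Fer : (π : List ℕ) → Pred (Point (suc (#descents π))) (c ⊔ ℓ₁ ⊔ ℓ₃)
  Fer π = conv (𝓥 π)

  ΣyΔ : ∀ {N} → List (Subset N × ℕ) → Pred (Point N) (c ⊔ ℓ₁ ⊔ ℓ₃)
  ΣyΔ B = minkowskiSum (map (λ (I , y) → dilate y (Δ I)) B)

{-# OPTIONS --safe #-}

-- In the decreasing tree Θ(H) of a valid hook configuration H, the color class
-- with index c consists of the leaf number c and of the right-only vertices
-- whose leftmost leaf is c.  To see how these vertices can move, let V_t(w) be
-- the set of compositions of the word w prolonged by t larger increasing
-- entries.  If w = L m with m = max w, then V_t(w) = V_{t+1}(L).  If w = L m R
-- with m = max w and R nonempty, then the hook of m ends in the tail, and V_t(w)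
-- is the union of V_a(L) × V_b(R) over a + b = t, a ≥ 1.  By induction:
--
--   (1) if V_t(w) ≠ ∅, then V_{t+1}(w) is the set of all q + e_i, q ∈ V_t(w);
--   (2) if u ends in a larger entry than v begins with, u and v are feasible
--       without tail, and V_0(u v) = ∅, then V_1(u v) = V_0(u) × V_0(v).
--
-- A vertex x of Θ(H*) turns the word w of its descendants into w x with
-- V_0(w x) = V_1(w).  If x is right-only, (1) adds one standard basis
-- vector e_i with i any leaf below x.  If x has two children, w = u v and x is the
-- endpoint of a canonical hook.  Such a hook only uses a tail entry that cannot
-- be dispensed with, so V_0(u v) = ∅ and (2) applies.  So the compositions of π
-- are exactly the sums of y_I standard basis vectors from each I, and the
-- theorem follows because convex hulls commute with Minkowski sums.

module Submission where

open import Defs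
open import Data.List.Base using (List)
open import Data.Nat.Base using (ℕ)
open import Data.Product.Base using (_×_)
open import Relation.Unary using (_≐_)

-- Removing the maximum m from w = L m R does not separate L from R, since hooks of both may end to
-- the right of w. Those endpoints increase and exceed everything before them, so only their number
-- matters; this is what the tail records. If the hook of m ends at the tail entry y, then hooks of
-- R stop before y, while hooks of L end at or before m or beyond y. Hence R inherits the b entries
-- before y, and L those after y together with m, so a ≥ 1. The least t with V_t(w) ≠ ∅ obeys the
-- same recursion and is called `μ`; sortedness and the emptiness of V_0(u v) become inequalities
-- for it. In (1), a unit is taken from a factor whose share of the tail exceeds its minimum. In
-- (2), V_0(u v) = ∅ means that one tail entry leaves no slack, so every share is forced, down to
-- the place where u meets v. Canonicity amounts to giving R exactly `μ` entries: with fewer R would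
-- be infeasible, and with more a lower endpoint would be admissible for m.

module LatticePoints where

  open import Data.Bool.Base using (if_then_else_; true; false)
  open import Data.Fin.Base using (Fin; toℕ)
  open import Data.Fin.Subset using (Subset) renaming (_∈_ to _∈ˢ_)
  open import Data.List.Base using ([]; _∷_)
  open import Data.Nat.Base using (zero; suc; _+_)
  open import Data.Nat.Properties using (_≟_)
  open import Data.Product.Base using (_,_; ∃-syntax; ∃₂)
  open import Relation.Binary.PropositionalEquality using (_≡_; _≢_; refl)
  open import Relation.Nullary.Decidable using (does; dec-true; dec-false)

  -- The vector x e_a. The index is a natural number so that leaf numbers can be shifted by
  -- addition.
  spike : ∀ {N} → ℕ → ℕ → Fin N → ℕ
  spike a x i = if does (toℕ i ≟ a) then x else 0

  spike-≡ : ∀ {N a x} (i : Fin N) → toℕ i ≡ a → spike a x i ≡ x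
  spike-≡ {a = a} i eq rewrite dec-true (toℕ i ≟ a) eq = refl

  spike-≢ : ∀ {N a x} (i : Fin N) → toℕ i ≢ a → spike a x i ≡ 0
  spike-≢ {a = a} i ne rewrite dec-false (toℕ i ≟ a) ne = refl

  spike-suc : ∀ {N} a x (i : Fin N) → spike a (suc x) i ≡ spike a 1 i + spike a x i
  spike-suc a x i with does (toℕ i ≟ a)
  ... | true  = refl
  ... | false = refl

  -- The lattice points of y Δ_I, as sums of y standard basis vectors.
  Disc : ∀ {N} → ℕ → Subset N → (Fin N → ℕ) → Set
  Disc zero    I z = ∀ i → z i ≡ 0
  Disc (suc y) I z = ∃[ j ] j ∈ˢ I × ∃[ u ] Disc y I u × (∀ i → z i ≡ spike (toℕ j) 1 i + u i)

  DiscSum : ∀ {N} → List (Subset N × ℕ) → (Fin N → ℕ) → Set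
  DiscSum []            z = ∀ i → z i ≡ 0
  DiscSum ((I , y) ∷ B) z = ∃₂ λ u v → Disc y I u × DiscSum B v × (∀ i → z i ≡ u i + v i)

  Disc-spike : ∀ {N} {I : Subset N} y {j} → j ∈ˢ I → Disc y I (spike (toℕ j) y)
  Disc-spike zero {j} _  i with does (toℕ i ≟ toℕ j)
  ... | true  = refl
  ... | false = refl
  Disc-spike (suc y) {j} j∈ = j , j∈ , _ , Disc-spike y j∈ , spike-suc (toℕ j) y

open LatticePoints

-- Convex hulls and Minkowski sums over an ordered field.

module Convexity {c ℓ₁ ℓ₂ ℓ₃} (F : OrderedField c ℓ₁ ℓ₂ ℓ₃) where

  open import Level using (lift)
  open import Algebra.Apartness.Bundles using (HeytingField)
  import Algebra.Apartness.Properties.HeytingCommutativeRing as HCR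
  open import Algebra.Bundles using (CommutativeRing)
  open import Data.Empty using (⊥)
  open import Data.Fin.Base using (Fin; zero; suc; toℕ; _↑ˡ_; _↑ʳ_; combine; remQuot)
  import Data.Fin.Properties as Fin
  open import Data.Fin.Subset using (Subset) renaming (_∈_ to _∈ˢ_)
  open import Data.Fin.Subset.Properties using (_∈?_)
  open import Data.List.Base using ([]; _∷_)
  open import Data.List.Relation.Unary.All using (All; []; _∷_)
  open import Data.Nat.Base as ℕ using (zero; suc; s≤s)
  open import Data.Product.Base using (_,_; ∃-syntax; ∃₂; proj₁; proj₂)
  open import Data.Sum.Base using (_⊎_; inj₁; inj₂)
  open import Data.Vec.Functional using (Vector)
  open import Function.Base using (_∘_)
  open import Relation.Binary.PropositionalEquality as ≡ using (_≡_)
  import Relation.Binary.Reasoning.Setoid as SetoidReasoning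
  open import Relation.Binary.Structures using (IsStrictPartialOrder)
  open import Relation.Nullary.Decidable using (Dec; yes; no)
  open import Relation.Nullary.Negation.Core using (¬_; contradiction)
  open import Relation.Unary using (Pred; _⊆_)

  open OrderedField F
  open CommutativeRing commutativeRing
    hiding (Carrier; _≈_; 0#; 1#; zero)
  open IsStrictPartialOrder isStrictPartialOrder
    using () renaming (trans to <-trans; irrefl to <-irrefl; <-resp-≈ to <-resp)
  open HCR heytingCommutativeRing using (x-0≈x)
  open import Algebra.Properties.Semiring.Sum semiring
    using (sum-cong-≋; ∑-distrib-+; ∑-comm; *-distribˡ-sum; *-distribʳ-sum; sum-replicate-zero)
  open import Algebra.Properties.Semiring.Mult semiring
    using (×-homo-+; ×-assoc-*; ×-comm-*; ×-congʳ)
  open SetoidReasoning setoid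

  private
    HF = OrderedField.heytingField F

  NonNeg : Carrier → Set ℓ₃
  NonNeg x = 0# ≤ᴷ x

  <-respˡ : ∀ {x y z} → x ≈ y → x <ᴷ z → y <ᴷ z
  <-respˡ = proj₂ <-resp

  <-respʳ : ∀ {x y z} → y ≈ z → x <ᴷ y → x <ᴷ z
  <-respʳ = proj₁ <-resp

  open HeytingField HF using (#-cotrans; #-sym; #⇒invertible; invertible⇒#)
  open import Algebra.Properties.Ring ring using (-‿distribʳ-*)

  NonNeg-resp : ∀ {x y} → x ≈ y → NonNeg x → NonNeg y
  NonNeg-resp x≈y nx y<0 = nx (<-respˡ (sym x≈y) y<0)

  Pos⇒NonNeg : ∀ {x} → 0# <ᴷ x → NonNeg x
  Pos⇒NonNeg 0<x x<0 = <-irrefl refl (<-trans 0<x x<0)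

  NonNeg-0 : NonNeg 0#
  NonNeg-0 = <-irrefl refl

  -- Nonnegativity only denies x < 0, so the signs of x and y cannot be inspected. Cotransitivity
  -- inserts y between x + y and 0, and either comparison that results is refutable.
  NonNeg-+ : ∀ {x y} → NonNeg x → NonNeg y → NonNeg (x + y)
  NonNeg-+ {x} {y} nx ny x+y<0 with #-cotrans (<⇒# x+y<0) y
  ... | inj₁ x+y#y with #⇒<⊎> x+y#y
  ...   | inj₂ y<x+y = ny (<-trans y<x+y x+y<0)
  ...   | inj₁ x+y<y = nx (<-respˡ (trans (+-assoc x y (- y)) (trans (+-congˡ (-‿inverseʳ y)) (+-identityʳ x)))
                          (<-respʳ (-‿inverseʳ y) (+-monoˡ-< (- y) x+y<y)))
  NonNeg-+ {x} {y} nx ny x+y<0 | inj₂ y#0 with #⇒<⊎> y#0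
  ...   | inj₁ y<0 = ny y<0
  ...   | inj₂ 0<y = nx (<-trans (<-respˡ (+-identityˡ x) (<-respʳ (+-comm y x) (+-monoˡ-< x 0<y))) x+y<0)

  unit⇒# : ∀ {x y} → x * y ≈ 1# → x # 0#
  unit⇒# {x} {y} xy≈1 = invertible⇒#
    (y , trans (*-congˡ (x-0≈x x)) (trans (*-comm y x) xy≈1) , trans (*-congʳ (x-0≈x x)) xy≈1)

  -- A negative product is apart from 0, hence invertible, and so are both factors; this apartness
  -- reveals their signs.
  NonNeg-* : ∀ {x y} → NonNeg x → NonNeg y → NonNeg (x * y)
  NonNeg-* {x} {y} nx ny xy<0 with #⇒invertible (<⇒# xy<0)
  ... | i , _ , xyi≈1 = go (#⇒<⊎> (unit⇒# (trans (sym (*-assoc x y i)) xyi)))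
                           (#⇒<⊎> (unit⇒# (trans (sym (*-assoc y x i)) (trans (*-congʳ (*-comm y x)) xyi))))
    where
    xyi : (x * y) * i ≈ 1#
    xyi = trans (*-congʳ (sym (x-0≈x (x * y)))) xyi≈1
    go : x <ᴷ 0# ⊎ 0# <ᴷ x → y <ᴷ 0# ⊎ 0# <ᴷ y → ⊥
    go (inj₁ x<0) _          = nx x<0
    go (inj₂ _)   (inj₁ y<0) = ny y<0
    go (inj₂ 0<x) (inj₂ 0<y) = <-irrefl refl (<-trans (*-pos 0<x 0<y) xy<0)

  sum-NonNeg : ∀ {m} (f : Vector Carrier m) → (∀ i → NonNeg (f i)) → NonNeg (sum f)
  sum-NonNeg {zero}  f nf = NonNeg-0
  sum-NonNeg {suc m} f nf = NonNeg-+ (nf zero) (sum-NonNeg (f ∘ suc) (nf ∘ suc))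

  suc-pos : ∀ k → 0# <ᴷ suc k · 1#
  suc-pos zero    = <-respʳ (sym (+-identityʳ 1#)) 0<1
  suc-pos (suc k) = <-trans (suc-pos k)
    (<-respˡ (+-identityˡ _) (+-monoˡ-< (suc k · 1#) 0<1))

  nat-NonNeg : ∀ k → NonNeg (k · 1#)
  nat-NonNeg zero    = NonNeg-0
  nat-NonNeg (suc k) = Pos⇒NonNeg (suc-pos k)

  -- If the inverse i were negative, then (k + 1)(- i) = - 1 would be a product of positive
  -- elements.
  suc-inverse : ∀ k → ∃[ i ] (suc k · 1#) * i ≈ 1# × NonNeg i
  suc-inverse k with #⇒invertible (#-sym (<⇒# (suc-pos k)))
  ... | i , _ , yi≈1 = i , yi , λ i<0 → <-irrefl refl (<-trans 0<1 (negative i<0))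
    where
    Y = suc k · 1#
    yi : Y * i ≈ 1#
    yi = trans (*-congʳ (sym (x-0≈x Y))) yi≈1
    negative : i <ᴷ 0# → 1# <ᴷ 0#
    negative i<0 = <-respˡ (+-identityˡ 1#) (<-respʳ (-‿inverseˡ 1#) (+-monoˡ-< 1#
      (<-respʳ (trans (sym (-‿distribʳ-* Y i)) (-‿cong yi))
        (*-pos (suc-pos k) (<-respˡ (-‿inverseʳ i) (<-respʳ (+-identityˡ (- i)) (+-monoˡ-< (- i) i<0)))))))

  sum-↑ : ∀ m {n} (f : Vector Carrier (m ℕ.+ n)) →
          sum f ≈ sum (λ i → f (i ↑ˡ n)) + sum (λ j → f (m ↑ʳ j))
  sum-↑ zero    f = sym (+-identityˡ _)
  sum-↑ (suc m) f = trans (+-congˡ (sum-↑ m (f ∘ suc))) (sym (+-assoc _ _ _))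

  sum-combine : ∀ m {n} (f : Vector Carrier (m ℕ.* n)) →
                sum f ≈ sum {m} (λ i → sum {n} (λ j → f (combine i j)))
  sum-combine zero        f = refl
  sum-combine (suc m) {n} f = trans (sum-↑ n f) (+-congˡ (sum-combine m (λ k → f (n ↑ʳ k))))

  sum-remQuot : ∀ {m n} (g : Fin m × Fin n → Carrier) →
                sum (λ k → g (remQuot {m} n k)) ≈ sum (λ i → sum (λ j → g (i , j)))
  sum-remQuot {m} {n} g = trans (sum-combine m (λ k → g (remQuot n k)))
    (sum-cong-≋ λ i → sum-cong-≋ λ j → reflexive (≡.cong g (Fin.remQuot-combine {m} i j)))

  sum-0 : ∀ {m} {f : Vector Carrier m} → (∀ i → f i ≈ 0#) → sum f ≈ 0#
  sum-0 {m} f≈0 = trans (sum-cong-≋ f≈0) (sum-replicate-zero m)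

  sum-e : ∀ {N} (f : Vector Carrier N) c → sum (λ i → f i * e F i c) ≈ f c
  sum-e f zero    = trans (+-cong (*-identityʳ _) (sum-0 λ i → zeroʳ (f (suc i)))) (+-identityʳ _)
  sum-e f (suc c) = trans (+-cong (zeroʳ _) (sum-e (f ∘ suc) c)) (+-identityˡ _)

  module _ {N : ℕ} where

    conv-mono : ∀ {ℓ ℓ′} {S : Pred (Point F N) ℓ} {T : Pred (Point F N) ℓ′} →
                S ⊆ T → conv F S ⊆ conv F T
    conv-mono S⊆T (m , pt , w , s , r) = m , pt , w , (λ j → S⊆T (s j)) , r

    -- The same weights serve for both summands.
    conv-split : ∀ {ℓ ℓ₁′ ℓ₂′} {S : Pred (Point F N) ℓ} {A : Pred (Point F N) ℓ₁′}
                 {B : Pred (Point F N) ℓ₂′} →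
                 (∀ {x} → S x → ∃₂ λ u v → A u × B v × (∀ i → x i ≈ u i + v i)) →
                 ∀ {x} → conv F S x →
                 ∃₂ λ u v → conv F A u × conv F B v × (∀ i → x i ≈ u i + v i)
    conv-split f (m , pt , w , s , w≥0 , Σw , eq) =
        _ , _
      , (m , (λ j → proj₁ (f (s j))) , w , (λ j → proj₁ (proj₂ (proj₂ (f (s j))))) , w≥0 , Σw , λ _ → refl)
      , (m , (λ j → proj₁ (proj₂ (f (s j)))) , w
          , (λ j → proj₁ (proj₂ (proj₂ (proj₂ (f (s j)))))) , w≥0 , Σw , λ _ → refl)
      , λ i → trans (eq i) (trans
          (sum-cong-≋ λ j → trans (*-congˡ (proj₂ (proj₂ (proj₂ (proj₂ (f (s j))))) i)) (distribˡ (w j) _ _))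
          (∑-distrib-+ (λ j → w j * proj₁ (f (s j)) i) (λ j → w j * proj₁ (proj₂ (f (s j))) i)))

    -- The sum of two convex combinations is the combination of all pairwise sums with the product
    -- weights; `remQuot` flattens the index set of pairs.
    conv-+ : ∀ {ℓ ℓ₁′ ℓ₂′} {S : Pred (Point F N) ℓ} {A : Pred (Point F N) ℓ₁′}
             {B : Pred (Point F N) ℓ₂′} →
             (∀ {u v} → A u → B v → S (λ i → u i + v i)) →
             ∀ {x u v} → conv F A u → conv F B v → (∀ i → x i ≈ u i + v i) → conv F S x
    conv-+ f {x} {u} {v} (m , pt , w , s , w≥0 , Σw , eq) (m′ , pt′ , w′ , s′ , w′≥0 , Σw′ , eq′) x≈ =
        m ℕ.* m′
      , (λ k i → pt (proj₁ (rq k)) i + pt′ (proj₂ (rq k)) i)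
      , (λ k → w (proj₁ (rq k)) * w′ (proj₂ (rq k)))
      , (λ k → f (s (proj₁ (rq k))) (s′ (proj₂ (rq k))))
      , (λ k → NonNeg-* (w≥0 (proj₁ (rq k))) (w′≥0 (proj₂ (rq k))))
      , total
      , λ i → trans (x≈ i) (sym (coordinate i))
      where
      rq : Fin (m ℕ.* m′) → Fin m × Fin m′
      rq = remQuot {m} m′

      total : sum (λ k → w (proj₁ (rq k)) * w′ (proj₂ (rq k))) ≈ 1#
      total = begin
        sum (λ k → w (proj₁ (rq k)) * w′ (proj₂ (rq k))) ≈⟨ sum-remQuot (λ (j , k) → w j * w′ k) ⟩
        sum (λ j → sum (λ k → w j * w′ k))               ≈⟨ sum-cong-≋ (λ j → *-distribˡ-sum (w j) w′) ⟨
        sum (λ j → w j * sum w′)                         ≈⟨ *-distribʳ-sum (sum w′) w ⟨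
        sum w * sum w′                                   ≈⟨ *-cong Σw Σw′ ⟩
        1# * 1#                                          ≈⟨ *-identityˡ 1# ⟩
        1#                                               ∎

      expand : ∀ j k i → (w j * w′ k) * (pt j i + pt′ k i) ≈ (w j * pt j i) * w′ k + w j * (w′ k * pt′ k i)
      expand j k i = begin
        (w j * w′ k) * (pt j i + pt′ k i)                   ≈⟨ distribˡ _ _ _ ⟩
        (w j * w′ k) * pt j i + (w j * w′ k) * pt′ k i      ≈⟨ +-cong (*-assoc _ _ _) (*-assoc _ _ _) ⟩
        w j * (w′ k * pt j i) + w j * (w′ k * pt′ k i)      ≈⟨ +-congʳ (*-congˡ (*-comm _ _)) ⟩
        w j * (pt j i * w′ k) + w j * (w′ k * pt′ k i)      ≈⟨ +-congʳ (*-assoc _ _ _) ⟨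
        (w j * pt j i) * w′ k + w j * (w′ k * pt′ k i)      ∎

      row : ∀ j i → sum (λ k → (w j * w′ k) * (pt j i + pt′ k i)) ≈ w j * pt j i + w j * v i
      row j i = begin
        sum (λ k → (w j * w′ k) * (pt j i + pt′ k i))
          ≈⟨ sum-cong-≋ (λ k → expand j k i) ⟩
        sum (λ k → (w j * pt j i) * w′ k + w j * (w′ k * pt′ k i))
          ≈⟨ ∑-distrib-+ (λ k → (w j * pt j i) * w′ k) (λ k → w j * (w′ k * pt′ k i)) ⟩
        sum (λ k → (w j * pt j i) * w′ k) + sum (λ k → w j * (w′ k * pt′ k i))
          ≈⟨ +-cong (*-distribˡ-sum (w j * pt j i) w′) (*-distribˡ-sum (w j) (λ k → w′ k * pt′ k i)) ⟨
        (w j * pt j i) * sum w′ + w j * sum (λ k → w′ k * pt′ k i)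
          ≈⟨ +-cong (trans (*-congˡ Σw′) (*-identityʳ _)) (*-congˡ (sym (eq′ i))) ⟩
        w j * pt j i + w j * v i ∎

      coordinate : ∀ i → sum (λ k → (w (proj₁ (rq k)) * w′ (proj₂ (rq k))) *
                                    (pt (proj₁ (rq k)) i + pt′ (proj₂ (rq k)) i)) ≈ u i + v i
      coordinate i = begin
        _ ≈⟨ sum-remQuot (λ (j , k) → (w j * w′ k) * (pt j i + pt′ k i)) ⟩
        sum (λ j → sum (λ k → (w j * w′ k) * (pt j i + pt′ k i))) ≈⟨ sum-cong-≋ (λ j → row j i) ⟩
        sum (λ j → w j * pt j i + w j * v i)                      ≈⟨ ∑-distrib-+ (λ j → w j * pt j i) (λ j → w j * v i) ⟩
        sum (λ j → w j * pt j i) + sum (λ j → w j * v i)          ≈⟨ +-cong (eq i) (*-distribʳ-sum (v i) w) ⟨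
        u i + sum w * v i                                         ≈⟨ +-congˡ (trans (*-congʳ Σw) (*-identityˡ _)) ⟩
        u i + v i                                                 ∎

    ⟦_⟧ : (Fin N → ℕ) → Point F N
    ⟦ z ⟧ i = z i · 1#

    Lattice : ∀ {ℓ} → Pred (Fin N → ℕ) ℓ → Pred (Point F N) _
    Lattice Z x = ∃[ z ] Z z × (∀ i → x i ≈ ⟦ z ⟧ i)

    ⟦⟧-resp : ∀ {z z′ : Fin N → ℕ} → (∀ i → z i ≡ z′ i) → ∀ i → ⟦ z ⟧ i ≈ ⟦ z′ ⟧ i
    ⟦⟧-resp eq i = reflexive (≡.cong (_· 1#) (eq i))

    ⟦⟧-trans : ∀ {x : Point F N} {z z′ : Fin N → ℕ} →
               (∀ i → x i ≈ ⟦ z ⟧ i) → (∀ i → z i ≡ z′ i) → ∀ i → x i ≈ ⟦ z′ ⟧ i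
    ⟦⟧-trans x≈ eq i = trans (x≈ i) (⟦⟧-resp eq i)

    ⟦⟧-+ : ∀ (z u v : Fin N → ℕ) → (∀ i → z i ≡ u i ℕ.+ v i) → ∀ i → ⟦ z ⟧ i ≈ ⟦ u ⟧ i + ⟦ v ⟧ i
    ⟦⟧-+ z u v eq i = trans (⟦⟧-resp eq i) (×-homo-+ 1# (u i) (v i))

    spike-e : ∀ y (j i : Fin N) → spike (toℕ j) y i · 1# ≈ y · e F j i
    spike-e y j i with j Fin.≟ i
    ... | yes ≡.refl = reflexive (≡.cong (_· 1#) (spike-≡ {x = y} j ≡.refl))
    ... | no  j≢i    = trans (reflexive (≡.cong (_· 1#) (spike-≢ {x = y} i (λ eq → j≢i (Fin.toℕ-injective (≡.sym eq))))))
      (sym (·-0 y))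
      where
      ·-0 : ∀ k → k · 0# ≈ 0#
      ·-0 zero    = refl
      ·-0 (suc k) = trans (+-identityˡ _) (·-0 k)

    -- The dilated corners y e_j are themselves lattice points of the dilated simplex, so the
    -- weights can be kept.
    dilate⊆conv : ∀ y (I : Subset N) → dilate F y (Δ F I) ⊆ conv F (Lattice (Disc y I))
    dilate⊆conv y I {x} (pt , (m , t , w , t∈ , w≥0 , Σw , eq) , x≈) =
      m , (λ j → ⟦ spike (toℕ (proj₁ (t∈ j))) y ⟧) , w
        , (λ j → _ , Disc-spike y (proj₁ (proj₂ (t∈ j))) , λ _ → refl) , w≥0 , Σw , λ c → begin
            x c                                      ≈⟨ x≈ c ⟩
            y · pt c                                 ≈⟨ ×-congʳ y (eq c) ⟩
            y · sum (λ j → w j * t j c)              ≈⟨ ·-sum y (λ j → w j * t j c) ⟩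
            sum (λ j → y · (w j * t j c))            ≈⟨ sum-cong-≋ (λ j → ×-comm-* y (w j) (t j c)) ⟨
            sum (λ j → w j * (y · t j c))            ≈⟨ sum-cong-≋ (λ j → *-congˡ (×-congʳ y (proj₂ (proj₂ (t∈ j)) c))) ⟩
            sum (λ j → w j * (y · e F (proj₁ (t∈ j)) c))
              ≈⟨ sum-cong-≋ (λ j → *-congˡ (spike-e y (proj₁ (t∈ j)) c)) ⟨
            sum (λ j → w j * ⟦ spike (toℕ (proj₁ (t∈ j))) y ⟧ c) ∎
      where
      ·-sum : ∀ k {m} (f : Vector Carrier m) → k · sum f ≈ sum (λ j → k · f j)
      ·-sum zero    {m} f = sym (sum-0 {m} (λ _ → refl))
      ·-sum (suc k) f = trans (+-congˡ (·-sum k f)) (sym (∑-distrib-+ f (λ j → k · f j)))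

    Disc-outside : ∀ y {I : Subset N} {z} → Disc y I z → ∀ {i} → ¬ (i ∈ˢ I) → z i ≡ 0
    Disc-outside zero    z≡0                 _  = z≡0 _
    Disc-outside (suc y) (j , j∈ , u , du , eq) {i} i∉ = ≡.trans (eq i)
      (≡.cong₂ ℕ._+_ (spike-≢ i (λ i≡j → i∉ (≡.subst (_∈ˢ _) (Fin.toℕ-injective (≡.sym i≡j)) j∈)))
                     (Disc-outside y du i∉))

    Disc-total : ∀ y {I : Subset N} {z} → Disc y I z → sum ⟦ z ⟧ ≈ y · 1#
    Disc-total zero    z≡0 = sum-0 (λ i → reflexive (≡.cong (_· 1#) (z≡0 i)))
    Disc-total (suc y) {z = z} (j , _ , u , du , eq) = begin
      sum ⟦ z ⟧                                   ≈⟨ sum-cong-≋ (⟦⟧-+ z (spike (toℕ j) 1) u eq) ⟩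
      sum (λ i → ⟦ spike (toℕ j) 1 ⟧ i + ⟦ u ⟧ i) ≈⟨ ∑-distrib-+ ⟦ spike (toℕ j) 1 ⟧ ⟦ u ⟧ ⟩
      sum ⟦ spike (toℕ j) 1 ⟧ + sum ⟦ u ⟧         ≈⟨ +-cong one (Disc-total y du) ⟩
      1# + y · 1#                                 ∎
      where
      e-sym : ∀ i → e F j i ≈ 1# * e F i j
      e-sym i with j Fin.≟ i | i Fin.≟ j
      ... | yes _      | yes _      = sym (*-identityʳ 1#)
      ... | no  _      | no  _      = sym (zeroʳ 1#)
      ... | yes ≡.refl | no  i≢j    = contradiction ≡.refl i≢j
      ... | no  j≢i    | yes ≡.refl = contradiction ≡.refl j≢i
      one : sum ⟦ spike (toℕ j) 1 ⟧ ≈ 1#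
      one = trans (sum-cong-≋ λ i → trans (spike-e 1 j i) (trans (+-identityʳ _) (e-sym i)))
                  (sum-e (λ _ → 1#) j)

    -- A point of the hull has nonnegative coordinates with sum y that vanish
    -- outside I; divided by y these are barycentric coordinates in Δ_I.
    conv⊆dilate : ∀ y (I : Subset N) → conv F (Lattice (Disc (suc y) I)) ⊆ dilate F (suc y) (Δ F I)
    conv⊆dilate y I {x} (zero  , _ , _ , _ , _ , 0≈1 , _) = contradiction 0<1 (<-irrefl 0≈1)
    conv⊆dilate y I {x} (suc m , pt , w , pt∈ , w≥0 , Σw , eq) =
      (λ c → x c * Y⁻¹) , (N , t , (λ i → x i * Y⁻¹) , t∈ , (λ i → NonNeg-* (x≥0 i) Y⁻¹≥0) , total , point-≈)
      , λ c → sym (begin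
          suc y · (x c * Y⁻¹)         ≈⟨ ×-congʳ (suc y) (*-identityˡ _) ⟨
          suc y · (1# * (x c * Y⁻¹))  ≈⟨ ×-assoc-* (suc y) 1# _ ⟨
          Y * (x c * Y⁻¹)             ≈⟨ *-congˡ (*-comm _ _) ⟩
          Y * (Y⁻¹ * x c)             ≈⟨ *-assoc _ _ _ ⟨
          (Y * Y⁻¹) * x c             ≈⟨ *-congʳ YY⁻¹ ⟩
          1# * x c                    ≈⟨ *-identityˡ _ ⟩
          x c                         ∎)
      where
      Y = suc y · 1#
      Y⁻¹ = proj₁ (suc-inverse y)
      YY⁻¹ : Y * Y⁻¹ ≈ 1#
      YY⁻¹ = proj₁ (proj₂ (suc-inverse y))
      Y⁻¹≥0 = proj₂ (proj₂ (suc-inverse y))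

      z : Fin (suc m) → Fin N → ℕ
      z j = proj₁ (pt∈ j)

      x≈ : ∀ i → x i ≈ sum (λ j → w j * ⟦ z j ⟧ i)
      x≈ i = trans (eq i) (sum-cong-≋ λ j → *-congˡ {w j} (proj₂ (proj₂ (pt∈ j)) i))

      x≥0 : ∀ i → NonNeg (x i)
      x≥0 i = NonNeg-resp (sym (x≈ i))
        (sum-NonNeg (λ j → w j * ⟦ z j ⟧ i) (λ j → NonNeg-* {w j} (w≥0 j) (nat-NonNeg (z j i))))

      x-outside : ∀ i → ¬ (i ∈ˢ I) → x i ≈ 0#
      x-outside i i∉ = trans (x≈ i) (sum-0 λ j → trans
        (*-congˡ (reflexive (≡.cong (_· 1#) (Disc-outside (suc y) (proj₁ (proj₂ (pt∈ j))) i∉)))) (zeroʳ (w j)))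

      Σx : sum x ≈ Y
      Σx = begin
        sum x                                       ≈⟨ sum-cong-≋ x≈ ⟩
        sum (λ i → sum (λ j → w j * ⟦ z j ⟧ i))     ≈⟨ ∑-comm (λ i j → w j * ⟦ z j ⟧ i) ⟩
        sum (λ j → sum (λ i → w j * ⟦ z j ⟧ i))     ≈⟨ sum-cong-≋ (λ j → *-distribˡ-sum (w j) ⟦ z j ⟧) ⟨
        sum (λ j → w j * sum ⟦ z j ⟧)
          ≈⟨ sum-cong-≋ (λ j → *-congˡ {w j} (Disc-total (suc y) (proj₁ (proj₂ (pt∈ j))))) ⟩
        sum (λ j → w j * Y)                         ≈⟨ *-distribʳ-sum Y w ⟨
        sum w * Y                                   ≈⟨ trans (*-congʳ Σw) (*-identityˡ Y) ⟩
        Y                                           ∎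

      total : sum (λ i → x i * Y⁻¹) ≈ 1#
      total = trans (sym (*-distribʳ-sum Y⁻¹ x)) (trans (*-congʳ Σx) YY⁻¹)

      some : ∃[ i ] i ∈ˢ I
      some = let j , j∈ , _ = proj₁ (proj₂ (pt∈ zero)) in j , j∈

      -- Weights are indexed by all coordinates. For i outside I the weight vanishes, so any fixed
      -- corner of Δ_I can stand in for e_i.
      corner : ∀ i → Dec (i ∈ˢ I) → Fin N
      corner i (yes _) = i
      corner i (no  _) = proj₁ some

      t : Fin N → Point F N
      t i = e F (corner i (i ∈? I))

      t∈ : ∀ i → ∃[ j ] j ∈ˢ I × _≋_ F (t i) (e F j)
      t∈ i = corner i (i ∈? I) , corner-∈ (i ∈? I) , λ _ → refl
        where
        corner-∈ : (i∈? : Dec (i ∈ˢ I)) → corner i i∈? ∈ˢ I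
        corner-∈ (yes i∈) = i∈
        corner-∈ (no  _)  = proj₂ some

      point-≈ : ∀ c → x c * Y⁻¹ ≈ sum (λ i → (x i * Y⁻¹) * t i c)
      point-≈ c = sym (trans (sum-cong-≋ λ i → same i (i ∈? I)) (sum-e (λ i → x i * Y⁻¹) c))
        where
        same : ∀ i (i∈? : Dec (i ∈ˢ I)) → (x i * Y⁻¹) * e F (corner i i∈?) c ≈ (x i * Y⁻¹) * e F i c
        same i (yes _)  = refl
        same i (no  i∉) = trans (*-congʳ xi≈0) (trans (zeroˡ _) (sym (trans (*-congʳ xi≈0) (zeroˡ _))))
          where
          xi≈0 : x i * Y⁻¹ ≈ 0#
          xi≈0 = trans (*-congʳ (x-outside i i∉)) (zeroˡ Y⁻¹)

    -- One summand is split off at a time; positivity of its label is what lets `conv⊆dilate` divide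
    -- by it.
    conv⊆ΣyΔ : ∀ {B : List (Subset N × ℕ)} → All (λ v → 1 ℕ.≤ proj₂ v) B →
               conv F (Lattice (DiscSum B)) ⊆ ΣyΔ F B
    conv⊆ΣyΔ [] (m , pt , w , pt∈ , _ , _ , eq) = lift λ i → trans (eq i) (sum-0 λ j →
      trans (*-congˡ (trans (proj₂ (proj₂ (pt∈ j)) i) (reflexive (≡.cong (_· 1#) (proj₁ (proj₂ (pt∈ j)) i)))))
            (zeroʳ (w j)))
    conv⊆ΣyΔ {(I , suc y) ∷ B} (s≤s _ ∷ 1≤) x∈
      with conv-split {S = Lattice (DiscSum ((I , suc y) ∷ B))} {Lattice (Disc (suc y) I)} {Lattice (DiscSum B)}
             (λ (z , (u , v , du , s , eq) , x≈) → ⟦ u ⟧ , ⟦ v ⟧ , (u , du , λ _ → refl) , (v , s , λ _ → refl)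
               , λ i → trans (x≈ i) (⟦⟧-+ z u v eq i)) x∈
    ... | u , v , u∈ , v∈ , x≈ = u , v , conv⊆dilate y I u∈ , conv⊆ΣyΔ 1≤ v∈ , x≈

    ΣyΔ⊆conv : ∀ (B : List (Subset N × ℕ)) → ΣyΔ F B ⊆ conv F (Lattice (DiscSum B))
    ΣyΔ⊆conv [] (lift x≈0) = 1 , (λ _ _ → 0#) , (λ _ → 1#) , (λ _ → (λ _ → 0) , (λ _ → ≡.refl) , λ _ → refl)
      , (λ _ → Pos⇒NonNeg 0<1) , +-identityʳ 1# , λ i → trans (x≈0 i) (sym (trans (+-identityʳ _) (zeroʳ 1#)))
    ΣyΔ⊆conv ((I , y) ∷ B) (u , v , u∈ , v∈ , x≈) =
      conv-+ {S = Lattice (DiscSum ((I , y) ∷ B))} {Lattice (Disc y I)} {Lattice (DiscSum B)}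
             (λ (a , da , u≈) (b , sb , v≈) → (λ i → a i ℕ.+ b i) , (a , b , da , sb , λ _ → ≡.refl)
               , λ i → trans (+-cong (u≈ i) (v≈ i)) (sym (×-homo-+ 1# (a i) (b i))))
             (dilate⊆conv y I u∈) (ΣyΔ⊆conv B v∈) x≈

open import Data.Bool.Base using (true; false)
open import Data.Empty using (⊥; ⊥-elim)
open import Data.Fin.Base using (Fin; zero; suc; toℕ; fromℕ<) renaming (_<_ to _<ᶠ_)
import Data.Fin.Properties as Fin
open import Data.Fin.Properties using (toℕ<n; toℕ-injective; toℕ-fromℕ<)
open import Data.Fin.Subset using (Subset) renaming (_∈_ to _∈ˢ_)
open import Data.Fin.Subset.Properties using (x∈p∪q⁻; x∈p∪q⁺)
open import Data.List.Base using ([]; _∷_; _++_; [_]; length; map; lookup; filter; allFin; tabulate)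
open import Data.List.Membership.Propositional using (_∈_)
open import Data.List.Membership.Propositional.Properties
  using (∈-++⁺ˡ; ∈-++⁺ʳ; ∈-++⁻; ∈-∃++; ∈-map⁺; ∈-map⁻; ∈-insert; ∈-filter⁺; ∈-filter⁻; ∈-lookup; ∈-allFin; ∈-tabulate⁺; ∈-tabulate⁻)
open import Data.List.Properties using (++-assoc; length-++; map-++; length-map; ∷-injective; length-tabulate)
open import Data.List.Relation.Unary.All as All using (All; []; _∷_)
import Data.List.Relation.Unary.All.Properties as All
open import Data.List.Relation.Unary.AllPairs as AllPairs using (AllPairs; []; _∷_)
import Data.List.Relation.Unary.AllPairs.Properties as AllPairs
open import Data.List.Relation.Unary.Any using (here; there; index)
open import Data.List.Relation.Unary.Any.Properties using (lookup-index)
open import Data.List.Relation.Unary.Unique.Propositional using (Unique)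
open import Data.Nat.Base using (zero; suc; pred; _+_; _∸_; _⊔_; _≤_; _<_; z≤n; s≤s; >-nonZero)
open import Data.Nat.ListAction using (sum)
open import Data.Nat.Properties
open import Data.Product.Base using (_,_; ∃; ∃-syntax; ∃₂; Σ-syntax; proj₁; proj₂)
open import Data.Sum.Base using (_⊎_; inj₁; inj₂; [_,_]′)
open import Data.Unit.Base using (⊤; tt)
open import Data.Vec.Properties using ([]=⇒lookup; lookup⇒[]=; lookup∘tabulate)
open import Function.Base using (_∘_; id; case_of_)
open import Function.Bundles using (_⇔_; mk⇔; Equivalence)
open import Relation.Binary.Construct.Closure.ReflexiveTransitive using (Star; ε; _◅_; _◅◅_; gmap)
open import Relation.Binary.Definitions using (tri<; tri≈; tri>)
open import Relation.Binary.PropositionalEquality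
  using (_≡_; _≢_; refl; sym; trans; cong; cong₂; subst; subst₂)
open import Relation.Nullary.Decidable using (Dec; yes; no; does; dec-true; ¬?; _×-dec_)
open import Relation.Nullary.Negation.Core using (¬_; contradiction)
open import Relation.Unary using (_⊆_)

-- Unit increments, ascending lists, and words continued past their end.

data Inc : List ℕ → List ℕ → Set where
  here  : ∀ {x xs} → Inc (x ∷ xs) (suc x ∷ xs)
  there : ∀ {x xs ys} → Inc xs ys → Inc (x ∷ xs) (x ∷ ys)

Inc-++⁺ˡ : ∀ {xs xs′} ys → Inc xs xs′ → Inc (xs ++ ys) (xs′ ++ ys)
Inc-++⁺ˡ ys here      = here
Inc-++⁺ˡ ys (there i) = there (Inc-++⁺ˡ ys i)

Inc-++⁺ʳ : ∀ xs {ys ys′} → Inc ys ys′ → Inc (xs ++ ys) (xs ++ ys′)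
Inc-++⁺ʳ []       i = i
Inc-++⁺ʳ (x ∷ xs) i = there (Inc-++⁺ʳ xs i)

Inc-++⁻ : ∀ xs {ys zs} → Inc (xs ++ ys) zs →
          (∃[ xs′ ] Inc xs xs′ × zs ≡ xs′ ++ ys) ⊎
          (∃[ ys′ ] Inc ys ys′ × zs ≡ xs ++ ys′)
Inc-++⁻ []       i    = inj₂ (_ , i , refl)
Inc-++⁻ (x ∷ xs) here = inj₁ (_ , here , refl)
Inc-++⁻ (x ∷ xs) (there i) with Inc-++⁻ xs i
... | inj₁ (_ , j , refl) = inj₁ (_ , there j , refl)
... | inj₂ (_ , j , refl) = inj₂ (_ , j , refl)

Ascending : List ℕ → Set
Ascending = AllPairs _<_

ascending-++⁻ : ∀ xs {ys} → Ascending (xs ++ ys) →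
                Ascending xs × Ascending ys × (∀ {x y} → x ∈ xs → y ∈ ys → x < y)
ascending-++⁻ []       a       = [] , a , λ ()
ascending-++⁻ (x ∷ xs) (h ∷ a) with ascending-++⁻ xs a
... | a₁ , a₂ , c = All.++⁻ˡ xs h ∷ a₁ , a₂ , λ where
  (here refl) y∈ → All.lookup (All.++⁻ʳ xs h) y∈
  (there x∈)  y∈ → c x∈ y∈

-- Identifies lists that arise in different ways, such as a color class found by recursion and the
-- positions filtered out of the plot.
ascending-ext : ∀ {xs ys} → Ascending xs → Ascending ys →
                (∀ {x} → x ∈ xs → x ∈ ys) → (∀ {x} → x ∈ ys → x ∈ xs) → xs ≡ ys
ascending-ext []      []      f g = refl
ascending-ext []      (_ ∷ _) f g = case g (here refl) of λ ()
ascending-ext (_ ∷ _) []      f g = case f (here refl) of λ ()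
ascending-ext {x ∷ xs} {y ∷ ys} (a ∷ as) (b ∷ bs) f g =
  cong₂ _∷_ x≡y (ascending-ext as bs
    (λ z∈ → tail-∈ (All.lookup a z∈) (f (there z∈)) (sym x≡y))
    (λ z∈ → tail-∈ (All.lookup b z∈) (g (there z∈)) x≡y))
  where
  x≡y : x ≡ y
  x≡y with f (here refl) | g (here refl)
  ... | here e   | _        = e
  ... | there _  | here e   = sym e
  ... | there x∈ | there y∈ = contradiction (All.lookup a y∈) (<-asym (All.lookup b x∈))
  tail-∈ : ∀ {u v z zs} → u < z → z ∈ v ∷ zs → v ≡ u → z ∈ zs
  tail-∈ u<z (here refl) refl = contradiction u<z (n≮n _)
  tail-∈ u<z (there z∈)  _    = z∈

split-length : ∀ s t (τ : List ℕ) → suc s + t ≡ length τ →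
               ∃[ τ₁ ] ∃[ y ] ∃[ τ₂ ] τ ≡ τ₁ ++ y ∷ τ₂ × t ≡ length τ₁ × s ≡ length τ₂
split-length s t       []      ()
split-length s zero    (x ∷ τ) e = [] , x , τ , refl , refl , trans (sym (+-identityʳ s)) (suc-injective e)
split-length s (suc t) (x ∷ τ) e
  with split-length s t τ (trans (sym (+-suc s t)) (suc-injective e))
... | τ₁ , y , τ₂ , refl , e₁ , e₂ = x ∷ τ₁ , y , τ₂ , refl , cong suc e₁ , e₂

maximum : ∀ τ → 1 ≤ length τ → ∃[ z ] z ∈ τ × (∀ {x} → x ∈ τ → x ≤ z)
maximum (x ∷ [])    _ = x , here refl , λ { (here refl) → ≤-refl }
maximum (x ∷ y ∷ τ) _ with maximum (y ∷ τ) (s≤s z≤n)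
... | z , z∈ , z-max with ≤-total x z
... | inj₁ x≤z = z , there z∈ , λ { (here refl) → x≤z ; (there w∈) → z-max w∈ }
... | inj₂ z≤x = x , here refl , λ { (here refl) → ≤-refl ; (there w∈) → ≤-trans (z-max w∈) z≤x }

length-insert : ∀ τ₁ {y : ℕ} {τ₂} → suc (length τ₂) + length τ₁ ≡ length (τ₁ ++ y ∷ τ₂)
length-insert τ₁ {y} {τ₂} =
  trans (+-comm (suc (length τ₂)) (length τ₁)) (sym (length-++ τ₁))

-- Junk entries beyond the end continue the word by base, base + 1, ….
at : List ℕ → ℕ → ℕ → ℕ
at []       base i       = base + i
at (x ∷ xs) base zero    = x
at (x ∷ xs) base (suc i) = at xs base i

at-lookup : ∀ xs {base} i → at xs base (toℕ i) ≡ lookup xs i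
at-lookup (x ∷ xs) zero    = refl
at-lookup (x ∷ xs) (suc i) = at-lookup xs i

at-∈ : ∀ xs {base i} → i < length xs → at xs base i ∈ xs
at-∈ (x ∷ xs) {i = zero}  _         = here refl
at-∈ (x ∷ xs) {i = suc i} (s≤s i<n) = there (at-∈ xs i<n)

at-≥ : ∀ xs {base i} → length xs ≤ i → at xs base i ≡ base + (i ∸ length xs)
at-≥ []       _         = refl
at-≥ (x ∷ xs) (s≤s n≤i) = at-≥ xs n≤i

at-∉ : ∀ {x xs base} → All (x ≢_) xs → x < base → ∀ j → x ≢ at xs base j
at-∉ {xs = xs} u x<b j eq with <-≤-connex j (length xs)
... | inj₁ j<n = All.lookup u (at-∈ xs j<n) eq
... | inj₂ n≤j = <⇒≱ x<b (≤-trans (m≤m+n _ _) (≤-reflexive (sym (trans eq (at-≥ xs n≤j)))))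

at-injective : ∀ {xs base} → Unique xs → All (_< base) xs →
               ∀ {i j} → at xs base i ≡ at xs base j → i ≡ j
at-injective {[]}     {base} _ _ eq = +-cancelˡ-≡ base _ _ eq
at-injective {x ∷ xs} _ _ {zero}  {zero}  _ = refl
at-injective {x ∷ xs} (u ∷ _) (x<b ∷ _) {zero} {suc j} eq = contradiction eq (at-∉ u x<b j)
at-injective {x ∷ xs} (u ∷ _) (x<b ∷ _) {suc i} {zero} eq = contradiction (sym eq) (at-∉ u x<b i)
at-injective {x ∷ xs} (_ ∷ u) (_ ∷ b) {suc i} {suc j} eq = cong suc (at-injective u b eq)

∈⇒≤sum : ∀ {x xs} → x ∈ xs → x ≤ sum xs
∈⇒≤sum (here refl)                = m≤m+n _ _
∈⇒≤sum {xs = y ∷ _} (there x∈)    = ≤-trans (∈⇒≤sum x∈) (m≤n+m _ y)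

AllPairs-lookup : ∀ {A : Set} {R : A → A → Set} {xs} → AllPairs R xs →
                  ∀ {i j} → i <ᶠ j → R (lookup xs i) (lookup xs j)
AllPairs-lookup (a ∷ _)  {zero}  {suc j} _         = All.lookup a (∈-lookup j)
AllPairs-lookup (_ ∷ as) {suc i} {suc j} (s≤s i<j) = AllPairs-lookup as i<j

at-beyond : ∀ xs {base i j} → All (_< base) xs → i < j → length xs ≤ j →
            at xs base i < at xs base j
at-beyond xs {base} {i} {j} xs< i<j n≤j with <-≤-connex i (length xs)
... | inj₁ i<n = <-≤-trans (All.lookup xs< (at-∈ xs i<n))
  (≤-trans (m≤m+n base _) (≤-reflexive (sym (at-≥ xs n≤j))))
... | inj₂ n≤i = subst₂ _<_ (sym (at-≥ xs n≤i)) (sym (at-≥ xs n≤j))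
  (+-monoʳ-< base (∸-monoˡ-< i<j n≤i))

map-≡-tabulate : ∀ {A : Set} {N} (xs : List A) {f g : A → ℕ} {u v : Fin N → ℕ} →
                 map f xs ≡ tabulate u → (∀ {x i} → x ∈ xs → f x ≡ u i → g x ≡ v i) →
                 map g xs ≡ tabulate v
map-≡-tabulate {N = zero}  []       eq _ = refl
map-≡-tabulate {N = suc N} (x ∷ xs) eq F with ∷-injective eq
... | eq₁ , eq₂ = cong₂ _∷_ (F (here refl) eq₁) (map-≡-tabulate xs eq₂ (F ∘ there))

key-unique : ∀ {A : Set} {xs : List (ℕ × A)} {k a b} → Ascending (map proj₁ xs) →
             (k , a) ∈ xs → (k , b) ∈ xs → a ≡ b
key-unique asc        (here refl) (here refl) = refl
key-unique (lt ∷ _)   (here refl) (there b∈)  = contradiction (All.lookup lt (∈-map⁺ proj₁ b∈)) (n≮n _)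
key-unique (lt ∷ _)   (there a∈)  (here refl) = contradiction (All.lookup lt (∈-map⁺ proj₁ a∈)) (n≮n _)
key-unique (_ ∷ asc)  (there a∈)  (there b∈)  = key-unique asc a∈ b∈

-- Compositions credited by a labeled tree, and their invariance under contraction.

Incs : ℕ → List ℕ → List ℕ → Set
Incs zero    xs ys = xs ≡ ys
Incs (suc k) xs ys = ∃[ zs ] Incs k xs zs × Inc zs ys

-- The compositions that arise from t when each right-only vertex, and each
-- unit of the label of a full vertex, is credited to any leaf below it.
Credit : BinTree ℕ → List ℕ → Set
Credit (leaf y)       r = r ≡ [ y ]
Credit (nodeL _ t)    r = Credit t r
Credit (nodeR _ t)    r = ∃[ r₀ ] Credit t r₀ × Inc r₀ r
Credit (nodeLR y t u) r = ∃₂ λ r₁ r₂ → Credit t r₁ × Credit u r₂ × Incs y (r₁ ++ r₂) r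

-- No vertex has only a left child: such a vertex could never be contracted away. Trees Θ(H) are of
-- this kind, because the point just before a northeast endpoint is lower than it and hence its
-- right child.
data NoL {A : Set} : BinTree A → Set where
  leaf   : ∀ {x} → NoL (leaf x)
  nodeR  : ∀ {x t} → NoL t → NoL (nodeR x t)
  nodeLR : ∀ {x t u} → NoL t → NoL u → NoL (nodeLR x t u)

relabel-NoL : ∀ {A : Set} {t : BinTree A} → NoL t → NoL (relabel t)
relabel-NoL leaf         = leaf
relabel-NoL (nodeR t)    = nodeR (relabel-NoL t)
relabel-NoL (nodeLR t u) = nodeLR (relabel-NoL t) (relabel-NoL u)

contraction : ∀ {t} → NoL t → ∃[ T ] Star _⇝_ t T × Full T
contraction leaf = _ , ε , leaf
contraction (nodeR t) with contraction t
... | _ , s , leaf       = _ , gmap _ in-R s ◅◅ (contract-leaf ◅ ε) , leaf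
... | _ , s , nodeLR l r = _ , gmap _ in-R s ◅◅ (contract-LR ◅ ε) , nodeLR l r
contraction (nodeLR t u) with contraction t | contraction u
... | _ , s , f | _ , s′ , f′ = _ , gmap _ in-LRˡ s ◅◅ gmap _ in-LRʳ s′ , nodeLR f f′

-- A contraction only changes where a unit is recorded: the `Inc` of a right-only vertex becomes one
-- more unit in the label of its child, and both vertices have the same leaves below them.
Credit-⇝ : ∀ {t t′} → t ⇝ t′ → ∀ {r} → Credit t r ⇔ Credit t′ r
Credit-⇝ contract-leaf = mk⇔ (λ { (_ , refl , here) → refl }) (λ { refl → _ , refl , here })
Credit-⇝ contract-LR   = mk⇔
  (λ (_ , (r₁ , r₂ , a , b , i) , j) → r₁ , r₂ , a , b , _ , i , j)
  (λ (r₁ , r₂ , a , b , _ , i , j) → _ , (r₁ , r₂ , a , b , i) , j)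
Credit-⇝ (in-L s)   = Credit-⇝ s
Credit-⇝ (in-R s)   = mk⇔
  (λ (_ , a , i) → _ , Equivalence.to (Credit-⇝ s) a , i)
  (λ (_ , a , i) → _ , Equivalence.from (Credit-⇝ s) a , i)
Credit-⇝ (in-LRˡ s) = mk⇔
  (λ (_ , _ , a , b , i) → _ , _ , Equivalence.to (Credit-⇝ s) a , b , i)
  (λ (_ , _ , a , b , i) → _ , _ , Equivalence.from (Credit-⇝ s) a , b , i)
Credit-⇝ (in-LRʳ s) = mk⇔
  (λ (_ , _ , a , b , i) → _ , _ , a , Equivalence.to (Credit-⇝ s) b , i)
  (λ (_ , _ , a , b , i) → _ , _ , a , Equivalence.from (Credit-⇝ s) b , i)

Credit-⇝* : ∀ {t t′} → Star _⇝_ t t′ → ∀ {r} → Credit t r ⇔ Credit t′ r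
Credit-⇝* ε        = mk⇔ id id
Credit-⇝* (s ◅ ss) = mk⇔ (Equivalence.to (Credit-⇝* ss) ∘ Equivalence.to (Credit-⇝ s))
                    (Equivalence.from (Credit-⇝ s) ∘ Equivalence.from (Credit-⇝* ss))

Incs-first : ∀ k x xs → Incs k (x ∷ xs) (k + x ∷ xs)
Incs-first zero    x xs = refl
Incs-first (suc k) x xs = _ , Incs-first k x xs , here

-- Every unit can go to the leftmost leaf, which is why the head is exhibited. This will show that
-- the word of a subtree is feasible without a tail.
Credit-inhabited : ∀ t → ∃₂ λ x xs → Credit t (x ∷ xs)
Credit-inhabited (leaf y)       = y , [] , refl
Credit-inhabited (nodeL _ t)    = Credit-inhabited t
Credit-inhabited (nodeR _ t)    = let x , xs , m = Credit-inhabited t in suc x , xs , _ , m , here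
Credit-inhabited (nodeLR y t u) =
  let x , xs , m = Credit-inhabited t ; x′ , xs′ , m′ = Credit-inhabited u
  in y + x , xs ++ x′ ∷ xs′ , _ , _ , m , m′ , Incs-first y x _

-- Seg p a b xs: the word xs occupies the positions from a to b - 1 of p.
data Seg (p : ℕ → ℕ) : ℕ → ℕ → List ℕ → Set where
  []  : ∀ {a} → Seg p a a []
  _∷_ : ∀ {a b x xs} → p a ≡ x → Seg p (suc a) b xs → Seg p a b (x ∷ xs)

Seg-++⁻ : ∀ {p a b} xs {ys} → Seg p a b (xs ++ ys) → ∃[ c ] Seg p a c xs × Seg p c b ys
Seg-++⁻ []       s       = _ , [] , s
Seg-++⁻ (x ∷ xs) (e ∷ s) = let c , s₁ , s₂ = Seg-++⁻ xs s in c , e ∷ s₁ , s₂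

Seg-≤ : ∀ {p a b xs} → Seg p a b xs → a ≤ b
Seg-≤ []      = ≤-refl
Seg-≤ (_ ∷ s) = <⇒≤ (Seg-≤ s)

Seg-All : ∀ {p a b xs} {P : ℕ → Set} → Seg p a b xs → All P xs → ∀ {i} → a ≤ i → i < b → P (p i)
Seg-All []         _        a≤i i<a = contradiction a≤i (<⇒≱ i<a)
Seg-All (refl ∷ s) (px ∷ P) a≤i i<b with m≤n⇒m<n∨m≡n a≤i
... | inj₁ a<i  = Seg-All s P a<i i<b
... | inj₂ refl = px

Seg-at : ∀ {p : ℕ → ℕ} {base} a xs → (∀ {i} → i < length xs → p (a + i) ≡ at xs base i) →
         Seg p a (a + length xs) xs
Seg-at {p} a []       f = subst (λ b → Seg p a b []) (sym (+-identityʳ a)) []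
Seg-at {p} a (x ∷ xs) f = trans (cong p (sym (+-identityʳ a))) (f (s≤s z≤n)) ∷
  subst (λ b → Seg p (suc a) b xs) (sym (+-suc a (length xs)))
    (Seg-at {p} (suc a) xs λ {i} i< → trans (cong p (sym (+-suc a i))) (f (s≤s i<)))

⟶ₛ-All : ∀ {P : ℕ → Set} {σ τ} → σ ⟶ₛ τ → All P σ → All P τ
⟶ₛ-All s-empty _ = []
⟶ₛ-All (s-LmR {L = L} _ _ sL sR) P with All.++⁻ L P
... | PL , Pm ∷ PR = All.++⁺ (⟶ₛ-All sL PL) (All.++⁺ (⟶ₛ-All sR PR) (Pm ∷ []))

Inc-length : ∀ {xs ys} → Inc xs ys → length ys ≡ length xs
Inc-length here      = refl
Inc-length (there i) = cong suc (Inc-length i)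

Incs-length : ∀ k {xs ys} → Incs k xs ys → length ys ≡ length xs
Incs-length zero    refl        = refl
Incs-length (suc k) (_ , is , i) = trans (Inc-length i) (Incs-length k is)

Credit-length : ∀ t {r} → Credit t r → length r ≡ #leaves t
Credit-length (leaf _)       refl = refl
Credit-length (nodeL _ t)    m = Credit-length t m
Credit-length (nodeR _ t)    (_ , m , i) = trans (Inc-length i) (Credit-length t m)
Credit-length (nodeLR y t u) (r₁ , r₂ , m₁ , m₂ , i) =
  trans (Incs-length y i) (trans (length-++ r₁) (cong₂ _+_ (Credit-length t m₁) (Credit-length u m₂)))

-- Credited compositions as lattice points of a sum of simplices.

embed : ∀ {N} → ℕ → List ℕ → Fin N → ℕ
embed a []      i = 0
embed a (x ∷ r) i = spike a x i + embed (suc a) r i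

embed-++ : ∀ {N} a r {s} (i : Fin N) → embed a (r ++ s) i ≡ embed a r i + embed (a + length r) s i
embed-++ a []      {s} i = cong (λ b → embed b s i) (sym (+-identityʳ a))
embed-++ a (x ∷ r) {s} i = trans (cong (spike a x i +_)
  (trans (embed-++ (suc a) r i) (cong (λ b → embed (suc a) r i + embed b s i) (sym (+-suc a (length r))))))
  (sym (+-assoc (spike a x i) _ _))

embed-< : ∀ {N} a r (i : Fin N) → toℕ i < a → embed a r i ≡ 0
embed-< a []      i _   = refl
embed-< a (x ∷ r) i i<a = cong₂ _+_ (spike-≢ i (<⇒≢ i<a)) (embed-< (suc a) r i (m<n⇒m<1+n i<a))

embed-tabulate : ∀ {N k} a (f : Fin k → ℕ) (i : Fin N) l → toℕ i ≡ a + toℕ l →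
                 embed a (tabulate f) i ≡ f l
embed-tabulate a f i zero eq =
  trans (cong₂ _+_ (spike-≡ i i≡a) (embed-< (suc a) (tabulate (f ∘ suc)) i (≤-reflexive (cong suc i≡a)))) (+-identityʳ _)
  where i≡a = trans eq (+-identityʳ a)
embed-tabulate a f i (suc l) eq =
  cong₂ _+_ (spike-≢ i (λ i≡a → m+1+n≢m a (trans (sym eq) i≡a)))
            (embed-tabulate (suc a) (f ∘ suc) i l (trans eq (+-suc a (toℕ l))))

Inc⇒spike : ∀ a {r r′} → Inc r r′ → ∃[ k ] a ≤ k × k < a + length r ×
            (∀ {N} (i : Fin N) → embed a r′ i ≡ spike k 1 i + embed a r i)
Inc⇒spike a {x ∷ r} here = a , ≤-refl , m<m+n a (s≤s z≤n) , λ i →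
  trans (cong (_+ embed (suc a) r i) (spike-suc a x i)) (+-assoc (spike a 1 i) _ _)
Inc⇒spike a {x ∷ r} (there {ys = r′} j) with Inc⇒spike (suc a) j
... | k , a<k , k< , f = k , <⇒≤ a<k , ≤-trans k< (≤-reflexive (sym (+-suc a (length r)))) , λ i →
  trans (cong (spike a x i +_) (f i)) (trans (sym (+-assoc (spike a x i) _ _))
    (trans (cong (_+ embed (suc a) r i) (+-comm (spike a x i) (spike k 1 i))) (+-assoc (spike k 1 i) _ _)))

spike⇒Inc : ∀ a r {k} → a ≤ k → k < a + length r → ∃[ r′ ] Inc r r′ ×
            (∀ {N} (i : Fin N) → embed a r′ i ≡ spike k 1 i + embed a r i)
spike⇒Inc a []      a≤k k< = contradiction a≤k (<⇒≱ (subst (_ <_) (+-identityʳ a) k<))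
spike⇒Inc a (x ∷ r) {k} a≤k k< with m≤n⇒m<n∨m≡n a≤k
... | inj₂ refl = suc x ∷ r , here , λ i →
  trans (cong (_+ embed (suc a) r i) (spike-suc a x i)) (+-assoc (spike a 1 i) _ _)
... | inj₁ a<k with spike⇒Inc (suc a) r a<k (subst (k <_) (+-suc a (length r)) k<)
...   | r′ , j , f = x ∷ r′ , there j , λ i →
  trans (cong (spike a x i +_) (f i)) (trans (sym (+-assoc (spike a x i) _ _))
    (trans (cong (_+ embed (suc a) r i) (+-comm (spike a x i) (spike k 1 i))) (+-assoc (spike k 1 i) _ _)))

DiscSum-resp : ∀ {N} (C : List (Subset N × ℕ)) {u v} → DiscSum C u → (∀ i → u i ≡ v i) → DiscSum C v
DiscSum-resp []      s                     eq i = trans (sym (eq i)) (s i)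
DiscSum-resp (_ ∷ C) (u , v , dz , s , eq′) eq = u , v , dz , s , λ i → trans (sym (eq i)) (eq′ i)

DiscSum-++⁺ : ∀ {N} (B : List (Subset N × ℕ)) {C u v} → DiscSum B u → DiscSum C v →
              DiscSum (B ++ C) (λ i → u i + v i)
DiscSum-++⁺ []      {C} {u} {v} z≡0 s = DiscSum-resp C s λ i → sym (cong (_+ v i) (z≡0 i))
DiscSum-++⁺ (_ ∷ B) {v = v} (u , w , dz , s , eq) s′ =
  u , _ , dz , DiscSum-++⁺ B s s′ , λ i → trans (cong (_+ v i) (eq i)) (+-assoc (u i) (w i) (v i))

DiscSum-++⁻ : ∀ {N} (B : List (Subset N × ℕ)) {C z} → DiscSum (B ++ C) z →
              ∃₂ λ u v → DiscSum B u × DiscSum C v × (∀ i → z i ≡ u i + v i)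
DiscSum-++⁻ []      s = _ , _ , (λ _ → refl) , s , λ _ → refl
DiscSum-++⁻ (_ ∷ B) (u , w , dz , s , eq) with DiscSum-++⁻ B s
... | u′ , v , s₁ , s₂ , eq′ = _ , v , (u , u′ , dz , s₁ , λ _ → refl) , s₂ , λ i →
  trans (eq i) (trans (cong (u i +_) (eq′ i)) (sym (+-assoc (u i) (u′ i) (v i))))

positive? : ∀ {N} (v : Subset N × ℕ) → Dec (1 ≤ proj₂ v)
positive? v = 1 ≤? proj₂ v

-- A vertex with label 0 contributes only the zero vector, so restricting to 𝓑 changes no sum.
DiscSum-positive⁺ : ∀ {N} (B : List (Subset N × ℕ)) {z} → DiscSum B z → DiscSum (filter positive? B) z
DiscSum-positive⁺ [] s = s
DiscSum-positive⁺ ((I , suc y) ∷ B) (u , v , dz , s , eq) = u , v , dz , DiscSum-positive⁺ B s , eq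
DiscSum-positive⁺ ((I , zero) ∷ B) {z} (u , v , u≡0 , s , eq) =
  DiscSum-resp (filter positive? B) (DiscSum-positive⁺ B s) λ i → trans (cong (_+ v i) (sym (u≡0 i))) (sym (eq i))

DiscSum-positive⁻ : ∀ {N} (B : List (Subset N × ℕ)) {z} → DiscSum (filter positive? B) z → DiscSum B z
DiscSum-positive⁻ [] s = s
DiscSum-positive⁻ ((I , suc y) ∷ B) (u , v , dz , s , eq) = u , v , dz , DiscSum-positive⁻ B s , eq
DiscSum-positive⁻ ((I , zero) ∷ B) s = _ , _ , (λ _ → refl) , DiscSum-positive⁻ B s , λ _ → refl

-- The leaves below a vertex are numbered consecutively, which reduces membership to bounds on the
-- index.
∈leafSet⁻ : ∀ {N} a (t : BinTree ℕ) {i : Fin N} → i ∈ˢ leafSet N a t → a ≤ toℕ i × toℕ i < a + #leaves t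
∈leafSet⁻ {N} a (leaf _) {i} i∈ =
  ≤-reflexive (sym i≡a) , ≤-reflexive (trans (cong suc i≡a) (+-comm 1 a))
  where
  witness : ∀ {P : Set} (P? : Dec P) → does P? ≡ true → P
  witness (yes x) _ = x
  i≡a : toℕ i ≡ a
  i≡a = witness (toℕ i ≟ a)
    (trans (sym (lookup∘tabulate (λ c → does (toℕ c ≟ a)) i)) ([]=⇒lookup i∈))
∈leafSet⁻ a (nodeL _ t) i∈ = ∈leafSet⁻ a t i∈
∈leafSet⁻ a (nodeR _ t) i∈ = ∈leafSet⁻ a t i∈
∈leafSet⁻ {N} a (nodeLR _ t u) {i} i∈ with x∈p∪q⁻ (leafSet N a t) (leafSet N (a + #leaves t) u) i∈
... | inj₁ i∈₁ = let l , r = ∈leafSet⁻ a t i∈₁ in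
  l , ≤-trans r (+-monoʳ-≤ a (m≤m+n (#leaves t) (#leaves u)))
... | inj₂ i∈₂ = let l , r = ∈leafSet⁻ (a + #leaves t) u i∈₂ in
  ≤-trans (m≤m+n a (#leaves t)) l , ≤-trans r (≤-reflexive (+-assoc a (#leaves t) (#leaves u)))

∈leafSet⁺ : ∀ {N} a (t : BinTree ℕ) {i : Fin N} → a ≤ toℕ i → toℕ i < a + #leaves t → i ∈ˢ leafSet N a t
∈leafSet⁺ {N} a (leaf _) {i} a≤i i< = lookup⇒[]= i _
  (trans (lookup∘tabulate (λ c → does (toℕ c ≟ a)) i)
    (dec-true (toℕ i ≟ a) (≤-antisym (≤-pred (subst (toℕ i <_) (+-comm a 1) i<)) a≤i)))
∈leafSet⁺ a (nodeL _ t) = ∈leafSet⁺ a t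
∈leafSet⁺ a (nodeR _ t) = ∈leafSet⁺ a t
∈leafSet⁺ {N} a (nodeLR _ t u) {i} a≤i i< with <-≤-connex (toℕ i) (a + #leaves t)
... | inj₁ lt = x∈p∪q⁺ (inj₁ (∈leafSet⁺ a t a≤i lt))
... | inj₂ ge = x∈p∪q⁺ (inj₂ (∈leafSet⁺ (a + #leaves t) u ge
  (≤-trans i< (≤-reflexive (sym (+-assoc a (#leaves t) (#leaves u)))))))

Incs⇒Disc : ∀ {N} a (I : Subset N) {r} → (∀ {i} → a ≤ toℕ i → toℕ i < a + length r → i ∈ˢ I) →
            a + length r ≤ N → ∀ y {s} → Incs y r s →
            ∃[ u ] Disc y I u × (∀ i → embed a s i ≡ u i + embed a r i)
Incs⇒Disc a I full le zero    refl = (λ _ → 0) , (λ _ → refl) , λ _ → refl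
Incs⇒Disc {N} a I {r} full le (suc y) (s , is , j) with Incs⇒Disc a I full le y is | Inc⇒spike a j
... | u , du , eq | k , a≤k , k< , f = _ , (i , i∈ , u , du , λ _ → refl) , λ c →
  trans (f c) (trans (cong₂ _+_ (cong (λ k → spike k 1 c) (sym i≡k)) (eq c)) (sym (+-assoc (spike (toℕ i) 1 c) (u c) _)))
  where
  k<′ : k < a + length r
  k<′ = ≤-trans k< (≤-reflexive (cong (a +_) (Incs-length y is)))
  k<N : k < N
  k<N = ≤-trans k<′ le
  i = fromℕ< k<N
  i≡k = toℕ-fromℕ< k<N
  i∈ : i ∈ˢ I
  i∈ = full (subst (a ≤_) (sym i≡k) a≤k) (subst (_< a + length r) (sym i≡k) k<′)

Disc⇒Incs : ∀ {N} a (I : Subset N) {r} → (∀ {i} → i ∈ˢ I → a ≤ toℕ i × toℕ i < a + length r) →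
            ∀ y {u} → Disc y I u → ∃[ s ] Incs y r s × (∀ i → embed a s i ≡ u i + embed a r i)
Disc⇒Incs a I {r} sub zero    u≡0 = r , refl , λ i → sym (cong (_+ embed a r i) (u≡0 i))
Disc⇒Incs a I {r} sub (suc y) (j , j∈ , u , du , eq) with Disc⇒Incs a I sub y du
... | s , is , f with spike⇒Inc a s (proj₁ (sub j∈))
        (≤-trans (proj₂ (sub j∈)) (≤-reflexive (cong (a +_) (sym (Incs-length y is)))))
...   | s′ , i′ , g = s′ , (s , is , i′) , λ c → trans (g c)
  (trans (cong (spike (toℕ j) 1 c +_) (f c)) (trans (sym (+-assoc (spike (toℕ j) 1 c) (u c) _))
    (cong (_+ embed a r c) (sym (eq c)))))

Disc-resp : ∀ {N} y {I : Subset N} {u v} → Disc y I u → (∀ i → u i ≡ v i) → Disc y I v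
Disc-resp zero    u≡0                 eq i = trans (sym (eq i)) (u≡0 i)
Disc-resp (suc y) (j , j∈ , w , dw , e) eq = j , j∈ , w , dw , λ i → trans (sym (eq i)) (e i)

Disc-leaf : ∀ {N} a {I : Subset N} → (∀ {i} → i ∈ˢ I → toℕ i ≡ a) →
            ∀ y {u} → Disc y I u → ∀ i → u i ≡ spike a y i
Disc-leaf a sub zero    u≡0 i with does (toℕ i ≟ a)
... | true  = u≡0 i
... | false = u≡0 i
Disc-leaf a sub (suc y) (j , j∈ , w , dw , eq) i = trans (eq i)
  (trans (cong₂ _+_ (cong (λ k → spike k 1 i) (sub j∈)) (Disc-leaf a sub y dw i)) (sym (spike-suc a y i)))

-- The two subtrees fill adjacent blocks of coordinates, so concatenating compositions becomes
-- adding vectors; the y increments at the root add a lattice point of y Δ_I.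
Credit⇒DiscSum : ∀ {N} a {t} → Full t → a + #leaves t ≤ N → ∀ {r} → Credit t r → DiscSum (vertices N a t) (embed a r)
Credit⇒DiscSum {N} a {leaf y} leaf le refl = spike a y , (λ _ → 0)
  , Disc-resp y (Disc-spike y {j} (∈leafSet⁺ a (leaf y) (≤-reflexive (sym j≡a))
      (≤-reflexive (trans (cong suc j≡a) (+-comm 1 a))))) (λ i → cong (λ b → spike b y i) j≡a)
  , (λ _ → refl) , λ _ → refl
  where
  a<N : a < N
  a<N = ≤-trans (≤-reflexive (+-comm 1 a)) le
  j = fromℕ< a<N
  j≡a = toℕ-fromℕ< a<N
Credit⇒DiscSum {N} a {nodeLR y t u} (nodeLR ft fu) le (r₁ , r₂ , m₁ , m₂ , is)
  with Incs⇒Disc a (leafSet N a (nodeLR y t u)) {r₁ ++ r₂}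
         (λ a≤i i< → ∈leafSet⁺ a (nodeLR y t u) a≤i (≤-trans i< (≤-reflexive (cong (a +_) len))))
         (≤-trans (≤-reflexive (cong (a +_) len)) le) y is
  where
  len : length (r₁ ++ r₂) ≡ #leaves t + #leaves u
  len = trans (length-++ r₁) (cong₂ _+_ (Credit-length t m₁) (Credit-length u m₂))
... | z , dz , eq = z , _ , dz , DiscSum-++⁺ (vertices N a t)
    (Credit⇒DiscSum a ft (≤-trans (+-monoʳ-≤ a (m≤m+n (#leaves t) (#leaves u))) le) m₁)
    (Credit⇒DiscSum (a + #leaves t) fu (≤-trans (≤-reflexive (+-assoc a (#leaves t) (#leaves u))) le) m₂)
  , λ i → trans (eq i) (cong (z i +_) (trans (embed-++ a r₁ i)
      (cong (λ k → embed a r₁ i + embed (a + k) r₂ i) (Credit-length t m₁))))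

DiscSum⇒Credit : ∀ {N} a {t} → Full t → ∀ {z} → DiscSum (vertices N a t) z →
            ∃[ r ] Credit t r × (∀ i → z i ≡ embed a r i)
DiscSum⇒Credit a {leaf y} leaf (u , v , du , v≡0 , eq) = [ y ] , refl , λ i → trans (eq i)
  (cong₂ _+_ (Disc-leaf a (λ {j} j∈ → let l , r = ∈leafSet⁻ a (leaf y) j∈ in
    ≤-antisym (≤-pred (subst (toℕ j <_) (+-comm a 1) r)) l) y du i) (v≡0 i))
DiscSum⇒Credit {N} a {nodeLR y t u} (nodeLR ft fu) (w , v , dw , s , eq)
  with DiscSum-++⁻ (vertices N a t) s
... | v₁ , v₂ , s₁ , s₂ , eq′ with DiscSum⇒Credit a ft s₁ | DiscSum⇒Credit (a + #leaves t) fu s₂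
... | r₁ , m₁ , e₁ | r₂ , m₂ , e₂ with Disc⇒Incs a (leafSet N a (nodeLR y t u)) {r₁ ++ r₂}
         (λ i∈ → let l , r = ∈leafSet⁻ a (nodeLR y t u) i∈ in l , ≤-trans r (≤-reflexive (cong (a +_) (sym len)))) y dw
  where
  len : length (r₁ ++ r₂) ≡ #leaves t + #leaves u
  len = trans (length-++ r₁) (cong₂ _+_ (Credit-length t m₁) (Credit-length u m₂))
... | r , is , f = r , (r₁ , r₂ , m₁ , m₂ , is) , λ i → trans (eq i) (trans (cong (w i +_)
  (trans (eq′ i) (trans (cong₂ _+_ (e₁ i) (e₂ i)) (sym (trans (embed-++ a r₁ i)
    (cong (λ k → embed a r₁ i + embed (a + k) r₂ i) (Credit-length t m₁))))))) (sym (f i)))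

-- Words as intervals of an injective sequence, and their compositions with a tail.

module Profile (p : ℕ → ℕ) (p-inj : ∀ {i j} → p i ≡ p j → i ≡ j) where

  record IsMax (m a b : ℕ) : Set where
    constructor isMax
    field
      lo  : a ≤ m
      hi  : m < b
      max : ∀ {i} → a ≤ i → i < b → i ≢ m → p i < p m

  open IsMax public

  -- Decomposition of the word on [a, b) at its maximum, which is its last
  -- entry (top) or not (mid).
  data Cart : ℕ → ℕ → Set where
    emp : ∀ {a} → Cart a a
    top : ∀ {a} m → IsMax m a (suc m) → Cart a m → Cart a (suc m)
    mid : ∀ {a b} m → IsMax m a b → suc m < b → Cart a m → Cart (suc m) b → Cart a b

  IsMax-unique : ∀ {m m′ a b} → IsMax m a b → IsMax m′ a b → m ≡ m′
  IsMax-unique {m} {m′} x y with m ≟ m′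
  ... | yes e = e
  ... | no  n = contradiction (max x (lo y) (hi y) (n ∘ sym))
                              (<-asym (max y (lo x) (hi x) n))

  p-cmp : ∀ {i j} → i ≢ j → p i < p j ⊎ p j < p i
  p-cmp {i} {j} i≢j with <-cmp (p i) (p j)
  ... | tri< l _ _ = inj₁ l
  ... | tri≈ _ e _ = contradiction (p-inj e) i≢j
  ... | tri> _ _ g = inj₂ g

  IsMax-exists : ∀ a k → ∃[ m ] IsMax m a (suc (a + k))
  IsMax-exists a zero = a , isMax ≤-refl (s≤s (m≤m+n a 0))
    λ a≤i i<a i≢a → contradiction
      (≤-antisym (subst (_ ≤_) (+-identityʳ a) (≤-pred i<a)) a≤i) i≢a
  IsMax-exists a (suc k) rewrite +-suc a k with IsMax-exists a k
  ... | m , mx with p-cmp {m} {suc (a + k)} (<⇒≢ (hi mx))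
  ... | inj₁ lt = suc (a + k) , isMax (≤-trans (m≤m+n a k) (n≤1+n _)) ≤-refl λ {i} a≤i i≤ i≢ →
          let i< = ≤∧≢⇒< (≤-pred i≤) i≢ in case i ≟ m of λ where
            (yes refl) → lt
            (no  i≢m)  → <-trans (max mx a≤i i< i≢m) lt
  ... | inj₂ gt = m , isMax (lo mx) (m<n⇒m<1+n (hi mx)) λ {i} a≤i i≤ i≢m →
          case i ≟ suc (a + k) of λ where
            (yes refl) → gt
            (no  i≢)   → max mx a≤i (≤∧≢⇒< (≤-pred i≤) i≢) i≢m

  cart : ∀ a b → a ≤ b → Cart a b
  cart a b a≤b = go (b ∸ a) a b a≤b ≤-refl
    where
    -- f bounds the length of the interval; the parts on both sides of the maximum are shorter.
    go : ∀ f a b → a ≤ b → b ∸ a ≤ f → Cart a b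
    go f a b a≤b b∸a≤f with m≤n⇒m<n∨m≡n a≤b
    ... | inj₂ refl = emp
    go zero a b a≤b b∸a≤f | inj₁ a<b =
      contradiction (n≤0⇒n≡0 b∸a≤f) (m>n⇒m∸n≢0 a<b)
    go (suc f) a (suc b) a≤b b∸a≤f | inj₁ (s≤s a≤b′) with IsMax-exists a (b ∸ a)
    ... | m , mx rewrite m+[n∸m]≡n a≤b′ =
      divide (m≤n⇒m<n∨m≡n (hi mx))
      where
      b-a≤f : b ∸ a ≤ f
      b-a≤f = ≤-pred (subst (_≤ suc f) (+-∸-assoc 1 a≤b′) b∸a≤f)
      l = go f a m (lo mx) (≤-trans (∸-monoˡ-≤ a (≤-pred (hi mx))) b-a≤f)
      divide : suc m < suc b ⊎ suc m ≡ suc b → Cart a (suc b)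
      divide (inj₂ refl) = top m mx l
      divide (inj₁ lt)   = mid m mx lt l
        (go f (suc m) (suc b) (hi mx) (≤-trans (∸-monoʳ-≤ b (lo mx)) b-a≤f))

  -- The left share s + 1 consists of m and of the s tail entries beyond the endpoint of the hook of
  -- m. That endpoint is used up and m replaces it, so the shares still add up to t.
  record _⊗_ (A B : ℕ → List ℕ → Set) (t : ℕ) (q : List ℕ) : Set where
    constructor split
    field
      s t′   : ℕ
      ql qr  : List ℕ
      sum≡   : suc s + t′ ≡ t
      q≡     : q ≡ ql ++ qr
      left   : A (suc s) ql
      right  : B t′ qr

  -- V c t q: some valid hook configuration of the word on [a, b), prolonged by
  -- an increasing tail of t larger entries, has color composition q.
  V : ∀ {a b} → Cart a b → ℕ → List ℕ → Set
  -- An empty word carries one color, whose points are the tail entries; parts of a composition are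
  -- positive.
  V emp                            t q = 1 ≤ t × q ≡ [ t ]
  V (top _ _ l)               t q = V l (suc t) q
  V (mid _ _ _ l r)  t q = (V l ⊗ V r) t q

  -- The least length of a tail that admits a valid hook configuration.
  μ : ∀ {a b} → Cart a b → ℕ
  μ emp                           = 1
  μ (top _ _ l)              = μ l ∸ 1
  -- The left share contains m in any case, even if the left factor could do without a tail.
  μ (mid _ _ _ l r) = (1 ⊔ μ l) + μ r

  V⇒μ≤ : ∀ {a b} (c : Cart a b) {t q} → V c t q → μ c ≤ t
  V⇒μ≤ emp                          (1≤t , _) = 1≤t
  V⇒μ≤ (top _ _ l)              v = ∸-monoˡ-≤ 1 (V⇒μ≤ l v)
  V⇒μ≤ (mid _ _ _ l r) (split s t′ _ _ refl _ x y) =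
    +-mono-≤ (⊔-lub (s≤s z≤n) (V⇒μ≤ l x)) (V⇒μ≤ r y)

  ⊗-inhabited : ∀ {A B : ℕ → List ℕ → Set} {x y t} →
                (∀ {t} → x ≤ t → ∃ (A t)) → ∃ (B y) → (1 ⊔ x) + y ≤ t → ∃ ((A ⊗ B) t)
  ⊗-inhabited {x = x} {y} {t} f (qr , b) h = _ , split s y _ qr s+y refl (proj₂ (f x≤)) b
    where
    -- The right factor gets its minimum y, the left one all the rest.
    s = t ∸ suc y
    1+y≤t : suc y ≤ t
    1+y≤t = ≤-trans (+-monoˡ-≤ y (m≤m⊔n 1 x)) h
    s+y : suc s + y ≡ t
    s+y = trans (sym (+-suc s y)) (m∸n+n≡m 1+y≤t)
    x≤ : x ≤ suc s
    x≤ = ≤-trans (m≤n⊔m 1 x) (+-cancelʳ-≤ y _ _ (≤-trans h (≤-reflexive (sym s+y))))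

  μ≤⇒V : ∀ {a b} (c : Cart a b) {t} → μ c ≤ t → ∃ (V c t)
  μ≤⇒V emp 1≤t = _ , 1≤t , refl
  μ≤⇒V (top _ _ l) h = μ≤⇒V l (≤-trans (m≤n+m∸n (μ l) 1) (s≤s h))
  μ≤⇒V (mid _ _ _ l r) h = ⊗-inhabited (μ≤⇒V l) (μ≤⇒V r ≤-refl) h

  IsMax-≮ : ∀ {m a} → ¬ IsMax m a a
  IsMax-≮ mx = contradiction (≤-trans (s≤s (lo mx)) (hi mx)) (n≮n _)

  -- The position of the maximum is unique, so two decompositions of an interval differ only in the
  -- proofs that they carry.
  V-irrelevant : ∀ {a b} (c c′ : Cart a b) {t q} → V c t q → V c′ t q
  V-irrelevant emp              emp              v = v
  V-irrelevant emp              (top _ mx _)     v = contradiction mx IsMax-≮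
  V-irrelevant emp              (mid _ mx _ _ _) v = contradiction mx IsMax-≮
  V-irrelevant (top _ mx _)     emp              v = contradiction mx IsMax-≮
  V-irrelevant (mid _ mx _ _ _) emp              v = contradiction mx IsMax-≮
  V-irrelevant (top _ _ l)      (top _ _ l′)     v = V-irrelevant l l′ v
  V-irrelevant (top _ mx _)     (mid _ mx′ lt _ _) v with refl ← IsMax-unique mx mx′ =
    contradiction lt (n≮n _)
  V-irrelevant (mid _ mx lt _ _) (top _ mx′ _)   v with refl ← IsMax-unique mx mx′ =
    contradiction lt (n≮n _)
  V-irrelevant (mid _ mx _ l r) (mid _ mx′ _ l′ r′) (split s t′ ql qr e e′ x y)
    with refl ← IsMax-unique mx mx′ =
    split s t′ ql qr e e′ (V-irrelevant l l′ x) (V-irrelevant r r′ y)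

  μ-irrelevant : ∀ {a b} (c c′ : Cart a b) → μ c ≡ μ c′
  μ-irrelevant c c′ = ≤-antisym (go c c′) (go c′ c)
    where
    go : ∀ {a b} (c c′ : Cart a b) → μ c ≤ μ c′
    go c c′ = V⇒μ≤ c (V-irrelevant c′ c (proj₂ (μ≤⇒V c′ ≤-refl)))

  ⊗-suc⁺ : ∀ {A B : ℕ → List ℕ → Set} →
           (∀ {t q q′} → A t q → Inc q q′ → A (suc t) q′) →
           (∀ {t q q′} → B t q → Inc q q′ → B (suc t) q′) →
           ∀ {t q q′} → (A ⊗ B) t q → Inc q q′ → (A ⊗ B) (suc t) q′
  ⊗-suc⁺ f g (split s t′ ql qr refl refl x y) i with Inc-++⁻ ql i
  ... | inj₁ (_ , j , e) = split (suc s) t′ _ qr refl e (f x j) y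
  ... | inj₂ (_ , j , e) = split s (suc t′) ql _ (cong suc (+-suc s t′)) e x (g y j)

  -- The tail is longer than both minima together, so some factor has an entry to spare: the right
  -- one if its share exceeds y, otherwise the left one.
  ⊗-suc⁻ : ∀ {A B : ℕ → List ℕ → Set} {x y} →
           (∀ {t q′} → A (suc t) q′ → x ≤ t → ∃[ q ] A t q × Inc q q′) →
           (∀ {t q′} → B (suc t) q′ → y ≤ t → ∃[ q ] B t q × Inc q q′) →
           ∀ {t q′} → (A ⊗ B) (suc t) q′ → (1 ⊔ x) + y ≤ t → ∃[ q ] (A ⊗ B) t q × Inc q q′
  ⊗-suc⁻ {y = y} f g (split s t′ ql qr e e′ u v) h with y <? t′
  ⊗-suc⁻ f g (split s (suc t′) ql qr refl refl u v) h | yes (s≤s y≤t′) =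
    let q , w , i = g v y≤t′ in
    _ , split s t′ ql q (sym (+-suc s t′)) refl u w , Inc-++⁺ʳ ql i
  ⊗-suc⁻ {x = x} f g (split s t′ ql qr refl refl u v) h | no ¬lt
    with s | +-cancelʳ-≤ t′ (1 ⊔ x) s (≤-trans (+-monoʳ-≤ (1 ⊔ x) (≮⇒≥ ¬lt)) h)
  ... | zero  | 1≤s = contradiction (≤-trans (m≤m⊔n 1 x) 1≤s) λ ()
  ... | suc s | 1≤s =
    let q , w , i = f u (≤-trans (m≤n⊔m 1 x) 1≤s) in
    _ , split s t′ q qr refl refl w v , Inc-++⁺ˡ qr i

  V-suc⁺ : ∀ {a b} (c : Cart a b) {t q q′} → V c t q → Inc q q′ → V c (suc t) q′
  V-suc⁺ emp (1≤t , refl) here = m≤n⇒m≤1+n 1≤t , refl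
  V-suc⁺ (top _ _ l)              = V-suc⁺ l
  V-suc⁺ (mid _ _ _ l r) = ⊗-suc⁺ (V-suc⁺ l) (V-suc⁺ r)

  V-suc⁻ : ∀ {a b} (c : Cart a b) {t q′} → V c (suc t) q′ → μ c ≤ t →
           ∃[ q ] V c t q × Inc q q′
  V-suc⁻ emp (_ , refl) 1≤t = _ , (1≤t , refl) , here
  V-suc⁻ (top _ _ l) v h = V-suc⁻ l v (≤-trans (m≤n+m∸n (μ l) 1) (s≤s h))
  V-suc⁻ (mid _ _ _ l r) = ⊗-suc⁻ (V-suc⁻ l) (V-suc⁻ r)

  -- Concatenation of two words.

  balance : ∀ {x y z s t t′} → x ≤ suc s → y ≤ t′ → suc s + t′ ≡ suc t → suc t ≤ x + y →
            z + y ≤ t → z ≤ s × suc s ≤ x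
  balance {x} {y} {z} {s} {t} {t′} x≤ y≤ e h h′ =
      +-cancelʳ-≤ t′ z s (≤-trans (+-monoʳ-≤ z t′≤y) (≤-trans h′ (≤-reflexive (sym (suc-injective e)))))
    , +-cancelʳ-≤ y (suc s) x (≤-trans (+-monoʳ-≤ (suc s) y≤) (≤-trans (≤-reflexive e) h))
    where
    -- The total does not exceed the sum of the lower bounds, so both shares attain theirs.
    t′≤y : t′ ≤ y
    t′≤y = +-cancelˡ-≤ (suc s) t′ y (≤-trans (≤-reflexive e) (≤-trans h (+-monoˡ-≤ y x≤)))

  -- A word that is feasible without a tail ends in its maximum, so the left
  -- factor of a concatenation may be taken to be of the form u.
  module _ {a m} {mx : IsMax m a (suc m)} (l : Cart a m) where

    private
      u = top m mx l

    max-left : ∀ {M b} → IsMax M (suc m) b → p M < p m → IsMax m a b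
    max-left {M} mv M<m = isMax (lo mx) (<-trans (lo mv) (hi mv)) λ {i} → go i
      where
      go : ∀ i → a ≤ i → i < _ → i ≢ m → p i < p m
      go i a≤i i<b i≢m with <-cmp i m
      ... | tri< i<m _ _ = max mx a≤i (m<n⇒m<1+n i<m) i≢m
      ... | tri≈ _ e _   = contradiction e i≢m
      ... | tri> _ _ m<i with i ≟ M
      ...   | yes refl = M<m
      ...   | no  i≢M  = <-trans (max mv m<i i<b i≢M) M<m

    max-right : ∀ {M b} → IsMax M (suc m) b → p m < p M → IsMax M a b
    max-right {M} mv m<M = isMax (≤-trans (lo mx) (<⇒≤ (lo mv))) (hi mv) λ {i} → go i
      where
      go : ∀ i → a ≤ i → i < _ → i ≢ M → p i < p M
      go i a≤i i<b i≢M with <-cmp i m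
      ... | tri< i<m _ _  = <-trans (max mx a≤i (m<n⇒m<1+n i<m) (<⇒≢ i<m)) m<M
      ... | tri≈ _ refl _ = m<M
      ... | tri> _ _ m<i  = max mv m<i i<b i≢M

    -- One half of (2), with a tail for v so that the recursion can follow left factors of v down to
    -- the place where it meets u. In the second outcome v begins above the end of u: no hook starts
    -- at m, and one tail entry can be saved.
    join : ∀ {b} (v : Cart (suc m) b) {t q q′} → suc m < b → V u 0 q → V v t q′ →
           ∃[ w ] (V {a} {b} w (suc t) (q ++ q′) ⊎ (p m < p (suc m) × μ w ≤ t))
    join emp m<b _ _ = contradiction m<b (n≮n _)
    join v@(top M mv vl) {t} {q} {q′} m<b x y
      with p-cmp {m} {M} (<⇒≢ (lo mv)) | m≤n⇒m<n∨m≡n (lo mv)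
    -- Here m is the maximum of the whole word; its hook ends at the last tail entry and leaves the
    -- other t to v.
    ... | inj₂ M<m | _         = mid m (max-left mv M<m) m<b l v , inj₁ (split 0 t q q′ refl refl x y)
    ... | inj₁ m<M | inj₂ refl = top M (max-right mv m<M) u ,
      inj₂ (m<M , ≤-trans (m∸n≤m _ 1) (≤-trans (V⇒μ≤ u x) z≤n))
    ... | inj₁ m<M | inj₁ lt with join vl lt x y
    ...   | w , inj₁ z        = top M (max-right mv m<M) w , inj₁ z
    ...   | w , inj₂ (l , z)  = top M (max-right mv m<M) w , inj₂ (l , ∸-monoˡ-≤ 1 z)
    join v@(mid M mv M<b vl vr) {t} {q} m<b x y′@(split s t′ ql qr e refl y z)
      with p-cmp {m} {M} (<⇒≢ (lo mv)) | m≤n⇒m<n∨m≡n (lo mv)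
    ... | inj₂ M<m | _ = mid m (max-left mv M<m) m<b l v , inj₁ (split 0 t q _ refl refl x y′)
    ... | inj₁ m<M | inj₂ refl = mid M (max-right mv m<M) M<b u vr ,
      inj₂ (m<M , ≤-trans (+-mono-≤ {1 ⊔ μ u} (⊔-lub (s≤s z≤n) (≤-trans (V⇒μ≤ u x) z≤n)) (V⇒μ≤ vr z))
                          (≤-reflexive e))
    ... | inj₁ m<M | inj₁ lt with join vl lt x y
    ...   | w , inj₁ v = mid M (max-right mv m<M) M<b w vr ,
      inj₁ (split (suc s) t′ _ qr (cong suc e) (sym (++-assoc q ql qr)) v z)
    ...   | w , inj₂ (lt , h) = mid M (max-right mv m<M) M<b w vr ,
      inj₂ (lt , ≤-trans (+-mono-≤ {1 ⊔ μ w} (⊔-lub (s≤s z≤n) h) (V⇒μ≤ vr z)) (≤-reflexive e))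

    private
      -- A share of l beyond the entry m could be given up, because u needs no tail; then t entries
      -- would do for the whole word.
      unjoin-max : ∀ {b} (mx′ : IsMax m a b) (m<b : suc m < b) (v : Cart (suc m) b) {t q} →
                   μ u ≤ 0 → μ v ≤ t → t < μ (mid m mx′ m<b l v) →
                   V (mid m mx′ m<b l v) (suc t) q →
                   ∃₂ λ q₁ q₂ → V u 0 q₁ × V v t q₂ × q ≡ q₁ ++ q₂
      unjoin-max mx′ m<b v μu μv t<μ (split zero t′ ql qr refl e x y) = _ , _ , x , y , e
      unjoin-max mx′ m<b v μu μv t<μ (split (suc s) t′ ql qr refl e x y) = contradiction
        (≤-trans t<μ (+-mono-≤ {1 ⊔ μ l} (⊔-lub ≤-refl (m∸n≡0⇒m≤n {μ l} (n≤0⇒n≡0 μu))) (V⇒μ≤ v y)))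
        (<⇒≱ (s≤s (s≤s (m≤n+m t′ s))))

    -- The other half of (2). By t < `μ` w a tail of t + 1 entries is minimal, which forces how it
    -- is shared at each maximum above m.
    unjoin : ∀ {b} (v : Cart (suc m) b) (w : Cart a b) {t q} → suc m < b → μ u ≤ 0 → μ v ≤ t →
             t < μ w → V w (suc t) q →
             ∃₂ λ q₁ q₂ → V u 0 q₁ × V v t q₂ × q ≡ q₁ ++ q₂
    unjoin emp _ m<b _ _ _ _ = contradiction m<b (n≮n _)
    unjoin v@(top M mv vl) w {t} m<b μu μv t<μ z
      with p-cmp {m} {M} (<⇒≢ (lo mv)) | m≤n⇒m<n∨m≡n (lo mv)
    ... | inj₂ M<m | _ = unjoin-max (max-left mv M<m) m<b v μu μv
      (≤-trans t<μ (≤-reflexive (μ-irrelevant w (mid m (max-left mv M<m) m<b l v))))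
      (V-irrelevant w (mid m (max-left mv M<m) m<b l v) z)
    -- If v begins above the end of u, then t entries already suffice for w, against t < `μ` w.
    ... | inj₁ m<M | inj₂ refl = contradiction
      (≤-trans t<μ (≤-reflexive (μ-irrelevant w (top M (max-right mv m<M) u))))
      (≤⇒≯ (≤-trans (m∸n≤m _ 1) (≤-trans μu z≤n)))
    ... | inj₁ m<M | inj₁ lt = unjoin vl w₁ lt μu (≤-trans (m≤n+m∸n (μ vl) 1) (s≤s μv))
        (≰⇒> λ h → <⇒≱ t<μ (≤-trans (≤-reflexive (μ-irrelevant w w′)) (∸-monoˡ-≤ {μ w₁} 1 h)))
        (V-irrelevant w w′ z)
      where
      w₁ = cart a M (≤-trans (lo mx) (<⇒≤ (lo mv)))
      w′ = top M (max-right mv m<M) w₁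
    unjoin v@(mid M mv M<b vl vr) w {t} m<b μu μv t<μ z
      with p-cmp {m} {M} (<⇒≢ (lo mv)) | m≤n⇒m<n∨m≡n (lo mv)
    ... | inj₂ M<m | _ = unjoin-max (max-left mv M<m) m<b v μu μv
      (≤-trans t<μ (≤-reflexive (μ-irrelevant w (mid m (max-left mv M<m) m<b l v))))
      (V-irrelevant w (mid m (max-left mv M<m) m<b l v) z)
    ... | inj₁ m<M | inj₂ refl = contradiction
      (≤-trans t<μ (≤-reflexive (μ-irrelevant w (mid M (max-right mv m<M) M<b u vr))))
      (≤⇒≯ (≤-trans (+-monoˡ-≤ (μ vr) {1 ⊔ μ u} (⊔-lub (m≤m⊔n 1 (μ vl)) (≤-trans μu z≤n))) μv))
    ... | inj₁ m<M | inj₁ lt = found (V-irrelevant w w′ z)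
      where
      w₁ = cart a M (≤-trans (lo mx) (<⇒≤ (lo mv)))
      w′ = mid M (max-right mv m<M) M<b w₁ vr

      found : V w′ (suc t) _ → ∃₂ λ q₁ q₂ → V u 0 q₁ × (V vl ⊗ V vr) t q₂ × _ ≡ q₁ ++ q₂
      found (split s t′ ql qr e e′ x y)
        -- A minimal total has minimal shares, so `w₁` satisfies the hypothesis of the recursive
        -- call.
        with balance (⊔-lub (s≤s z≤n) (V⇒μ≤ w₁ x)) (V⇒μ≤ vr y) e
               (≤-trans t<μ (≤-reflexive (μ-irrelevant w w′))) μv
      found (split zero t′ ql qr e e′ x y) | 1≤0 , _ =
        contradiction (≤-trans (m≤m⊔n 1 (μ vl)) 1≤0) λ ()
      found (split (suc s) t′ ql qr e e′ x y) | ≤s , s< =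
        let q₁ , q₂ , x₁ , x₂ , e″ = unjoin vl w₁ lt μu (≤-trans (m≤n⊔m 1 (μ vl)) ≤s) (s<⊔ s<) x
        in q₁ , q₂ ++ qr , x₁ , split s t′ q₂ qr (suc-injective e) refl x₂ y
           , trans e′ (trans (cong (_++ qr) e″) (++-assoc q₁ q₂ qr))
        where
        s<⊔ : suc (suc s) ≤ 1 ⊔ μ w₁ → suc s < μ w₁
        s<⊔ h with μ w₁
        ... | zero  = contradiction h λ { (s≤s ()) }
        ... | suc _ = h

  -- Hook configurations of an interval with a tail.

  Desc : ℕ → Set
  Desc i = p (suc i) < p i

  record D (a b i : ℕ) : Set where
    constructor mkD
    field
      a≤ : a ≤ i
      <b : i < b
      desc : Desc i

  open D public

  D-empty : ∀ {a i} → ¬ D a a i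
  D-empty d = contradiction (≤-trans (s≤s (a≤ d)) (<b d)) (n≮n _)

  -- Increasing entries after the word on [a, b) that serve as further northeast
  -- endpoints.  They need not be adjacent to the word or to each other.
  record Tail (a b : ℕ) (τ : List ℕ) : Set where
    constructor mkTail
    field
      ascending : Ascending τ
      after     : ∀ {x} → x ∈ τ → b ≤ x
      above     : ∀ {x i} → x ∈ τ → a ≤ i → i < x → p i < p x

  open Tail public

  Tail-top : ∀ {a m τ} → IsMax m a (suc m) → Tail a (suc m) τ → Tail a m (m ∷ τ)
  Tail-top {a} {m} {τ} mx T = mkTail (All.tabulate (after T) ∷ ascending T) after′ above′
    where
    after′ : ∀ {x} → x ∈ m ∷ τ → m ≤ x
    after′ (here refl) = ≤-refl
    after′ (there x∈)  = <⇒≤ (after T x∈)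
    above′ : ∀ {x i} → x ∈ m ∷ τ → a ≤ i → i < x → p i < p x
    above′ (here refl) a≤i i<m = max mx a≤i (m<n⇒m<1+n i<m) (<⇒≢ i<m)
    above′ (there x∈)          = above T x∈

  Tail-left : ∀ {a b m τ₁ y τ₂} → IsMax m a b → Tail a b (τ₁ ++ y ∷ τ₂) → Tail a m (m ∷ τ₂)
  Tail-left {a} {b} {m} {τ₁} {y} {τ₂} mx T =
    mkTail (All.tabulate (λ x∈ → <-≤-trans (hi mx) (after T (in₂ x∈))) ∷
            AllPairs.tail (proj₁ (proj₂ (ascending-++⁻ τ₁ (ascending T))))) after′ above′
    where
    in₂ : ∀ {x} → x ∈ τ₂ → x ∈ τ₁ ++ y ∷ τ₂
    in₂ x∈ = ∈-++⁺ʳ τ₁ (there x∈)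
    after′ : ∀ {x} → x ∈ m ∷ τ₂ → m ≤ x
    after′ (here refl) = ≤-refl
    after′ (there x∈)  = ≤-trans (<⇒≤ (hi mx)) (after T (in₂ x∈))
    above′ : ∀ {x i} → x ∈ m ∷ τ₂ → a ≤ i → i < x → p i < p x
    above′ (here refl) a≤i i<m = max mx a≤i (<-trans i<m (hi mx)) (<⇒≢ i<m)
    above′ (there x∈)          = above T (in₂ x∈)

  Tail-right : ∀ {a b m τ₁ y τ₂} → IsMax m a b → Tail a b (τ₁ ++ y ∷ τ₂) → Tail (suc m) b τ₁
  Tail-right {τ₁ = τ₁} mx T = mkTail (proj₁ (ascending-++⁻ τ₁ (ascending T)))
    (after T ∘ ∈-++⁺ˡ) (λ x∈ sm≤i → above T (∈-++⁺ˡ x∈) (≤-trans (lo mx) (<⇒≤ sm≤i)))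

  End-left : ∀ {a b m} → IsMax m a b → ∀ {i} → a ≤ i → suc i ≡ m → ¬ Desc i
  End-left mx a≤i refl = <-asym (max mx a≤i (<-trans (n<1+n _) (hi mx)) (<⇒≢ (n<1+n _)))

  -- h sends a descent to the northeast endpoint of its hook. `none` is condition (2), strict
  -- because heights are distinct. `nested` replaces condition (3): a later hook starts at or after
  -- the end of an earlier one, or ends strictly before it.
  record Hooks (h : ℕ → ℕ) (a b : ℕ) (τ : List ℕ) : Set where
    field
      right  : ∀ {i} → D a b i → i < h i
      range  : ∀ {i} → D a b i → h i < b ⊎ h i ∈ τ
      rise   : ∀ {i} → D a b i → p i < p (h i)
      none   : ∀ {i x} → D a b i → i < x → x < h i → p x < p (h i)
      nested : ∀ {i j} → D a b i → D a b j → i < j → h i ≤ j ⊎ h j < h i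

  open Hooks public

  -- The same data arranged along the decomposition, with the tail cut at the endpoint of the hook
  -- of m.
  Conf : ∀ {a b} → (ℕ → ℕ) → Cart a b → List ℕ → Set
  Conf h emp                           τ = 1 ≤ length τ
  Conf h (top m _ l)            τ = Conf h l (m ∷ τ)
  Conf h (mid m _ _ l r) τ =
    ∃₂ λ τ₁ τ₂ → τ ≡ τ₁ ++ h m ∷ τ₂ × Conf h l (m ∷ τ₂) × Conf h r τ₁

  -- Excludes a descent at the last entry, whose lower neighbor would lie outside the interval.
  End : ℕ → ℕ → Set
  End a b = ∀ {i} → a ≤ i → suc i ≡ b → ¬ Desc i

  locate : ∀ m {a b i} → D a b i → D a m i ⊎ i ≡ m ⊎ D (suc m) b i
  locate m {i = i} (mkD a≤ <b ds) with <-cmp i m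
  ... | tri< l _ _ = inj₁ (mkD a≤ l ds)
  ... | tri≈ _ e _ = inj₂ (inj₁ e)
  ... | tri> _ _ g = inj₂ (inj₂ (mkD g <b ds))

  D-top : ∀ {m a i} → End a (suc m) → D a (suc m) i → D a m i
  D-top {m} E d with locate m d
  ... | inj₁ x          = x
  ... | inj₂ (inj₁ refl) = contradiction (desc d) (E (a≤ d) refl)
  ... | inj₂ (inj₂ d′)  = contradiction (≤-trans (s≤s (a≤ d′)) (<b d′)) (n≮n _)

  D-left : ∀ {m a b i} → IsMax m a b → D a m i → D a b i
  D-left mx d = mkD (a≤ d) (<-trans (<b d) (hi mx)) (desc d)

  D-right : ∀ {m a b i} → IsMax m a b → D (suc m) b i → D a b i
  D-right mx d = mkD (≤-trans (lo mx) (<⇒≤ (a≤ d))) (<b d) (desc d)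

  D-max : ∀ {m a b} → IsMax m a b → suc m < b → D a b m
  D-max mx sm<b = mkD (lo mx) (hi mx)
    (max mx (m≤n⇒m≤1+n (lo mx)) sm<b (>⇒≢ (n<1+n _)))

  Conf⇒Hooks : ∀ {a b h τ} (c : Cart a b) → Tail a b τ → End a b → Conf h c τ → Hooks h a b τ
  Conf⇒Hooks emp T E k = record
    { right = ⊥-elim ∘ D-empty ; range = ⊥-elim ∘ D-empty ; rise = ⊥-elim ∘ D-empty
    ; none = λ d → ⊥-elim (D-empty d) ; nested = λ d → ⊥-elim (D-empty d) }
  Conf⇒Hooks (top m mx l) T E k = record
    { right = right H ∘ D-top E ; range = λ d → rng (range H (D-top E d)) ; rise = rise H ∘ D-top E
    ; none = none H ∘ D-top E ; nested = λ d d′ → nested H (D-top E d) (D-top E d′) }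
    where
    H = Conf⇒Hooks l (Tail-top mx T) (End-left mx) k
    rng : ∀ {x τ} → x < m ⊎ x ∈ m ∷ τ → x < suc m ⊎ x ∈ τ
    rng (inj₁ lt)          = inj₁ (m<n⇒m<1+n lt)
    rng (inj₂ (here refl)) = inj₁ (n<1+n _)
    rng (inj₂ (there x∈))  = inj₂ x∈
  Conf⇒Hooks {a} {b} {h} (mid m mx sm<b l r) T E (τ₁ , τ₂ , refl , k₁ , k₂) = record
    { right = rt ; range = rg ; rise = rs ; none = nn ; nested = ns }
    where
    y = h m
    L = Conf⇒Hooks l (Tail-left mx T) (End-left mx) k₁
    R = Conf⇒Hooks r (Tail-right mx T) (λ sm≤i → E (≤-trans (lo mx) (<⇒≤ sm≤i))) k₂
    y∈ : y ∈ τ₁ ++ y ∷ τ₂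
    y∈ = ∈-++⁺ʳ τ₁ (here refl)
    m<y = <-≤-trans (hi mx) (after T y∈)
    A = proj₂ (ascending-++⁻ τ₁ (ascending T))
    rt : ∀ {i} → D a b i → i < h i
    rt d with locate m d
    ... | inj₁ d′           = right L d′
    ... | inj₂ (inj₁ refl) = m<y
    ... | inj₂ (inj₂ d′)   = right R d′
    rg : ∀ {i} → D a b i → h i < b ⊎ h i ∈ τ₁ ++ y ∷ τ₂
    rg d with locate m d
    ... | inj₂ (inj₁ refl) = inj₂ y∈
    rg d | inj₂ (inj₂ d′) with range R d′
    ... | inj₁ lt = inj₁ lt
    ... | inj₂ x∈ = inj₂ (∈-++⁺ˡ x∈)
    rg d | inj₁ d′ with range L d′
    ... | inj₁ lt          = inj₁ (<-trans lt (hi mx))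
    ... | inj₂ (here e)    = inj₁ (subst (_< b) (sym e) (hi mx))
    ... | inj₂ (there x∈)  = inj₂ (∈-++⁺ʳ τ₁ (there x∈))
    rs : ∀ {i} → D a b i → p i < p (h i)
    rs d with locate m d
    ... | inj₁ d′           = rise L d′
    ... | inj₂ (inj₁ refl) = above T y∈ (lo mx) m<y
    ... | inj₂ (inj₂ d′)   = rise R d′
    nn : ∀ {i x} → D a b i → i < x → x < h i → p x < p (h i)
    nn d with locate m d
    ... | inj₁ d′           = none L d′
    ... | inj₂ (inj₁ refl) = λ i<x x<h → above T y∈ (≤-trans (lo mx) (<⇒≤ i<x)) x<h
    ... | inj₂ (inj₂ d′)   = none R d′
    below-y : ∀ {j} → D (suc m) b j → h j < y
    below-y d with range R d
    ... | inj₁ lt = <-≤-trans lt (after T y∈)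
    ... | inj₂ x∈ = proj₂ A x∈ (here refl)
    m≤ : ∀ {j} → j ≡ m ⊎ D (suc m) b j → m ≤ j
    m≤ (inj₁ refl) = ≤-refl
    m≤ (inj₂ d)    = <⇒≤ (a≤ d)
    h≤ : ∀ {j} → j ≡ m ⊎ D (suc m) b j → h j ≤ y
    h≤ (inj₁ refl) = ≤-refl
    h≤ (inj₂ d)    = <⇒≤ (below-y d)
    ns : ∀ {i j} → D a b i → D a b j → i < j → h i ≤ j ⊎ h j < h i
    ns d d′ i<j with locate m d | locate m d′
    ... | inj₁ e          | inj₁ e′           = nested L e e′ i<j
    ... | inj₂ (inj₁ refl) | inj₁ e′          = contradiction (<b e′) (<-asym i<j)
    ... | inj₂ (inj₁ refl) | inj₂ (inj₁ refl) = contradiction i<j (n≮n _)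
    ... | inj₂ (inj₁ refl) | inj₂ (inj₂ e′)   = inj₂ (below-y e′)
    ... | inj₂ (inj₂ e)   | inj₁ e′           = contradiction (<-trans (a≤ e) (<-trans i<j (<b e′))) (n≮n _)
    ... | inj₂ (inj₂ e)   | inj₂ (inj₁ refl)  = contradiction (a≤ e) (<-asym i<j)
    ... | inj₂ (inj₂ e)   | inj₂ (inj₂ e′)    = nested R e e′ i<j
    ... | inj₁ e          | inj₂ o with range L e
    ...   | inj₁ lt = inj₁ (<⇒≤ (<-≤-trans lt (m≤ o)))
    ...   | inj₂ (here q) = inj₁ (subst (_≤ _) (sym q) (m≤ o))
    ...   | inj₂ (there x∈) = inj₂ (≤-<-trans (h≤ o) (All.lookup (AllPairs.head (proj₁ A)) x∈))

  -- The hook of the maximum cannot end inside the word, so it ends in the tail; nesting with it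
  -- confines the other hooks to the tails of their factors. The empty word without a tail is
  -- excluded, since its only color would have no points.
  Hooks⇒Conf : ∀ {a b h τ} (c : Cart a b) → Tail a b τ → a < b ⊎ 1 ≤ length τ →
               Hooks h a b τ → Conf h c τ
  Hooks⇒Conf emp T (inj₁ a<a) H = contradiction a<a (n≮n _)
  Hooks⇒Conf emp T (inj₂ 1≤)  H = 1≤
  Hooks⇒Conf {a} {h = h} {τ} (top m mx l) T _ H = Hooks⇒Conf l (Tail-top mx T) (inj₂ (s≤s z≤n)) record
    { right = right H ∘ D-left mx ; range = rg ; rise = rise H ∘ D-left mx
    ; none = none H ∘ D-left mx ; nested = λ d d′ → nested H (D-left mx d) (D-left mx d′) }
    where
    rg : ∀ {i} → D a m i → h i < m ⊎ h i ∈ m ∷ τ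
    rg d with range H (D-left mx d)
    ... | inj₂ x∈ = inj₂ (there x∈)
    ... | inj₁ lt with m≤n⇒m<n∨m≡n (≤-pred lt)
    ...   | inj₁ lt′ = inj₁ lt′
    ...   | inj₂ e   = inj₂ (here e)
  Hooks⇒Conf {a} {b} {h} {τ} (mid m mx sm<b l r) T _ H = mid-conf (∈-∃++ h∈)
    where
    dm = D-max mx sm<b
    h∈ : h m ∈ τ
    h∈ with range H dm
    ... | inj₂ x∈ = x∈
    ... | inj₁ lt = contradiction (rise H dm)
      (<-asym (max mx (≤-trans (lo mx) (<⇒≤ (right H dm))) lt (>⇒≢ (right H dm))))
    mid-conf : (∃₂ λ τ₁ τ₂ → τ ≡ τ₁ ++ [ h m ] ++ τ₂) → Conf h (mid m mx sm<b l r) τ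
    mid-conf (τ₁ , τ₂ , refl) = τ₁ , τ₂ , refl
      , Hooks⇒Conf l (Tail-left mx T) (inj₂ (s≤s z≤n)) record
        { right = right H ∘ D-left mx ; range = rgL ; rise = rise H ∘ D-left mx
        ; none = none H ∘ D-left mx ; nested = λ d d′ → nested H (D-left mx d) (D-left mx d′) }
      , Hooks⇒Conf r (Tail-right mx T) (inj₁ sm<b) record
        { right = right H ∘ D-right mx ; range = rgR ; rise = rise H ∘ D-right mx
        ; none = none H ∘ D-right mx ; nested = λ d d′ → nested H (D-right mx d) (D-right mx d′) }
      where
      A = proj₂ (ascending-++⁻ τ₁ (ascending T))
      rgL : ∀ {i} → D a m i → h i < m ⊎ h i ∈ m ∷ τ₂
      rgL d with nested H (D-left mx d) dm (<b d)
      ... | inj₁ le with m≤n⇒m<n∨m≡n le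
      ...   | inj₁ lt = inj₁ lt
      ...   | inj₂ e  = inj₂ (here e)
      rgL d | inj₂ gt with range H (D-left mx d)
      ... | inj₁ lt = contradiction (<-trans gt lt) (≤⇒≯ (after T (∈-++⁺ʳ τ₁ (here refl))))
      ... | inj₂ x∈ with ∈-++⁻ τ₁ x∈
      ...   | inj₁ x∈₁        = contradiction gt (<-asym (proj₂ A x∈₁ (here refl)))
      ...   | inj₂ (here e)   = contradiction gt (<-irrefl (sym e))
      ...   | inj₂ (there x∈) = inj₂ (there x∈)
      rgR : ∀ {i} → D (suc m) b i → h i < b ⊎ h i ∈ τ₁
      rgR d with range H (D-right mx d)
      ... | inj₁ lt = inj₁ lt
      ... | inj₂ x∈ with ∈-++⁻ τ₁ x∈ | nested H dm (D-right mx d) (a≤ d)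
      ...   | inj₁ x∈₁        | _       = inj₂ x∈₁
      ...   | _               | inj₁ le = contradiction (≤-<-trans le (<b d)) (≤⇒≯ (after T h∈))
      ...   | inj₂ (here e)   | inj₂ lt = contradiction lt (<-irrefl e)
      ...   | inj₂ (there x∈) | inj₂ lt =
        contradiction lt (<-asym (All.lookup (AllPairs.head (proj₁ A)) x∈))

  -- The color classes of a configuration from left to right, each with the
  -- position of its first point unless that point lies in the tail.
  slots : ∀ {a b h τ} (c : Cart a b) → Conf h c τ → List (ℕ × List ℕ)
  slots {a} {τ = τ} emp _ = [ a , τ ]
  slots (top _ _ l)     k = slots l k
  slots (mid _ _ _ l r) (_ , _ , _ , k₁ , k₂) = slots l k₁ ++ slots r k₂

  sizes : List (ℕ × List ℕ) → List ℕ
  sizes = map (length ∘ proj₂)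

  Conf⇒V : ∀ {a b h τ} (c : Cart a b) (k : Conf h c τ) → V c (length τ) (sizes (slots c k))
  Conf⇒V emp             k = k , refl
  Conf⇒V (top _ _ l)     k = Conf⇒V l k
  Conf⇒V (mid _ _ _ l r) (τ₁ , τ₂ , refl , k₁ , k₂) =
    split (length τ₂) (length τ₁) _ _ (length-insert τ₁)
      (map-++ (length ∘ proj₂) (slots l k₁) (slots r k₂)) (Conf⇒V l k₁) (Conf⇒V r k₂)

  -- Canonicity in recursive form: the hook of m skips exactly as many tail entries as the right
  -- factor needs.
  Canon : ∀ {a b h τ} (c : Cart a b) → Conf h c τ → Set
  Canon emp             _ = ⊤
  Canon (top _ _ l)     k = Canon l k
  Canon (mid _ _ _ l r) (τ₁ , _ , _ , k₁ , k₂) = length τ₁ ≡ μ r × Canon l k₁ × Canon r k₂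

  Conf-cong : ∀ {a b h h′ τ} (c : Cart a b) → (∀ {i} → D a b i → h i ≡ h′ i) →
              (k : Conf h c τ) → Σ[ k′ ∈ Conf h′ c τ ]
              slots c k′ ≡ slots c k × (Canon c k → Canon c k′)
  Conf-cong emp eq k = k , refl , id
  Conf-cong (top m mx l) eq k = Conf-cong l (eq ∘ D-left mx) k
  Conf-cong (mid m mx m<b l r) eq (τ₁ , τ₂ , e , k₁ , k₂)
    with Conf-cong l (eq ∘ D-left mx) k₁ | Conf-cong r (eq ∘ D-right mx) k₂
  ... | k₁′ , e₁ , f₁ | k₂′ , e₂ , f₂ =
    (τ₁ , τ₂ , trans e (cong (λ y → τ₁ ++ y ∷ τ₂) (eq (D-max mx m<b))) , k₁′ , k₂′)
    , cong₂ _++_ e₁ e₂ , λ (e , c₁ , c₂) → e , f₁ c₁ , f₂ c₂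

  Conf-mid : ∀ {a b m h₁ h₂} y τ₁ {τ₂} {mx : IsMax m a b} {m<b : suc m < b}
             {l : Cart a m} {r : Cart (suc m) b} (k₁ : Conf h₁ l (m ∷ τ₂)) (k₂ : Conf h₂ r τ₁) →
             ∃[ h ] Σ[ k ∈ Conf h (mid m mx m<b l r) (τ₁ ++ y ∷ τ₂) ]
             slots (mid m mx m<b l r) k ≡ slots l k₁ ++ slots r k₂ ×
             (length τ₁ ≡ μ r → Canon l k₁ → Canon r k₂ → Canon (mid m mx m<b l r) k)
  Conf-mid {m = m} {h₁} {h₂} y τ₁ {τ₂} {l = l} {r} k₁ k₂ =
    let k₁′ , e₁ , f₁ = Conf-cong l (λ {i} d → h-< i (<b d)) k₁
        k₂′ , e₂ , f₂ = Conf-cong r (λ {i} d → h-> i (a≤ d)) k₂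
    in h , (τ₁ , τ₂ , cong (λ z → τ₁ ++ z ∷ τ₂) h-≡ , k₁′ , k₂′) , cong₂ _++_ e₁ e₂
       , λ e c₁ c₂ → e , f₁ c₁ , f₂ c₂
    where
    h : ℕ → ℕ
    h i with <-cmp i m
    ... | tri< _ _ _ = h₁ i
    ... | tri≈ _ _ _ = y
    ... | tri> _ _ _ = h₂ i
    h-< : ∀ i → i < m → h₁ i ≡ h i
    h-< i i<m with <-cmp i m
    ... | tri< _ _ _  = refl
    ... | tri≈ ¬< _ _ = contradiction i<m ¬<
    ... | tri> ¬< _ _ = contradiction i<m ¬<
    h-> : ∀ i → m < i → h₂ i ≡ h i
    h-> i m<i with <-cmp i m
    ... | tri< _ _ ¬> = contradiction m<i ¬>
    ... | tri≈ _ _ ¬> = contradiction m<i ¬>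
    ... | tri> _ _ _  = refl
    h-≡ : y ≡ h m
    h-≡ with <-cmp m m
    ... | tri< lt _ _ = contradiction lt (n≮n m)
    ... | tri≈ _ _ _  = refl
    ... | tri> _ _ gt = contradiction gt (n≮n m)

  V⇒Conf : ∀ {a b q} (c : Cart a b) τ → V c (length τ) q →
           ∃[ h ] Σ[ k ∈ Conf h c τ ] sizes (slots c k) ≡ q
  V⇒Conf emp             τ (1≤ , refl) = id , 1≤ , refl
  V⇒Conf (top m _ l)     τ v = V⇒Conf l (m ∷ τ) v
  V⇒Conf (mid m mx m<b l r) τ (split s t′ ql qr e refl x y) with split-length s t′ τ e
  ... | τ₁ , z , τ₂ , refl , refl , refl with V⇒Conf l (m ∷ τ₂) x | V⇒Conf r τ₁ y
  ... | _ , k₁ , refl | _ , k₂ , refl with Conf-mid z τ₁ {mx = mx} {m<b} {l} {r} k₁ k₂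
  ... | h , k , e′ , _ = h , k ,
    trans (cong sizes e′) (map-++ (length ∘ proj₂) (slots l k₁) (slots r k₂))

  Canon-exists : ∀ {a b} (c : Cart a b) τ → μ c ≤ length τ →
                 ∃[ h ] Σ[ k ∈ Conf h c τ ] Canon c k
  Canon-exists emp             τ 1≤ = id , 1≤ , tt
  Canon-exists (top m _ l)     τ le = Canon-exists l (m ∷ τ) (≤-trans (m≤n+m∸n (μ l) 1) (s≤s le))
  Canon-exists (mid m mx m<b l r) τ le
    with split-length (length τ ∸ suc (μ r)) (μ r) τ
      (trans (sym (+-suc _ (μ r))) (m∸n+n≡m (≤-trans (+-monoˡ-≤ (μ r) (m≤m⊔n 1 (μ l))) le)))
  ... | τ₁ , z , τ₂ , refl , e₁ , e₂
    with Canon-exists l (m ∷ τ₂) (≤-trans (m≤n⊔m 1 (μ l)) (+-cancelʳ-≤ (μ r) _ _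
           (≤-trans le (≤-reflexive (trans (sym (length-insert τ₁)) (cong (suc (length τ₂) +_) (sym e₁)))))))
       | Canon-exists r τ₁ (≤-reflexive e₁)
  ... | _ , k₁ , c₁ | _ , k₂ , c₂ with Conf-mid z τ₁ {mx = mx} {m<b} {l} {r} k₁ k₂
  ... | h , k , _ , f = h , k , f (sym e₁) c₁ c₂

  -- Canonical hooks and minimal tails.

  Lowest : (ℕ → ℕ) → ℕ → Set
  Lowest h m = ∀ {z} → m < z → p m < p z →
    (∀ {j} → Desc j → m < j → j < z → z ≤ h j → ⊥) → p (h m) ≤ p z

  -- No hook that starts beyond the word passes over a tail entry or ends there, so such hooks do
  -- not bar tail entries from being canonical endpoints.
  Free : (ℕ → ℕ) → ℕ → List ℕ → Set
  Free h b τ = ∀ {x j} → x ∈ τ → b ≤ j → Desc j → j < x → x ≤ h j → ⊥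

  End-right : ∀ {a b m} → IsMax m a b → End a b → End (suc m) b
  End-right mx E m<i = E (≤-trans (lo mx) (<⇒≤ m<i))

  -- A canonical configuration does not hook to a tail entry that could be
  -- dispensed with.
  tail-minimal : ∀ {a b h τ d} (c : Cart a b) → Tail a b τ → End a b → Conf h c τ →
                 (∀ {m} → Desc m → Lowest h m) → Free h b τ →
                 D a b d → h d ∈ τ → (∀ {x} → x ∈ τ → x ≤ h d) → length τ ≤ μ c
  tail-minimal emp T E k G F d _ _ = ⊥-elim (D-empty d)
  tail-minimal {h = h} {τ} {d} (top m mx l) T E k G F dd h∈ h-max =
    ∸-monoˡ-≤ 1 (tail-minimal l (Tail-top mx T) (End-left mx) k G F′ (D-top E dd) (there h∈) max′)
    where
    F′ : Free h m (m ∷ τ)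
    F′ (here refl) m≤j _ j<m = contradiction m≤j (<⇒≱ j<m)
    F′ (there x∈) m≤j dj with m≤n⇒m<n∨m≡n m≤j
    ... | inj₁ m<j  = F x∈ m<j dj
    ... | inj₂ refl = contradiction dj (E (lo mx) refl)
    max′ : ∀ {x} → x ∈ m ∷ τ → x ≤ h d
    max′ (here refl) = ≤-trans (n≤1+n m) (after T h∈)
    max′ (there x∈)  = h-max x∈
  tail-minimal {a} {b} {h} {d = d} (mid m mx m<b l r) T E (τ₁ , τ₂ , refl , k₁ , k₂) G F dd h∈ h-max =
    subst (_≤ _) (length-insert τ₁) (+-mono-≤ left≤ right≤)
    where
    y = h m
    y∈ : y ∈ τ₁ ++ y ∷ τ₂
    y∈ = ∈-++⁺ʳ τ₁ (here refl)
    A = proj₂ (ascending-++⁻ τ₁ (ascending T))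
    L = Conf⇒Hooks l (Tail-left mx T) (End-left mx) k₁
    R = Conf⇒Hooks r (Tail-right mx T) (End-right mx E) k₂

    below-y : ∀ {j} → D (suc m) b j → h j < y
    below-y d with range R d
    ... | inj₁ lt = <-≤-trans lt (after T y∈)
    ... | inj₂ x∈ = proj₂ A x∈ (here refl)

    right≤ : length τ₁ ≤ μ r
    right≤ with length τ₁ ≤? μ r
    ... | yes le = le
    ... | no  ¬le with maximum τ₁ (≤-trans (s≤s z≤n) (≰⇒> ¬le))
    ... | z , z∈ , z-max = contradiction
      (G (desc (D-max mx m<b)) m<z (above T (∈-++⁺ˡ z∈) (lo mx) m<z) uncovered)
      (<⇒≱ (above T y∈ (≤-trans (lo mx) (<⇒≤ m<z)) (proj₂ A z∈ (here refl))))
      where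
      m<z : m < z
      m<z = <-≤-trans (hi mx) (after T (∈-++⁺ˡ z∈))
      uncovered : ∀ {j} → Desc j → m < j → j < z → z ≤ h j → ⊥
      uncovered {j} dj m<j j<z z≤ with <-≤-connex j b
      ... | inj₂ b≤j = F (∈-++⁺ˡ z∈) b≤j dj j<z z≤
      ... | inj₁ j<b with range R (mkD m<j j<b dj)
      ...   | inj₁ lt = contradiction (<-≤-trans lt (after T (∈-++⁺ˡ z∈))) (≤⇒≯ z≤)
      ...   | inj₂ j∈ = ¬le (tail-minimal r (Tail-right mx T) (End-right mx E) k₂ G
                              (F ∘ ∈-++⁺ˡ) (mkD m<j j<b dj) j∈ (λ x∈ → ≤-trans (z-max x∈) z≤))

    F′ : Free h m (m ∷ τ₂)
    F′ (here refl) m≤j _ j<m = contradiction m≤j (<⇒≱ j<m)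
    F′ {x} {j} (there x∈) m≤j dj j<x x≤ with <-≤-connex j b
    ... | inj₂ b≤j = F (∈-++⁺ʳ τ₁ (there x∈)) b≤j dj j<x x≤
    ... | inj₁ j<b with m≤n⇒m<n∨m≡n m≤j
    ...   | inj₁ m<j  = contradiction (<-trans (below-y (mkD m<j j<b dj)) y<x) (≤⇒≯ x≤)
      where y<x = All.lookup (AllPairs.head (proj₁ A)) x∈
    ...   | inj₂ refl = contradiction (All.lookup (AllPairs.head (proj₁ A)) x∈) (≤⇒≯ x≤)

    -- The hook of d ends at the last tail entry. If d = m, nothing follows y; if d is left of m,
    -- that entry lies in τ₂ and the induction applies to the left factor.
    left≤ : suc (length τ₂) ≤ 1 ⊔ μ l
    left≤ with locate m dd
    ... | inj₂ (inj₂ d′)   = contradiction (below-y d′) (≤⇒≯ (h-max y∈))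
    left≤ | inj₂ (inj₁ refl) = ≤-trans (s≤s (none-after (proj₁ A) (λ x∈ → h-max (∈-++⁺ʳ τ₁ (there x∈))))) (m≤m⊔n 1 (μ l))
      where
      none-after : ∀ {τ} → Ascending (y ∷ τ) → (∀ {x} → x ∈ τ → x ≤ y) → length τ ≤ 0
      none-after {[]}    _              f = z≤n
      none-after {_ ∷ _} ((lt ∷ _) ∷ _) f = contradiction lt (≤⇒≯ (f (here refl)))
    left≤ | inj₁ d′ with range L d′
    ... | inj₁ lt        = contradiction (<-trans lt (hi mx)) (≤⇒≯ (after T h∈))
    ... | inj₂ (here e)  = contradiction (subst (_< b) (sym e) (hi mx)) (≤⇒≯ (after T h∈))
    ... | inj₂ (there x∈) = ≤-trans
      (tail-minimal l (Tail-left mx T) (End-left mx) k₁ G F′ d′ (there x∈) max′) (m≤n⊔m 1 (μ l))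
      where
      max′ : ∀ {x} → x ∈ m ∷ τ₂ → x ≤ h d
      max′ (here refl) = ≤-trans (<⇒≤ (hi mx)) (after T h∈)
      max′ (there x∈)  = h-max (∈-++⁺ʳ τ₁ (there x∈))

  -- Ensures that the tail misses no competing endpoint: a position beyond the word and outside the
  -- tail is hidden under a later hook or higher than word and tail.
  Covered : (ℕ → ℕ) → ℕ → ℕ → List ℕ → Set
  Covered h a b τ = ∀ {x} → b ≤ x →
    x ∈ τ ⊎ (∃[ j ] b ≤ j × Desc j × j < x × x ≤ h j) ⊎
    ((∀ {i} → a ≤ i → i < b → p i < p x) × (∀ {y} → y ∈ τ → p y < p x))

  -- An admissible endpoint z lower than h n would lie in τ₁. As no hook of the right factor reaches
  -- z, that factor would be feasible with the entries before z alone, which are fewer than its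
  -- minimum.
  Canon⇒Lowest : ∀ {a b h τ m} (c : Cart a b) → Tail a b τ → End a b → (k : Conf h c τ) →
                 Canon c k → Covered h a b τ → D a b m → Lowest h m
  Canon⇒Lowest emp T E k C I d = ⊥-elim (D-empty d)
  Canon⇒Lowest {a} {h = h} {τ} (top n mx l) T E k C I d =
    Canon⇒Lowest l (Tail-top mx T) (End-left mx) k C I′ (D-top E d)
    where
    I′ : Covered h a n (n ∷ τ)
    I′ n≤x with m≤n⇒m<n∨m≡n n≤x
    ... | inj₂ refl = inj₁ (here refl)
    ... | inj₁ n<x with I n<x
    ...   | inj₁ x∈ = inj₁ (there x∈)
    ...   | inj₂ (inj₁ (j , le , r)) = inj₂ (inj₁ (j , <⇒≤ le , r))
    ...   | inj₂ (inj₂ (f , g)) = inj₂ (inj₂ ((λ a≤i i<n → f a≤i (m<n⇒m<1+n i<n)) , λ where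
      (here refl) → f (lo mx) ≤-refl
      (there y∈)  → g y∈))
  Canon⇒Lowest {a} {b} {h} {m = m} (mid n mx n<b l r) T E (τ₁ , τ₂ , refl , k₁ , k₂) (C , C₁ , C₂) I d
    with locate n d
  ... | inj₁ d′ = Canon⇒Lowest l (Tail-left mx T) (End-left mx) k₁ C₁ I₁ d′
    where
    dn = D-max mx n<b
    -- Seen from the left factor, the positions after n up to h n are hidden under the hook of n.
    I₁ : Covered h a n (n ∷ τ₂)
    I₁ {x} n≤x with m≤n⇒m<n∨m≡n n≤x | <-≤-connex (h n) x
    ... | inj₂ refl | _        = inj₁ (here refl)
    ... | inj₁ n<x  | inj₂ x≤y = inj₂ (inj₁ (n , ≤-refl , desc dn , n<x , x≤y))
    ... | inj₁ n<x  | inj₁ y<x with I (≤-trans (after T (∈-++⁺ʳ τ₁ (here refl))) (<⇒≤ y<x))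
    ...   | inj₂ (inj₁ (j , le , r)) = inj₂ (inj₁ (j , ≤-trans (<⇒≤ (hi mx)) le , r))
    ...   | inj₂ (inj₂ (f , g)) = inj₂ (inj₂ ((λ a≤i i<n → f a≤i (<-trans i<n (hi mx))) , λ where
      (here refl) → f (lo mx) (hi mx)
      (there y∈)  → g (∈-++⁺ʳ τ₁ (there y∈))))
    ...   | inj₁ x∈ with ∈-++⁻ τ₁ x∈
    ...     | inj₁ x∈₁        = contradiction y<x
      (<-asym (proj₂ (proj₂ (ascending-++⁻ τ₁ (ascending T))) x∈₁ (here refl)))
    ...     | inj₂ (here e)   = contradiction y<x (<-irrefl (sym e))
    ...     | inj₂ (there x∈) = inj₁ (there x∈)
  ... | inj₂ (inj₂ d′) = Canon⇒Lowest r (Tail-right mx T) (End-right mx E) k₂ C₂ I₂ d′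
    where
    A = proj₂ (ascending-++⁻ τ₁ (ascending T))
    I₂ : Covered h (suc n) b τ₁
    I₂ b≤x with I b≤x
    ... | inj₂ (inj₁ o) = inj₂ (inj₁ o)
    ... | inj₂ (inj₂ (f , g)) =
      inj₂ (inj₂ ((λ n<i → f (≤-trans (lo mx) (<⇒≤ n<i))) , λ y∈ → g (∈-++⁺ˡ y∈)))
    ... | inj₁ x∈ with ∈-++⁻ τ₁ x∈
    ...   | inj₁ x∈₁ = inj₁ x∈₁
    ...   | inj₂ x∈₂ = inj₂ (inj₂
      ( (λ n<i i<b → above T x∈ (≤-trans (lo mx) (<⇒≤ n<i)) (<-≤-trans i<b b≤x))
      , λ y∈ → above T x∈ (≤-trans (≤-trans (lo mx) (<⇒≤ (hi mx))) (after T (∈-++⁺ˡ y∈)))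
                 (proj₂ A y∈ x∈₂)))
  ... | inj₂ (inj₁ refl) = lowest
    where
    y = h n
    A = proj₂ (ascending-++⁻ τ₁ (ascending T))
    R = Conf⇒Hooks r (Tail-right mx T) (End-right mx E) k₂

    lowest : Lowest h n
    lowest {z} n<z pn<pz free with <-≤-connex z b
    ... | inj₁ z<b = contradiction pn<pz
      (<-asym (max mx (≤-trans (lo mx) (<⇒≤ n<z)) z<b (>⇒≢ n<z)))
    ... | inj₂ b≤z with I b≤z
    ...   | inj₂ (inj₁ (j , b≤j , dj , j<z , z≤)) = ⊥-elim (free dj (<-≤-trans (hi mx) b≤j) j<z z≤)
    ...   | inj₂ (inj₂ (f , g)) = <⇒≤ (g (∈-++⁺ʳ τ₁ (here refl)))
    ...   | inj₁ z∈ with ∈-++⁻ τ₁ z∈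
    ...     | inj₂ (here refl) = ≤-refl
    ...     | inj₂ (there z∈₂) = <⇒≤ (above T z∈
      (≤-trans (≤-trans (lo mx) (<⇒≤ (hi mx))) (after T (∈-++⁺ʳ τ₁ (here refl))))
      (All.lookup (AllPairs.head (proj₁ A)) z∈₂))
    ...     | inj₁ z∈₁ with ∈-∃++ z∈₁
    ...       | σ , ρ , refl = contradiction (V⇒μ≤ r (Conf⇒V r k₃))
      (<⇒≱ (subst (length σ <_) (trans (length-insert σ) C) (s≤s (m≤n+m (length σ) (length ρ)))))
      where
      T₂ = Tail-right mx T
      T₃ : Tail (suc n) b σ
      T₃ = mkTail (proj₁ (ascending-++⁻ σ (ascending T₂)))
             (after T₂ ∘ ∈-++⁺ˡ) (λ x∈ → above T₂ (∈-++⁺ˡ x∈))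
      -- The hooks under z do not need the tail entries from z on.
      range′ : ∀ {i} → D (suc n) b i → h i < b ⊎ h i ∈ σ
      range′ di with range R di
      ... | inj₁ lt = inj₁ lt
      ... | inj₂ h∈ with ∈-++⁻ σ h∈
      ...   | inj₁ h∈σ = inj₂ h∈σ
      ...   | inj₂ h∈ρ = ⊥-elim (free (desc di) (a≤ di) (<-≤-trans (<b di) b≤z) (z≤ h∈ρ))
        where
        z≤ : ∀ {x} → x ∈ z ∷ ρ → z ≤ x
        z≤ (here refl) = ≤-refl
        z≤ (there x∈)  = <⇒≤ (All.lookup (AllPairs.head (proj₁ (proj₂
                           (ascending-++⁻ σ (ascending T₂))))) x∈)
      k₃ = Hooks⇒Conf r T₃ (inj₁ n<b) record
        { right = right R ; range = range′ ; rise = rise R ; none = none R ; nested = nested R }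

  -- Color classes.

  Spot : ℕ → ℕ → List ℕ → ℕ → Set
  Spot a b τ x = (a ≤ x × x < b) ⊎ x ∈ τ

  -- The color class starting at s consists of the points x that are not
  -- northeast endpoints and for which s - 1 is the last descent whose hook
  -- passes above x; s = a is the color of the sky.
  record ColorClass (h : ℕ → ℕ) (a b : ℕ) (τ : List ℕ) (slot : ℕ × List ℕ) : Set where
    private
      s = proj₁ slot
      σ = proj₂ slot
    field
      s-range : a ≤ s × s ≤ b
      begins  : s ≡ a ⊎ (∃[ d ] D a b d × suc d ≡ s × (∀ {x} → x ∈ σ → d < x × x < h d))
      spots   : ∀ {x} → x ∈ σ → Spot a b τ x
      notNE   : ∀ {x d} → x ∈ σ → D a b d → h d ≢ x
      last    : ∀ {x d} → x ∈ σ → D a b d → s ≤ d → d < x → x < h d → ⊥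
      sorted  : Ascending σ

  open ColorClass public

  ColorClasses : ∀ {a b h τ} (c : Cart a b) → Tail a b τ → End a b → (k : Conf h c τ) →
                 All (ColorClass h a b τ) (slots c k)
  ColorClasses {a} emp T E k = record
    { s-range = ≤-refl , ≤-refl ; begins = inj₁ refl ; spots = inj₂
    ; notNE = λ _ d → ⊥-elim (D-empty d) ; last = λ _ d → ⊥-elim (D-empty d) ; sorted = ascending T } ∷ []
  ColorClasses {a} {b} {h} {τ} (top m mx l) T E k =
    All.map step (ColorClasses l (Tail-top mx T) (End-left mx) k)
    where
    step : ∀ {slot} → ColorClass h a m (m ∷ τ) slot → ColorClass h a b τ slot
    step C = record
      { s-range = proj₁ (s-range C) , m≤n⇒m≤1+n (proj₂ (s-range C))
      ; begins  = [ inj₁ , (λ (d , dd , r) → inj₂ (d , D-left mx dd , r)) ]′ (begins C)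
      ; spots   = λ x∈ → spot (spots C x∈)
      ; notNE   = λ x∈ d → notNE C x∈ (D-top E d)
      ; last    = λ x∈ d → last C x∈ (D-top E d)
      ; sorted  = sorted C }
      where
      spot : ∀ {x} → Spot a m (m ∷ τ) x → Spot a (suc m) τ x
      spot (inj₁ (a≤x , x<m))   = inj₁ (a≤x , m<n⇒m<1+n x<m)
      spot (inj₂ (here refl))   = inj₁ (lo mx , ≤-refl)
      spot (inj₂ (there x∈))    = inj₂ x∈
  ColorClasses {a} {b} {h} (mid m mx m<b l r) T E (τ₁ , τ₂ , refl , k₁ , k₂) =
    All.++⁺ (All.map stepˡ (ColorClasses l (Tail-left mx T) (End-left mx) k₁))
            (All.map stepʳ (ColorClasses r (Tail-right mx T) (End-right mx E) k₂))
    where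
    y = h m
    dm = D-max mx m<b
    A = proj₂ (ascending-++⁻ τ₁ (ascending T))
    y∈ : y ∈ τ₁ ++ y ∷ τ₂
    y∈ = ∈-insert τ₁
    b≤y = after T y∈
    L = Conf⇒Hooks l (Tail-left mx T) (End-left mx) k₁
    R = Conf⇒Hooks r (Tail-right mx T) (End-right mx E) k₂
    y< : ∀ {x} → x ∈ τ₂ → y < x
    y< = All.lookup (AllPairs.head (proj₁ A))

    -- Endpoints and color class points of the left factor lie at or before m or beyond y, those of
    -- the right factor strictly between. This separation transfers `notNE` and `last` from a factor
    -- to the whole word.
    data Outer (x : ℕ) : Set where
      before : x ≤ m → Outer x
      beyond : y < x → Outer x

    outer : ∀ {x} → Spot a m (m ∷ τ₂) x → Outer x
    outer (inj₁ (_ , x<m))    = before (<⇒≤ x<m)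
    outer (inj₂ (here refl))  = before ≤-refl
    outer (inj₂ (there x∈))   = beyond (y< x∈)

    Inner : ℕ → Set
    Inner x = m < x × x < y

    inner : ∀ {x} → Spot (suc m) b τ₁ x → Inner x
    inner (inj₁ (m<x , x<b)) = m<x , <-≤-trans x<b b≤y
    inner (inj₂ x∈)          = <-≤-trans (hi mx) (after T (∈-++⁺ˡ x∈)) , proj₂ A x∈ (here refl)

    disjoint : ∀ {x} → Outer x → Inner x → ⊥
    disjoint (before x≤m) (m<x , _) = <⇒≱ m<x x≤m
    disjoint (beyond y<x) (_ , x<y) = <-asym y<x x<y

    left-ne : ∀ {d} → D a m d → Outer (h d)
    left-ne d with range L d
    ... | inj₁ lt = before (<⇒≤ lt)
    ... | inj₂ x∈ = outer (inj₂ x∈)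

    right-ne : ∀ {d} → D (suc m) b d → Inner (h d)
    right-ne d with range R d
    ... | inj₁ lt = inner (inj₁ (<-trans (a≤ d) (right R d) , lt))
    ... | inj₂ x∈ = inner (inj₂ x∈)

    stepˡ : ∀ {slot} → ColorClass h a m (m ∷ τ₂) slot → ColorClass h a b (τ₁ ++ y ∷ τ₂) slot
    stepˡ {s , σ} C = record
      { s-range = proj₁ (s-range C) , ≤-trans (proj₂ (s-range C)) (<⇒≤ (hi mx))
      ; begins  = [ inj₁ , (λ (d , dd , r) → inj₂ (d , D-left mx dd , r)) ]′ (begins C)
      ; spots   = λ x∈ → spot (spots C x∈)
      ; notNE   = ne
      ; last    = la
      ; sorted  = sorted C }
      where
      spot : ∀ {x} → Spot a m (m ∷ τ₂) x → Spot a b (τ₁ ++ y ∷ τ₂) x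
      spot (inj₁ (a≤x , x<m))   = inj₁ (a≤x , <-trans x<m (hi mx))
      spot (inj₂ (here refl))   = inj₁ (lo mx , hi mx)
      spot (inj₂ (there x∈))    = inj₂ (∈-++⁺ʳ τ₁ (there x∈))
      ne : ∀ {x d} → x ∈ σ → D a b d → h d ≢ x
      ne x∈ d with locate m d
      ... | inj₁ d′ = notNE C x∈ d′
      ... | inj₂ (inj₂ d′) = λ { refl → disjoint (outer (spots C x∈)) (right-ne d′) }
      ... | inj₂ (inj₁ refl) with outer (spots C x∈)
      ...   | before x≤m = λ { refl → <⇒≱ (<-≤-trans (hi mx) b≤y) x≤m }
      ...   | beyond y<x = <⇒≢ y<x
      la : ∀ {x d} → x ∈ σ → D a b d → s ≤ d → d < x → x < h d → ⊥
      la x∈ d s≤d d<x x<hd with locate m d | outer (spots C x∈)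
      ... | inj₁ d′          | _          = last C x∈ d′ s≤d d<x x<hd
      ... | inj₂ (inj₁ refl) | o          = disjoint o (d<x , x<hd)
      ... | inj₂ (inj₂ d′)   | o          =
        disjoint o (<-trans (a≤ d′) d<x , <-trans x<hd (proj₂ (right-ne d′)))

    stepʳ : ∀ {slot} → ColorClass h (suc m) b τ₁ slot → ColorClass h a b (τ₁ ++ y ∷ τ₂) slot
    stepʳ {s , σ} C = record
      { s-range = ≤-trans (lo mx) (≤-trans (n≤1+n m) (proj₁ (s-range C))) , proj₂ (s-range C)
      ; begins  = inj₂ ([ (λ { refl → m , dm , refl , (λ x∈ → inner (spots C x∈)) })
                        , (λ (d , dd , r) → d , D-right mx dd , r) ]′ (begins C))
      ; spots   = λ x∈ → spot (spots C x∈)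
      ; notNE   = ne
      ; last    = la
      ; sorted  = sorted C }
      where
      spot : ∀ {x} → Spot (suc m) b τ₁ x → Spot a b (τ₁ ++ y ∷ τ₂) x
      spot (inj₁ (m<x , x<b)) = inj₁ (≤-trans (lo mx) (<⇒≤ m<x) , x<b)
      spot (inj₂ x∈)          = inj₂ (∈-++⁺ˡ x∈)
      ne : ∀ {x d} → x ∈ σ → D a b d → h d ≢ x
      ne x∈ d with locate m d
      ... | inj₁ d′          = λ { refl → disjoint (left-ne d′) (inner (spots C x∈)) }
      ... | inj₂ (inj₁ refl) = >⇒≢ (proj₂ (inner (spots C x∈)))
      ... | inj₂ (inj₂ d′)   = notNE C x∈ d′
      la : ∀ {x d} → x ∈ σ → D a b d → s ≤ d → d < x → x < h d → ⊥
      la x∈ d s≤d = last C x∈ (mkD (≤-trans (proj₁ (s-range C)) s≤d) (<b d) (desc d)) s≤d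

  -- Shows that a slot misses no point of its color: a point that is no endpoint lies in some slot,
  -- and its color tells in which.
  slots-cover : ∀ {a b h τ x} (c : Cart a b) (k : Conf h c τ) → Spot a b τ x →
                (∃[ d ] D a b d × h d ≡ x) ⊎
                (∃[ s ] ∃[ σ ] (s , σ) ∈ slots c k × x ∈ σ)
  slots-cover emp k (inj₁ (a≤x , x<a)) = contradiction (<-≤-trans x<a a≤x) (n≮n _)
  slots-cover emp k (inj₂ x∈) = inj₂ (_ , _ , here refl , x∈)
  slots-cover {a} {b} {h} {τ} {x} (top m mx l) k sp
    with slots-cover l k (spot sp)
    where
    spot : Spot a (suc m) τ x → Spot a m (m ∷ τ) x
    spot (inj₂ x∈)         = inj₂ (there x∈)
    spot (inj₁ (a≤x , x≤m)) with m≤n⇒m<n∨m≡n (≤-pred x≤m)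
    ... | inj₁ x<m  = inj₁ (a≤x , x<m)
    ... | inj₂ refl = inj₂ (here refl)
  ... | inj₁ (d , dd , e) = inj₁ (d , D-left mx dd , e)
  ... | inj₂ o = inj₂ o
  slots-cover {a} {b} {h} {τ} {x} (mid m mx m<b l r) (τ₁ , τ₂ , refl , k₁ , k₂) sp
    with spot sp
    where
    dm = D-max mx m<b
    spot : Spot a b (τ₁ ++ h m ∷ τ₂) x → h m ≡ x ⊎ Spot a m (m ∷ τ₂) x ⊎ Spot (suc m) b τ₁ x
    spot (inj₂ x∈) with ∈-++⁻ τ₁ x∈
    ... | inj₁ x∈₁          = inj₂ (inj₂ (inj₂ x∈₁))
    ... | inj₂ (here refl)  = inj₁ refl
    ... | inj₂ (there x∈₂)  = inj₂ (inj₁ (inj₂ (there x∈₂)))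
    spot (inj₁ (a≤x , x<b)) with <-cmp x m
    ... | tri< x<m _ _  = inj₂ (inj₁ (inj₁ (a≤x , x<m)))
    ... | tri≈ _ refl _ = inj₂ (inj₁ (inj₂ (here refl)))
    ... | tri> _ _ m<x  = inj₂ (inj₂ (inj₁ (m<x , x<b)))
  ... | inj₁ refl = inj₁ (m , D-max mx m<b , refl)
  ... | inj₂ (inj₁ sp₁) with slots-cover l k₁ sp₁
  ...   | inj₁ (d , dd , e) = inj₁ (d , D-left mx dd , e)
  ...   | inj₂ (s , σ , s∈ , x∈) = inj₂ (s , σ , ∈-++⁺ˡ s∈ , x∈)
  slots-cover {a} {b} {h} {τ} {x} (mid m mx m<b l r) (τ₁ , τ₂ , refl , k₁ , k₂) sp
    | inj₂ (inj₂ sp₂) with slots-cover r k₂ sp₂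
  ...   | inj₁ (d , dd , e) = inj₁ (d , D-right mx dd , e)
  ...   | inj₂ (s , σ , s∈ , x∈) = inj₂ (s , σ , ∈-++⁺ʳ (slots l k₁) s∈ , x∈)

  starts : ∀ {a b h τ} (c : Cart a b) → Conf h c τ → List ℕ
  starts c k = map proj₁ (slots c k)

  starts-range : ∀ {a b h τ s} (c : Cart a b) (k : Conf h c τ) → s ∈ starts c k → a ≤ s × s ≤ b
  starts-range emp k (here refl) = ≤-refl , ≤-refl
  starts-range (top m mx l) k s∈ =
    let a≤s , s≤m = starts-range l k s∈ in a≤s , m≤n⇒m≤1+n s≤m
  starts-range (mid m mx _ l r) (_ , _ , _ , k₁ , k₂) s∈
    with ∈-++⁻ (starts l k₁) (subst (_ ∈_) (map-++ proj₁ (slots l k₁) (slots r k₂)) s∈)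
  ... | inj₁ s∈₁ = let a≤s , s≤m = starts-range l k₁ s∈₁ in a≤s , ≤-trans s≤m (<⇒≤ (hi mx))
  ... | inj₂ s∈₂ = let m<s , s≤b = starts-range r k₂ s∈₂ in ≤-trans (lo mx) (<⇒≤ m<s) , s≤b

  starts-ascending : ∀ {a b h τ} (c : Cart a b) (k : Conf h c τ) → Ascending (starts c k)
  starts-ascending emp k = [] ∷ []
  starts-ascending (top m mx l) k = starts-ascending l k
  starts-ascending (mid m mx _ l r) (_ , _ , _ , k₁ , k₂) =
    subst Ascending (sym (map-++ proj₁ (slots l k₁) (slots r k₂)))
      (AllPairs.++⁺ (starts-ascending l k₁) (starts-ascending r k₂)
        (All.tabulate λ s∈ → All.tabulate λ t∈ →
          ≤-<-trans (proj₂ (starts-range l k₁ s∈)) (proj₁ (starts-range r k₂ t∈))))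

  starts-first : ∀ {a b h τ} (c : Cart a b) (k : Conf h c τ) → a ∈ starts c k
  starts-first emp k = here refl
  starts-first (top m mx l) k = starts-first l k
  starts-first (mid m mx _ l r) (_ , _ , _ , k₁ , k₂) =
    subst (_ ∈_) (sym (map-++ proj₁ (slots l k₁) (slots r k₂))) (∈-++⁺ˡ (starts-first l k₁))

  starts-descent : ∀ {a b h τ d} (c : Cart a b) (k : Conf h c τ) → End a b → D a b d →
                   suc d ∈ starts c k
  starts-descent emp k E d = ⊥-elim (D-empty d)
  starts-descent (top m mx l) k E d = starts-descent l k (End-left mx) (D-top E d)
  starts-descent (mid m mx _ l r) (_ , _ , _ , k₁ , k₂) E d =
    subst (_ ∈_) (sym (map-++ proj₁ (slots l k₁) (slots r k₂))) (go (locate m d))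
    where
    go : ∀ {d} → D _ m d ⊎ d ≡ m ⊎ D (suc m) _ d → suc d ∈ starts l k₁ ++ starts r k₂
    go (inj₁ d′)          = ∈-++⁺ˡ (starts-descent l k₁ (End-left mx) d′)
    go (inj₂ (inj₁ refl)) = ∈-++⁺ʳ (starts l k₁) (starts-first r k₂)
    go (inj₂ (inj₂ d′))   = ∈-++⁺ʳ (starts l k₁) (starts-descent r k₂ (End-right mx E) d′)

  -- Sorted words are feasible without a tail.

  concat-feasible : ∀ {a c b} (u : Cart a c) (v : Cart c b) (w : Cart a b) → a < c → c < b →
                    μ u ≤ 0 → μ v ≤ 0 → μ w ≤ 1
  concat-feasible emp _ _ a<a = contradiction a<a (n≮n _)
  concat-feasible (mid _ _ _ l r) _ _ _ _ μu _ =
    contradiction (≤-trans (m≤m⊔n 1 (μ l)) (≤-trans (m≤m+n _ (μ r)) μu)) λ ()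
  concat-feasible u@(top _ mx l) v w _ c<b μu μv
    with join {mx = mx} l v c<b (proj₂ (μ≤⇒V u μu)) (proj₂ (μ≤⇒V v μv))
  ... | w′ , inj₁ z       = ≤-trans (≤-reflexive (μ-irrelevant w w′)) (V⇒μ≤ w′ z)
  ... | w′ , inj₂ (_ , z) = ≤-trans (≤-reflexive (μ-irrelevant w w′)) (m≤n⇒m≤1+n z)

  -- In s(L) s(R) m, nonempty factors s(L) and s(R) need no tail by induction, their concatenation
  -- needs at most one entry, and m provides it.
  sorted-feasible : ∀ {σ τ a b} → σ ⟶ₛ τ → Seg p a b τ → (c : Cart a b) → a < b → μ c ≤ 0
  sorted-feasible s-empty [] c a<a = contradiction a<a (n≮n _)
  sorted-feasible {a = a} (s-LmR {L′ = L′} {R′} {m} L< R< sL sR) seg c _ with Seg-++⁻ L′ seg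
  ... | k , segL , seg′ with Seg-++⁻ R′ seg′
  ... | x , segR , refl ∷ [] =
    ≤-trans (≤-reflexive (μ-irrelevant c (top x mx w))) (∸-monoˡ-≤ {μ w} 1 μw≤1)
    where
    a≤k = Seg-≤ segL
    k≤x = Seg-≤ segR
    w = cart a x (≤-trans a≤k k≤x)
    u = cart a k a≤k
    v = cart k x k≤x
    mx : IsMax x a (suc x)
    mx = isMax (≤-trans a≤k k≤x) ≤-refl λ {i} a≤i i≤x i≢x →
      [ Seg-All segL (⟶ₛ-All sL L<) a≤i
      , (λ k≤i → Seg-All segR (⟶ₛ-All sR R<) k≤i (≤∧≢⇒< (≤-pred i≤x) i≢x)) ]′ (<-≤-connex i k)
    μw≤1 : μ w ≤ 1
    μw≤1 with m≤n⇒m<n∨m≡n a≤k | m≤n⇒m<n∨m≡n k≤x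
    ... | inj₁ a<k  | inj₁ k<x  = concat-feasible u v w a<k k<x
      (sorted-feasible sL segL u a<k) (sorted-feasible sR segR v k<x)
    ... | inj₁ a<k  | inj₂ refl = m≤n⇒m≤1+n (sorted-feasible sL segL w a<k)
    ... | inj₂ refl | inj₁ k<x  = m≤n⇒m≤1+n (sorted-feasible sR segR w k<x)
    ... | inj₂ refl | inj₂ refl = ≤-reflexive (μ-irrelevant w emp)

-- From valid hook configurations of a plot to hook maps and back.

module Plot (π : List ℕ) (p : ℕ → ℕ) (p-inj : ∀ {i j} → p i ≡ p j → i ≡ j)
            (p-height : ∀ i → p (toℕ i) ≡ height π i)
            (p-beyond : ∀ {i j} → i < j → length π ≤ j → p i < p j) where

  n : ℕ
  n = length π

  open Profile p p-inj public

  Desc⇒< : ∀ {i} → Desc i → suc i < n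
  Desc⇒< di = ≰⇒> λ n≤i → <-asym di (p-beyond (n<1+n _) n≤i)

  D-Desc : ∀ {i} → Desc i → D 0 n i
  D-Desc di = mkD z≤n (<-trans (n<1+n _) (Desc⇒< di)) di

  IsDescent⇒Desc : ∀ {i} → IsDescent π i → Desc (toℕ i)
  IsDescent⇒Desc {i} (j , e , lt) = subst₂ _<_ (trans (sym (p-height j)) (cong p e)) (sym (p-height i)) lt

  Desc⇒IsDescent : ∀ {i} → Desc (toℕ i) → IsDescent π i
  Desc⇒IsDescent {i} di = fromℕ< lt , toℕ-fromℕ< lt
    , subst₂ _<_ (trans (cong p (sym (toℕ-fromℕ< lt))) (p-height (fromℕ< lt))) (p-height i) di
    where lt = Desc⇒< di

  δ : Fin (#descents π) → ℕ
  δ ℓ = toℕ (d π ℓ)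

  δ-Desc : ∀ ℓ → Desc (δ ℓ)
  δ-Desc ℓ = IsDescent⇒Desc
    (proj₂ (∈-filter⁻ (isDescent? π) {xs = allFin n} (∈-lookup ℓ)))

  δ-surjective : ∀ {i} → Desc i → ∃[ ℓ ] δ ℓ ≡ i
  δ-surjective {i} di = index i∈ , trans (cong toℕ (sym (lookup-index i∈))) (toℕ-fromℕ< i<n)
    where
    i<n = <b (D-Desc di)
    i∈ : fromℕ< i<n ∈ descents π
    i∈ = ∈-filter⁺ (isDescent? π) (∈-allFin _)
           (Desc⇒IsDescent (subst Desc (sym (toℕ-fromℕ< i<n)) di))

  filter-ascending : ∀ {P : Fin n → Set} (P? : ∀ i → Dec (P i)) →
                     AllPairs _<ᶠ_ (filter P? (allFin n))
  filter-ascending P? = AllPairs.filter⁺ P? (AllPairs.tabulate⁺-< id)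

  δ-mono : ∀ {i j} → i <ᶠ j → δ i < δ j
  δ-mono = AllPairs-lookup (filter-ascending (isDescent? π))

  δ-mono⁻ : ∀ {i j} → δ i < δ j → i <ᶠ j
  δ-mono⁻ {i} {j} lt with Fin.<-cmp i j
  ... | tri< i<j _ _  = i<j
  ... | tri≈ _ refl _ = contradiction lt (n≮n _)
  ... | tri> _ _ j<i  = contradiction lt (<-asym (δ-mono j<i))

  δ-injective : ∀ {i j} → δ i ≡ δ j → i ≡ j
  δ-injective {i} {j} e with Fin.<-cmp i j
  ... | tri< i<j _ _ = contradiction e (<⇒≢ (δ-mono i<j))
  ... | tri≈ _ e′ _  = e′
  ... | tri> _ _ j<i = contradiction e (>⇒≢ (δ-mono j<i))

  open Hook
  open VHC

  ν : VHC π → Fin (#descents π) → ℕ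
  ν H ℓ = toℕ (ne (hooks H ℓ))

  hookMap : VHC π → ℕ → ℕ
  hookMap H i with Fin.any? (λ ℓ → δ ℓ ≟ i)
  ... | yes (ℓ , _) = ν H ℓ
  -- A default off the descents, where no condition consults the map.
  ... | no  _       = 0

  hookMap-δ : ∀ (H : VHC π) ℓ → hookMap H (δ ℓ) ≡ ν H ℓ
  hookMap-δ H ℓ with Fin.any? (λ ℓ′ → δ ℓ′ ≟ δ ℓ)
  ... | yes (ℓ′ , e) = cong (ν H) (δ-injective e)
  ... | no  ¬e       = contradiction (ℓ , refl) ¬e

  δ<ν : ∀ (H : VHC π) ℓ → δ ℓ < ν H ℓ
  δ<ν H ℓ = subst (λ s → toℕ s < ν H ℓ) (sw≡d H ℓ) (sw<ne (hooks H ℓ))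

  pδ<pν : ∀ (H : VHC π) ℓ → p (δ ℓ) < p (ν H ℓ)
  pδ<pν H ℓ = subst₂ _<_
    (trans (cong (height π) (sw≡d H ℓ)) (sym (p-height _))) (sym (p-height _)) (rises (hooks H ℓ))

  Tail₀ : Tail 0 n []
  Tail₀ = mkTail [] (λ ()) (λ ())

  End₀ : End 0 n
  End₀ _ eq di = n≮n n (subst (_< n) eq (Desc⇒< di))

  under : ∀ (H : VHC π) ℓ {x} → δ ℓ < x → x < ν H ℓ → p x < p (ν H ℓ)
  under H ℓ {x} lt x<ν = ≤∧≢⇒< (≮⇒≥ λ gt → noneAbove H ℓ (fromℕ< x<n)
      ( subst₂ _<_ (cong toℕ (sym (sw≡d H ℓ))) (sym toℕ≡x) lt
      , subst (_< ν H ℓ) (sym toℕ≡x) x<ν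
      , subst₂ _<_ (p-height _) (trans (cong p (sym toℕ≡x)) (p-height _)) gt))
    (λ eq → <⇒≢ x<ν (p-inj eq))
    where
    x<n = <-trans x<ν (toℕ<n (ne (hooks H ℓ)))
    toℕ≡x = toℕ-fromℕ< x<n

  sw-δ : ∀ (H : VHC π) ℓ → toℕ (sw (hooks H ℓ)) ≡ δ ℓ
  sw-δ H ℓ = cong toℕ (sw≡d H ℓ)

  -- Otherwise the hooks share their northeast endpoint, or the vertical segment of the later one
  -- crosses the horizontal segment of the earlier one; neither contact is permitted.
  ν-nested : ∀ (H : VHC π) {i j} → δ i < δ j → ν H i ≤ δ j ⊎ ν H j < ν H i
  ν-nested H {i} {j} lt with <-≤-connex (δ j) (ν H i)
  ... | inj₂ ge = inj₁ ge
  ... | inj₁ δj<νi with <-cmp (ν H j) (ν H i)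
  ...   | tri< l _ _ = inj₂ l
  ...   | tri≈ _ eq _ = ⊥-elim (case meet of λ where
      (inj₁ (_ , r)) → <⇒≢ δj<νi (sym (trans (cong proj₁ r) (sw-δ H j)))
      (inj₂ (r , _)) → >⇒≢ (δ<ν H i) (trans (cong proj₁ r) (sw-δ H i)))
    where
    meet = disjoint H {i} {j} (λ { refl → n≮n _ lt }) (point π (ne (hooks H i)))
      (inj₂ (refl , <⇒≤ (sw<ne (hooks H i)) , ≤-refl))
      (inj₂ ( cong (height π) (sym (toℕ-injective eq))
            , ≤-trans (<⇒≤ (sw<ne (hooks H j))) (≤-reflexive eq) , ≤-reflexive (sym eq)))
  ...   | tri> _ _ gt = ⊥-elim (case meet of λ where
      (inj₁ (r , _)) → <⇒≢ δj<νi (cong proj₁ r)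
      (inj₂ (r , _)) → >⇒≢ lt (trans (cong proj₁ r) (sw-δ H i)))
    where
    meet = disjoint H {i} {j} (λ { refl → n≮n _ lt }) (δ j , height π (ne (hooks H i)))
      (inj₂ (refl , subst (_≤ δ j) (sym (sw-δ H i)) (<⇒≤ lt) , <⇒≤ δj<νi))
      (inj₁ ( sym (sw-δ H j)
            , subst₂ _≤_ (trans (p-height _) (cong (height π) (sym (sw≡d H j)))) (p-height _)
                (<⇒≤ (under H i lt δj<νi))
            , subst₂ _≤_ (p-height _) (p-height _) (<⇒≤ (under H j δj<νi gt))))

  hookMap-elim : ∀ (H : VHC π) (P : ℕ → ℕ → Set) → (∀ ℓ → P (δ ℓ) (ν H ℓ)) →
                 ∀ {i} → Desc i → P i (hookMap H i)
  hookMap-elim H P f di with δ-surjective di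
  ... | ℓ , refl = subst (P (δ ℓ)) (sym (hookMap-δ H ℓ)) (f ℓ)

  VHC⇒Hooks : ∀ (H : VHC π) → Hooks (hookMap H) 0 n []
  VHC⇒Hooks H = record
    { right  = hookMap-elim H _<_ (δ<ν H) ∘ desc
    ; range  = λ d → inj₁ (hookMap-elim H (λ _ y → y < n) (λ ℓ → toℕ<n (ne (hooks H ℓ))) (desc d))
    ; rise   = hookMap-elim H (λ i y → p i < p y) (pδ<pν H) ∘ desc
    ; none   = λ d → hookMap-elim H (λ i y → i < _ → _ < y → p _ < p y) (λ ℓ → under H ℓ) (desc d)
    ; nested = λ d d′ → hookMap-elim H (λ i y → i < _ → y ≤ _ ⊎ hookMap H _ < y)
        (λ ℓ → hookMap-elim H (λ j z → δ ℓ < j → ν H ℓ ≤ j ⊎ z < ν H ℓ)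
          (λ ℓ′ → ν-nested H) (desc d′)) (desc d)
    }

  module _ {h} (K : Hooks h 0 n []) where

    private
      D-δ : ∀ ℓ → D 0 n (δ ℓ)
      D-δ ℓ = D-Desc (δ-Desc ℓ)

      h<n : ∀ ℓ → h (δ ℓ) < n
      h<n ℓ with range K (D-δ ℓ)
      ... | inj₁ lt = lt

      hook : Fin (#descents π) → Hook π
      hook ℓ = record
        { sw = d π ℓ ; ne = fromℕ< (h<n ℓ)
        ; sw<ne = subst (δ ℓ <_) (sym (toℕ-fromℕ< (h<n ℓ))) (right K (D-δ ℓ))
        ; rises = subst₂ _<_ (p-height _) (trans (cong p (sym (toℕ-fromℕ< (h<n ℓ)))) (p-height _))
                    (rise K (D-δ ℓ)) }

      ne-h : ∀ ℓ → toℕ (ne (hook ℓ)) ≡ h (δ ℓ)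
      ne-h ℓ = toℕ-fromℕ< (h<n ℓ)

      height-h : ∀ ℓ → height π (ne (hook ℓ)) ≡ p (h (δ ℓ))
      height-h ℓ = trans (sym (p-height _)) (cong p (ne-h ℓ))

      at-corner : ∀ {i j} → δ i < δ j → δ j ≤ h (δ i) → p (h (δ i)) ≤ p (h (δ j)) → h (δ i) ≡ δ j
      at-corner {i} {j} lt le p≤ =
        [ (λ ge → ≤-antisym ge le)
        , (λ gt → contradiction p≤ (<⇒≱ (none K (D-δ i) (<-trans lt (right K (D-δ j))) gt)))
        ]′ (nested K (D-δ i) (D-δ j) lt)

      ne-distinct : ∀ {i j} → δ i < δ j → h (δ i) ≢ h (δ j)
      ne-distinct {i} {j} lt eq =
        [ (λ le → <⇒≱ (right K (D-δ j)) (subst (_≤ δ j) eq le))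
        , (λ gt → <⇒≢ gt (sym eq)) ]′ (nested K (D-δ i) (D-δ j) lt)

      -- Nested hooks can only meet where the horizontal segment of the earlier one reaches the
      -- vertical segment of the later one; comparing heights forces this to be the end of the first
      -- and the start of the second.
      touch : ∀ i j → δ i < δ j → ∀ z → OnHook π (hook i) z → OnHook π (hook j) z →
              z ≡ point π (ne (hook i)) × z ≡ point π (sw (hook j))
      touch i j lt (x , y) (inj₁ (x≡ , _)) (inj₁ (x≡′ , _)) =
        contradiction (trans (sym x≡) x≡′) (<⇒≢ lt)
      touch i j lt (x , y) (inj₁ (x≡ , _)) (inj₂ (_ , le , _)) =
        contradiction lt (≤⇒≯ (subst (δ j ≤_) x≡ le))
      touch i j lt (x , y) (inj₂ (y≡ , _)) (inj₂ (y≡′ , _)) =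
        contradiction (p-inj (trans (sym (height-h i)) (trans (sym y≡) (trans y≡′ (height-h j)))))
          (ne-distinct lt)
      touch i j lt (x , y) (inj₂ (y≡ , _ , x≤)) (inj₁ (x≡ , _ , y≤)) =
          cong₂ _,_ (trans x≡ (trans (sym corner) (sym (ne-h i)))) y≡
        , cong₂ _,_ x≡ (trans y≡ (trans (height-h i) (trans (cong p corner) (p-height _))))
        where
        corner : h (δ i) ≡ δ j
        corner = at-corner lt (subst₂ _≤_ x≡ (ne-h i) x≤)
          (subst₂ _≤_ (trans y≡ (height-h i)) (height-h j) y≤)

    Hooks⇒VHC : VHC π
    Hooks⇒VHC = record
      { hooks = hook
      ; sw≡d = λ _ → refl
      ; noneAbove = λ ℓ m (lt , gt , above) → <-asym
          (none K (D-δ ℓ) lt (subst (toℕ m <_) (ne-h ℓ) gt))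
          (subst₂ _<_ (height-h ℓ) (sym (p-height m)) above)
      ; disjoint = λ {i} {j} i≢j z on on′ → case <-cmp (δ i) (δ j) of λ where
          (tri< lt _ _) → inj₁ (touch i j lt z on on′)
          (tri≈ _ eq _) → contradiction (δ-injective eq) i≢j
          (tri> _ _ gt) → inj₂ (let r , s = touch j i gt z on′ on in s , r)
      }

    hookMap-Hooks⇒VHC : ∀ {i} → D 0 n i → h i ≡ hookMap Hooks⇒VHC i
    hookMap-Hooks⇒VHC dd with δ-surjective (desc dd)
    ... | ℓ , refl = trans (sym (ne-h ℓ)) (sym (hookMap-δ Hooks⇒VHC ℓ))

  -- As no point lies above a hook, lying weakly below it depends on the position alone.
  weaklyBelow⁺ : ∀ (H : VHC π) ℓ z → δ ℓ < toℕ z → toℕ z ≤ ν H ℓ → WeaklyBelow π (hooks H ℓ) z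
  weaklyBelow⁺ H ℓ z lt le with m≤n⇒m<n∨m≡n le
  ... | inj₁ lt′ = inj₁ ( subst (_< toℕ z) (sym (sw-δ H ℓ)) lt , lt′
                        , subst₂ _<_ (p-height _) (p-height _) (under H ℓ lt lt′))
  ... | inj₂ eq  = inj₂ (toℕ-injective eq)

  weaklyBelow⁻ : ∀ (H : VHC π) ℓ z → WeaklyBelow π (hooks H ℓ) z → δ ℓ < toℕ z × toℕ z ≤ ν H ℓ
  weaklyBelow⁻ H ℓ z (inj₁ (lt , gt , _)) = subst (_< toℕ z) (sw-δ H ℓ) lt , <⇒≤ gt
  weaklyBelow⁻ H ℓ z (inj₂ refl) = δ<ν H ℓ , ≤-refl

  IsCanonical⇒Lowest : ∀ (H : VHC π) → IsCanonical π H → ∀ {m} → Desc m → Lowest (hookMap H) m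
  IsCanonical⇒Lowest H can dm with δ-surjective dm
  ... | ℓ , refl rewrite hookMap-δ H ℓ = go
    where
    go : ∀ {z} → δ ℓ < z → p (δ ℓ) < p z →
         (∀ {j} → Desc j → δ ℓ < j → j < z → z ≤ hookMap H j → ⊥) → p (ν H ℓ) ≤ p z
    go {z} lt p< free with <-≤-connex z n
    -- Positions past the end of π are higher than all of its points.
    ... | inj₂ n≤z = <⇒≤ (p-beyond (<-≤-trans (toℕ<n (ne (hooks H ℓ))) n≤z) n≤z)
    ... | inj₁ z<n = subst₂ _≤_ (sym (p-height _)) (trans (sym (p-height _)) (cong p z≡))
      (proj₂ (can ℓ) (fromℕ< z<n)
        ( subst (δ ℓ <_) (sym z≡) lt
        , subst₂ _<_ (p-height _) (trans (cong p (sym z≡)) (p-height _)) p<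
        , λ j ℓ<j wb → let a , b = weaklyBelow⁻ H j (fromℕ< z<n) wb in
            free (δ-Desc j) (δ-mono ℓ<j) (subst (δ j <_) z≡ a)
              (subst₂ _≤_ z≡ (sym (hookMap-δ H j)) b)))
      where z≡ = toℕ-fromℕ< z<n

  Lowest⇒IsCanonical : ∀ (H : VHC π) → (∀ {m} → Desc m → Lowest (hookMap H) m) → IsCanonical π H
  Lowest⇒IsCanonical H low ℓ =
      ( δ<ν H ℓ , subst₂ _<_ (p-height _) (p-height _) (pδ<pν H ℓ)
      , λ j ℓ<j wb → let a , b = weaklyBelow⁻ H j _ wb in
          case ν-nested H (δ-mono ℓ<j) of λ where
            (inj₁ le) → <⇒≱ a le
            (inj₂ lt) → <⇒≱ lt b)
    , λ z (lt , p< , free) → subst₂ _≤_ (trans (cong p (hookMap-δ H ℓ)) (p-height _)) (p-height z)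
        (low (δ-Desc ℓ) lt (subst₂ _<_ (sym (p-height _)) (sym (p-height _)) p<)
          λ dj m<j j<z z≤ → unfree z free (δ-surjective dj) m<j j<z z≤)
    where
    unfree : ∀ z → (∀ j → ℓ <ᶠ j → ¬ WeaklyBelow π (hooks H j) z) →
             ∀ {j} → ∃[ ℓ′ ] δ ℓ′ ≡ j → δ ℓ < j → j < toℕ z → toℕ z ≤ hookMap H j → ⊥
    unfree z free (ℓ′ , refl) m<j j<z z≤ = free ℓ′ (δ-mono⁻ m<j)
      (weaklyBelow⁺ H ℓ′ z j<z (subst (toℕ z ≤_) (hookMap-δ H ℓ′) z≤))

  start : Color π → ℕ
  start zero    = 0
  start (suc ℓ) = suc (δ ℓ)

  module _ (H : VHC π) (c : Cart 0 n) (k : Conf (hookMap H) c []) where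

    private
      S : List (ℕ × List ℕ)
      S = slots c k

      classes : ∀ {s σ} → (s , σ) ∈ S → ColorClass (hookMap H) 0 n [] (s , σ)
      classes = All.lookup (ColorClasses c Tail₀ End₀ k)

      over : ∀ ℓ (m : Fin n) → δ ℓ < toℕ m → toℕ m < ν H ℓ → Below π (hooks H ℓ) m
      over ℓ m lt gt = subst (_< toℕ m) (sym (sw-δ H ℓ)) lt , gt
        , subst₂ _<_ (p-height _) (p-height _) (under H ℓ lt gt)

      -- By nesting, the lowest hook above a point is the one that starts last. This matches the
      -- definition of colors with `ColorClass`.
      lower : ∀ {i j} (m : Fin n) → δ i < toℕ m → toℕ m < ν H i → δ j < toℕ m → δ i < δ j →
              height π (ne (hooks H j)) < height π (ne (hooks H i))
      lower {i} {j} m i<m m<i j<m i<j =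
        [ (λ le → contradiction (<-≤-trans m<i le) (<-asym j<m))
        , (λ lt → subst₂ _<_ (p-height _) (p-height _) (under H i (<-trans i<j (δ<ν H j)) lt))
        ]′ (ν-nested H i<j)

      starts-≡ : starts c k ≡ tabulate start
      starts-≡ = ascending-ext (starts-ascending c k)
        (All.tabulate (λ s∈ → positive (∈-tabulate⁻ s∈)) ∷
          AllPairs.tabulate⁺-< (λ i<j → s≤s (δ-mono i<j)))
        sound complete
        where
        positive : ∀ {s} → ∃[ i ] s ≡ suc (δ i) → 0 < s
        positive (_ , refl) = s≤s z≤n
        sound : ∀ {s} → s ∈ starts c k → s ∈ tabulate start
        sound s∈ with ∈-map⁻ proj₁ s∈
        ... | (s , σ) , s∈S , refl with begins (classes s∈S)
        ...   | inj₁ refl = here refl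
        ...   | inj₂ (_ , dd , refl , _) with δ-surjective (desc dd)
        ...     | ℓ , refl = ∈-tabulate⁺ {f = start} (suc ℓ)
        complete : ∀ {s} → s ∈ tabulate start → s ∈ starts c k
        complete s∈ with ∈-tabulate⁻ {f = start} s∈
        ... | zero  , refl = starts-first c k
        ... | suc ℓ , refl = starts-descent c k End₀ (D-Desc (δ-Desc ℓ))

      Counted : Color π → Fin n → Set
      Counted i m = (¬ IsNE π H m) × HasColor π H m i

      σ⇒counted : ∀ {σ} i → (start i , σ) ∈ S → ∀ m → toℕ m ∈ σ → Counted i m
      σ⇒counted {σ} i s∈ m m∈ = notNE′ , color i s∈
        where
        notNE′ : ¬ IsNE π H m
        notNE′ (ℓ , refl) = notNE (classes s∈) m∈ (D-Desc (δ-Desc ℓ)) (hookMap-δ H ℓ)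
        none-later : ∀ i → (start i , σ) ∈ S → ∀ ℓ → start i ≤ δ ℓ → ¬ Below π (hooks H ℓ) m
        none-later i s∈ ℓ s≤ (lt , gt , _) = last (classes s∈) m∈ (D-Desc (δ-Desc ℓ)) s≤
          (subst (_< toℕ m) (sw-δ H ℓ) lt) (subst (toℕ m <_) (sym (hookMap-δ H ℓ)) gt)
        color : ∀ i → (start i , σ) ∈ S → HasColor π H m i
        color zero    s∈ ℓ = none-later zero s∈ ℓ z≤n
        color (suc i) s∈ with begins (classes s∈)
        ... | inj₂ (_ , _ , refl , covers) = over i m i<m m<i , λ j below →
          [ (λ j≤i → [ (λ j<i → <⇒≤ (lower {j} {i} m (subst (_< toℕ m) (sw-δ H j) (proj₁ below))
                                       (proj₁ (proj₂ below)) i<m j<i))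
                     , (λ eq → ≤-reflexive (cong (λ ℓ → height π (ne (hooks H ℓ))) (δ-injective (sym eq))))
                     ]′ (m≤n⇒m<n∨m≡n j≤i))
          , (λ i<j → contradiction below (none-later (suc i) s∈ j i<j)) ]′ (≤-<-connex (δ j) (δ i))
          where
          i<m = proj₁ (covers m∈)
          m<i = subst (toℕ m <_) (hookMap-δ H i) (proj₂ (covers m∈))

      counted⇒start : ∀ {s σ} i → (s , σ) ∈ S → ∀ m → toℕ m ∈ σ → Counted i m → s ≡ start i
      counted⇒start i s∈ m m∈ (_ , color) with begins (classes s∈)
      counted⇒start zero s∈ m m∈ _ | inj₁ s≡0 = s≡0
      counted⇒start (suc i) s∈ m m∈ (_ , (lt , gt , _) , _) | inj₁ s≡0 =
        ⊥-elim (last (classes s∈) m∈ (D-Desc (δ-Desc i)) (≤-trans (≤-reflexive s≡0) z≤n)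
          (subst (_< toℕ m) (sw-δ H i) lt) (subst (toℕ m <_) (sym (hookMap-δ H i)) gt))
      counted⇒start i s∈ m m∈ _ | inj₂ (_ , dd , refl , covers) with δ-surjective (desc dd)
      counted⇒start zero s∈ m m∈ (_ , color) | inj₂ (_ , dd , refl , covers) | ℓ , refl =
        contradiction (over ℓ m (proj₁ (covers m∈))
          (subst (toℕ m <_) (hookMap-δ H ℓ) (proj₂ (covers m∈)))) (color ℓ)
      counted⇒start (suc i) s∈ m m∈ (_ , (lt , gt , _) , color) | inj₂ (_ , dd , refl , covers) | ℓ , refl =
        cong suc ([ (λ ℓ<i → ⊥-elim (last (classes s∈) m∈ (D-Desc (δ-Desc i)) ℓ<i i<m
                       (subst (toℕ m <_) (sym (hookMap-δ H i)) gt)))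
                  , (λ i≤ℓ → [ (λ i<ℓ → contradiction (color ℓ (over ℓ m ℓ<m m<ℓ))
                                           (<⇒≱ (lower {i} {ℓ} m i<m gt ℓ<m i<ℓ)))
                             , sym ]′ (m≤n⇒m<n∨m≡n i≤ℓ))
                  ]′ (<-≤-connex (δ ℓ) (δ i)))
        where
        i<m = subst (_< toℕ m) (sw-δ H i) lt
        ℓ<m = proj₁ (covers m∈)
        m<ℓ = subst (toℕ m <_) (hookMap-δ H ℓ) (proj₂ (covers m∈))

      counted? : ∀ i m → Dec (Counted i m)
      counted? i m = ¬? (isNE? π H m) ×-dec hasColor? π H m i

      class-size : ∀ {s σ} i → (s , σ) ∈ S → s ≡ start i → length σ ≡ q π H i
      class-size {σ = σ} i s∈ refl = trans (cong length σ≡) (length-map toℕ (filter (counted? i) (allFin n)))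
        where
        σ≡ : σ ≡ map toℕ (filter (counted? i) (allFin n))
        σ≡ = ascending-ext (sorted (classes s∈)) (AllPairs.map⁺ (filter-ascending (counted? i))) to from
          where
          to : ∀ {x} → x ∈ σ → x ∈ map toℕ (filter (counted? i) (allFin n))
          to x∈ with spots (classes s∈) x∈
          ... | inj₁ (_ , x<n) = subst (_∈ _) (toℕ-fromℕ< x<n)
            (∈-map⁺ toℕ (∈-filter⁺ (counted? i) (∈-allFin (fromℕ< x<n))
              (σ⇒counted i s∈ _ (subst (_∈ σ) (sym (toℕ-fromℕ< x<n)) x∈))))
          from : ∀ {x} → x ∈ map toℕ (filter (counted? i) (allFin n)) → x ∈ σ
          from x∈ with ∈-map⁻ toℕ x∈
          ... | m , m∈ , refl with ∈-filter⁻ (counted? i) {xs = allFin n} m∈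
          ...   | _ , counted with slots-cover c k (inj₁ (z≤n , toℕ<n m))
          ...     | inj₁ (_ , dd , eq) with δ-surjective (desc dd)
          ...       | ℓ , refl = contradiction (ℓ , toℕ-injective (trans (sym (hookMap-δ H ℓ)) eq)) (proj₁ counted)
          from x∈ | m , m∈ , refl | _ , counted | inj₂ (s′ , σ′ , s′∈ , m∈′) =
            subst (toℕ m ∈_) (key-unique (starts-ascending c k)
              (subst (λ s → (s , σ′) ∈ S) (counted⇒start i s′∈ m m∈′ counted) s′∈) s∈) m∈′

    sizes-q : sizes (slots c k) ≡ tabulate (q π H)
    sizes-q = map-≡-tabulate S {u = start} {q π H} starts-≡ (λ {_} {i} → class-size i)

  compositions⁺ : (c : Cart 0 n) → 0 < n → (H : VHC π) → V c 0 (tabulate (q π H))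
  compositions⁺ c 0<n H = subst (V c 0) (sizes-q H c k) (Conf⇒V c k)
    where k = Hooks⇒Conf c Tail₀ (inj₁ 0<n) (VHC⇒Hooks H)

  compositions⁻ : (c : Cart 0 n) → ∀ {r} → V c 0 r → ∃[ H ] tabulate (q π H) ≡ r
  compositions⁻ c v with V⇒Conf c [] v
  ... | h , k , refl with Conf-cong c (hookMap-Hooks⇒VHC (Conf⇒Hooks c Tail₀ End₀ k)) k
  ... | k′ , eq , _ = Hooks⇒VHC (Conf⇒Hooks c Tail₀ End₀ k) , trans (sym (sizes-q _ c k′)) (cong sizes eq)

  canonical-exists : (c : Cart 0 n) → μ c ≤ 0 → ∃[ H ] IsCanonical π H
  canonical-exists c μ≤0 with Canon-exists c [] μ≤0
  ... | h , k , can with Conf-cong c (hookMap-Hooks⇒VHC (Conf⇒Hooks c Tail₀ End₀ k)) k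
  ... | k′ , _ , f = Hooks⇒VHC (Conf⇒Hooks c Tail₀ End₀ k) , Lowest⇒IsCanonical _ λ dm →
    -- Without a tail, positions from n on fall under the third alternative of `Covered`.
    Canon⇒Lowest c Tail₀ End₀ k′ (f can) (λ n≤x →
      inj₂ (inj₂ ((λ _ i<n → p-beyond (<-≤-trans i<n n≤x) n≤x) , λ ()))) (D-Desc dm)

  -- The decreasing tree of the canonical configuration.

  module _ (H : VHC π) where

    private
      h : ℕ → ℕ
      h = hookMap H
      K = VHC⇒Hooks H

    ν-injective : ∀ {i j} → ν H i ≡ ν H j → i ≡ j
    ν-injective {i} {j} eq with <-cmp (δ i) (δ j)
    ... | tri≈ _ e _  = δ-injective e
    ... | tri< lt _ _ = ⊥-elim ([ (λ le → <⇒≱ (δ<ν H j) (subst (_≤ δ j) eq le))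
                                , (λ gt → <⇒≢ gt (sym eq)) ]′ (ν-nested H lt))
    ... | tri> _ _ lt = ⊥-elim ([ (λ le → <⇒≱ (δ<ν H i) (subst (_≤ δ i) (sym eq) le))
                                , (λ gt → <⇒≢ gt eq) ]′ (ν-nested H lt))

    LeftChild-unique : ∀ {i i′ j} → LeftChild H i j → LeftChild H i′ j → i ≡ i′
    LeftChild-unique (ℓ , refl , e) (ℓ′ , refl , e′) =
      cong (λ ℓ → sw (hooks H ℓ)) (ν-injective (cong toℕ (trans e (sym e′))))

    RightChild-unique : ∀ {i i′ j} → RightChild H i j → RightChild H i′ j → i ≡ i′
    RightChild-unique (e , _) (e′ , _) = toℕ-injective (suc-injective (trans e (sym e′)))

    ΘAt-unique : ∀ {j t t′} → ΘAt H j t → ΘAt H j t′ → t ≡ t′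
    ΘAt-unique (leaf _ _)      (leaf _ _)        = refl
    ΘAt-unique (leaf ¬l _)     (nodeL l _ _)     = contradiction l (¬l _)
    ΘAt-unique (leaf _ ¬r)     (nodeR _ r _)     = contradiction r (¬r _)
    ΘAt-unique (leaf _ ¬r)     (nodeLR _ _ r _)  = contradiction r (¬r _)
    ΘAt-unique (nodeL l _ _)   (leaf ¬l _)       = contradiction l (¬l _)
    ΘAt-unique (nodeL l x _)   (nodeL l′ x′ _)   with refl ← LeftChild-unique l l′ =
      cong (nodeL _) (ΘAt-unique x x′)
    ΘAt-unique (nodeL l _ _)   (nodeR ¬l _ _)    = contradiction l (¬l _)
    ΘAt-unique (nodeL _ _ ¬r)  (nodeLR _ _ r _)  = contradiction r (¬r _)
    ΘAt-unique (nodeR _ r _)   (leaf _ ¬r)       = contradiction r (¬r _)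
    ΘAt-unique (nodeR ¬l _ _)  (nodeL l _ _)     = contradiction l (¬l _)
    ΘAt-unique (nodeR _ r x)   (nodeR _ r′ x′)   with refl ← RightChild-unique r r′ =
      cong (nodeR _) (ΘAt-unique x x′)
    ΘAt-unique (nodeR ¬l _ _)  (nodeLR l _ _ _)  = contradiction l (¬l _)
    ΘAt-unique (nodeLR _ _ r _) (leaf _ ¬r)      = contradiction r (¬r _)
    ΘAt-unique (nodeLR _ _ r _) (nodeL _ _ ¬r)   = contradiction r (¬r _)
    ΘAt-unique (nodeLR l _ _ _) (nodeR ¬l _ _)   = contradiction l (¬l _)
    ΘAt-unique (nodeLR l x r y) (nodeLR l′ x′ r′ y′)
      with refl ← LeftChild-unique l l′ | refl ← RightChild-unique r r′ =
      cong₂ (nodeLR _) (ΘAt-unique x x′) (ΘAt-unique y y′)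

    -- Identifies the tree that a run of the construction supplies with the one built by recursion
    -- below.
    IsΘ-unique : ∀ {t t′} → IsΘ H t → IsΘ H t′ → t ≡ t′
    IsΘ-unique (j , e , x) (j′ , e′ , x′)
      with refl ← toℕ-injective {i = j} {j′} (suc-injective (trans e (sym e′))) = ΘAt-unique x x′

    -- The subtree of Θ(H) at x occupies the positions from a to x.
    record Closed (a x : ℕ) : Set where
      field
        inside  : ∀ {i} → D a x i → h i ≤ x
        outside : ∀ {i} → Desc i → i < a → a ≤ h i → h i ≤ x → ⊥
        first   : ∀ {i} → suc i ≡ a → Desc i

    open Closed

    -- A maximum before x would be a descent whose hook ends within the interval at a higher point.
    Closed-max : ∀ {a x} → a ≤ x → x < n → Closed a x → IsMax x a (suc x)
    Closed-max {a} {x} a≤x x<n C with IsMax-exists a (x ∸ a)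
    ... | m , mx rewrite m+[n∸m]≡n a≤x with m≤n⇒m<n∨m≡n (≤-pred (hi mx))
    ...   | inj₂ refl = mx
    ...   | inj₁ m<x  = contradiction (rise K d₀)
      (<-asym (max mx (≤-trans (lo mx) (<⇒≤ (right K d₀))) (s≤s (inside C dC)) (>⇒≢ (right K d₀))))
      where
      dm = desc (D-max mx (s≤s m<x))
      dC = mkD (lo mx) m<x dm
      d₀ = D-Desc dm

    Hooks-restrict : ∀ {a b τ} → (∀ {i} → D a b i → h i < b ⊎ h i ∈ τ) → Hooks h a b τ
    Hooks-restrict f = record
      { right = right K ∘ up ; range = f ; rise = rise K ∘ up ; none = none K ∘ up
      ; nested = λ d d′ → nested K (up d) (up d′) }
      where
      up : ∀ {a b i} → D a b i → D 0 n i
      up = D-Desc ∘ desc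

    module _ (can : IsCanonical π H) where

      record Subtree (a x : ℕ) (j : Fin n) : Set where
        field
          tree  : BinTree ℕ
          isΘAt : ΘAt H j tree
          noL   : NoL tree
          Credit⇔V   : (c : Cart a (suc x)) → ∀ {r} → Credit (relabel tree) r ⇔ V c 0 r

      open Subtree

      private
        leaf-subtree : ∀ a j → toℕ j ≡ a → Closed a a → Subtree a a j
        leaf-subtree a j refl C = record
          { tree  = leaf (height π j)
          ; isΘAt = leaf (λ { i (ℓ , refl , e) → outside C (δ-Desc ℓ)
                               (subst (δ ℓ <_) (cong toℕ e) (δ<ν H ℓ))
                               (≤-reflexive (sym (trans (hookMap-δ H ℓ) (cong toℕ e))))
                               (≤-reflexive (trans (hookMap-δ H ℓ) (cong toℕ e))) })
                         (λ i (e , ¬d) → ¬d (Desc⇒IsDescent (first C e)))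
          ; noL   = leaf
          ; Credit⇔V   = λ c → mk⇔
              (λ { refl → V-irrelevant single c (s≤s z≤n , refl) })
              (λ v → proj₂ (V-irrelevant c single v))
          }
          where
          single : Cart a (suc a)
          single = top a (Closed-max ≤-refl (toℕ<n j) C) emp

        nodeR-subtree : ∀ a x j j′ → toℕ j ≡ suc x → toℕ j′ ≡ x → a ≤ x → Closed a (suc x) →
                        (∀ ℓ → ν H ℓ ≢ suc x) → ¬ Desc x → Subtree a x j′ → Subtree a (suc x) j
        nodeR-subtree a x j j′ j≡ j′≡ a≤x C no-ne ¬dx S = record
          { tree  = nodeR (height π j) (tree S)
          ; isΘAt = nodeR (λ { i (ℓ , _ , e) → no-ne ℓ (trans (cong toℕ e) j≡) })
                          (trans (cong suc j′≡) (sym j≡) , λ d → ¬dx (subst Desc j′≡ (IsDescent⇒Desc d)))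
                          (isΘAt S)
          ; noL   = nodeR (noL S)
          ; Credit⇔V   = λ c → mk⇔
              (λ (r₀ , m , i) → V-irrelevant (top (suc x) mx w) c
                (V-suc⁺ w (Equivalence.to (Credit⇔V S w) m) i))
              (λ v → let q₀ , v₀ , i = V-suc⁻ w (V-irrelevant c (top (suc x) mx w) v) μw≤0
                     in q₀ , Equivalence.from (Credit⇔V S w) v₀ , i)
          }
          where
          mx = Closed-max (m≤n⇒m≤1+n a≤x) (subst (_< n) j≡ (toℕ<n j)) C
          w = cart a (suc x) (m≤n⇒m≤1+n a≤x)
          -- Any credited composition of the smaller subtree proves its word feasible without a
          -- tail, as (1) requires.
          μw≤0 : μ w ≤ 0
          μw≤0 = V⇒μ≤ w (Equivalence.to (Credit⇔V S w) (proj₂ (proj₂ (Credit-inhabited (relabel (tree S))))))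

        nodeLR-subtree : ∀ a x j j′ ℓ → toℕ j ≡ suc x → toℕ j′ ≡ x → a ≤ δ ℓ → ν H ℓ ≡ suc x →
                         δ ℓ < x → Closed a (suc x) → Closed a (δ ℓ) →
                         Subtree a (δ ℓ) (d π ℓ) → Subtree (suc (δ ℓ)) x j′ → Subtree a (suc x) j
        nodeLR-subtree a x j j′ ℓ j≡ j′≡ a≤δ ν≡ δ<x C C′ S S′ = record
          { tree  = nodeLR (height π j) (tree S) (tree S′)
          ; isΘAt = nodeLR (ℓ , sw≡d H ℓ , toℕ-injective (trans ν≡ (sym j≡))) (isΘAt S)
                           (trans (cong suc j′≡) (sym j≡) , λ dd → <-asym
                             (subst (λ z → p x < p z) ν≡ (under H ℓ δ<x (subst (x <_) (sym ν≡) (n<1+n x))))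
                             (subst Desc j′≡ (IsDescent⇒Desc dd)))
                           (isΘAt S′)
          ; noL   = nodeLR (noL S) (noL S′)
          ; Credit⇔V   = λ c → mk⇔
              (λ { (r₁ , r₂ , m , m′ , refl) → V-irrelevant (top (suc x) mx w) c
                     (joined (Equivalence.to (Credit⇔V S u) m) (Equivalence.to (Credit⇔V S′ v) m′)) })
              (λ z → let q₁ , q₂ , z₁ , z₂ , eq = unjoin {mx = mδ} l v w (s≤s δ<x) μu≤0 μv≤0 0<μw
                                                    (V-irrelevant c (top (suc x) mx w) z)
                     in q₁ , q₂ , Equivalence.from (Credit⇔V S u) z₁ , Equivalence.from (Credit⇔V S′ v) z₂ , sym eq)
          }
          where
          a≤x = ≤-trans a≤δ (<⇒≤ δ<x)
          x<n = subst (_< n) j≡ (toℕ<n j)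
          mx = Closed-max (m≤n⇒m≤1+n a≤x) x<n C
          mδ = Closed-max a≤δ (<-trans (m<n⇒m<1+n δ<x) x<n) C′
          w = cart a (suc x) (m≤n⇒m≤1+n a≤x)
          l = cart a (δ ℓ) a≤δ
          u = top (δ ℓ) mδ l
          v = cart (suc (δ ℓ)) (suc x) (s≤s (<⇒≤ δ<x))
          μu≤0 : μ u ≤ 0
          μu≤0 = V⇒μ≤ u (Equivalence.to (Credit⇔V S u) (proj₂ (proj₂ (Credit-inhabited (relabel (tree S))))))
          μv≤0 : μ v ≤ 0
          μv≤0 = V⇒μ≤ v (Equivalence.to (Credit⇔V S′ v) (proj₂ (proj₂ (Credit-inhabited (relabel (tree S′))))))
          joined : ∀ {r₁ r₂} → V u 0 r₁ → V v 0 r₂ → V w 1 (r₁ ++ r₂)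
          joined z₁ z₂ with join {mx = mδ} l v (s≤s δ<x) z₁ z₂
          ... | w′ , inj₁ z        = V-irrelevant w′ w z
          -- The descent at the end of the left subtree rules out the second outcome.
          ... | _  , inj₂ (up , _) = contradiction up (<-asym (δ-Desc ℓ))
          δ↦x : h (δ ℓ) ≡ suc x
          δ↦x = trans (hookMap-δ H ℓ) ν≡
          T : Tail a (suc x) [ suc x ]
          T = mkTail ([] ∷ []) (λ { (here refl) → ≤-refl })
            (λ { (here refl) a≤i i<x → max mx a≤i (m<n⇒m<1+n i<x) (<⇒≢ i<x) })
          rg : ∀ {i} → D a (suc x) i → h i < suc x ⊎ h i ∈ [ suc x ]
          rg dd with m≤n⇒m<n∨m≡n (inside C dd)
          ... | inj₁ lt = inj₁ lt
          ... | inj₂ eq = inj₂ (here eq)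
          -- The canonical hook from δ ℓ ends at suc x, taken as the only tail entry, so this entry
          -- is indispensable and (2) applies.
          0<μw : 0 < μ w
          0<μw = tail-minimal w T (End-left mx)
            (Hooks⇒Conf w T (inj₁ (s≤s a≤x)) (Hooks-restrict rg))
            (IsCanonical⇒Lowest H can)
            (λ { (here refl) x≤j _ j<x _ → <⇒≱ j<x x≤j })
            (mkD a≤δ (m<n⇒m<1+n δ<x) (δ-Desc ℓ)) (here δ↦x)
            (λ { (here refl) → ≤-reflexive (sym δ↦x) })

      -- f bounds the size of the interval. Whether its last point is a northeast endpoint decides
      -- the shape; if so, the start of that hook separates the words of the two children.
      subtree : ∀ f a x j → toℕ j ≡ x → x < a + f → a ≤ x → Closed a x → Subtree a x j
      subtree f a x j j≡ x<a+f a≤x C with m≤n⇒m<n∨m≡n a≤x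
      subtree f       a x       j j≡ x<a+f a≤x C | inj₂ refl = leaf-subtree a j j≡ C
      subtree zero    a x       j j≡ x<a+f a≤x C | inj₁ a<x =
        contradiction a≤x (<⇒≱ (subst (x <_) (+-identityʳ a) x<a+f))
      subtree (suc f) a (suc x) j j≡ x<a+f _   C | inj₁ (s≤s a≤x)
        with Fin.any? (λ ℓ → ν H ℓ ≟ suc x)
      ... | no ¬∃ = nodeR-subtree a x j j′ j≡ (toℕ-fromℕ< x<n) a≤x C (λ ℓ e → ¬∃ (ℓ , e)) ¬dx
          (subtree f a x j′ (toℕ-fromℕ< x<n) x<a+f′ a≤x C′)
        where
        x<n = <-trans (n<1+n x) (subst (_< n) j≡ (toℕ<n j))
        j′ = fromℕ< x<n
        x<a+f′ : x < a + f
        x<a+f′ = ≤-pred (subst (suc x <_) (+-suc a f) x<a+f)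
        ≢x : ∀ {i} → Desc i → h i ≢ suc x
        ≢x di e with δ-surjective di
        ... | ℓ , refl = ¬∃ (ℓ , trans (sym (hookMap-δ H ℓ)) e)
        ¬dx : ¬ Desc x
        ¬dx dx = ≢x dx (≤-antisym (inside C (mkD a≤x (n<1+n x) dx)) (right K (D-Desc dx)))
        C′ : Closed a x
        C′ = record
          { inside  = λ dd → ≤-pred (≤∧≢⇒< (inside C (mkD (a≤ dd) (m<n⇒m<1+n (<b dd)) (desc dd))) (≢x (desc dd)))
          ; outside = λ di i<a a≤h h≤ → outside C di i<a a≤h (m≤n⇒m≤1+n h≤)
          ; first   = first C }
      ... | yes (ℓ , ν≡) = nodeLR-subtree a x j j′ ℓ j≡ (toℕ-fromℕ< x<n) a≤δ ν≡ δ<x C C₁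
          (subtree f a (δ ℓ) (d π ℓ) refl (<-trans δ<x x<a+f′) a≤δ C₁)
          (subtree f (suc (δ ℓ)) x j′ (toℕ-fromℕ< x<n)
            (<-≤-trans x<a+f′ (+-monoˡ-≤ f (m≤n⇒m≤1+n a≤δ))) δ<x C₂)
        where
        x<n = <-trans (n<1+n x) (subst (_< n) j≡ (toℕ<n j))
        j′ = fromℕ< x<n
        x<a+f′ : x < a + f
        x<a+f′ = ≤-pred (subst (suc x <_) (+-suc a f) x<a+f)
        hδ≡ : h (δ ℓ) ≡ suc x
        hδ≡ = trans (hookMap-δ H ℓ) ν≡
        a≤δ : a ≤ δ ℓ
        a≤δ = ≮⇒≥ λ δ<a → outside C (δ-Desc ℓ) δ<a
          (subst (a ≤_) (sym hδ≡) (m≤n⇒m≤1+n a≤x)) (≤-reflexive hδ≡)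
        δ<x : δ ℓ < x
        δ<x = ≤∧≢⇒< (≤-pred (subst (δ ℓ <_) ν≡ (δ<ν H ℓ))) λ δ≡x →
          <-asym (δ-Desc ℓ) (subst (λ z → p (δ ℓ) < p z) (trans ν≡ (cong suc (sym δ≡x))) (pδ<pν H ℓ))
        dδ = D-Desc (δ-Desc ℓ)
        C₁ : Closed a (δ ℓ)
        C₁ = record
          { inside  = λ dd → [ id , (λ lt → contradiction
              (inside C (mkD (a≤ dd) (<-trans (<b dd) (m<n⇒m<1+n δ<x)) (desc dd)))
              (<⇒≱ (subst (_< _) hδ≡ lt))) ]′ (nested K (D-Desc (desc dd)) dδ (<b dd))
          ; outside = λ di i<a a≤h h≤ → outside C di i<a a≤h (≤-trans h≤ (<⇒≤ (m<n⇒m<1+n δ<x)))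
          ; first   = first C }
        C₂ : Closed (suc (δ ℓ)) x
        C₂ = record
          { inside  = λ dd → [ (λ le → contradiction (<-trans (<b dd) (n<1+n x)) (≤⇒≯ (subst (_≤ _) hδ≡ le)))
                             , (λ lt → ≤-pred (subst (_ <_) hδ≡ lt)) ]′ (nested K dδ (D-Desc (desc dd)) (a≤ dd))
          ; outside = λ di i≤δ δ<h h≤x → [ (λ i<δ → [ (λ le → <⇒≱ δ<h le)
                                                   , (λ lt → <⇒≱ (<-trans (n<1+n x) (subst (_< _) hδ≡ lt)) h≤x)
                                                   ]′ (nested K (D-Desc di) dδ i<δ))
                                       , (λ { refl → n≮n x (subst (_≤ x) hδ≡ h≤x) }) ]′ (m≤n⇒m<n∨m≡n (≤-pred i≤δ))
          ; first   = λ { refl → δ-Desc ℓ } }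

      Θ-tree : (c : Cart 0 n) → 0 < n →
               ∃[ t ] IsΘ H t × NoL t × (∀ {r} → Credit (relabel t) r ⇔ V c 0 r)
      Θ-tree c 0<n = tree S , (j , n≡ , isΘAt S) , noL S
                   , Credit⇔V′
        where
        x = pred n
        suc-x : suc x ≡ n
        suc-x = suc-pred n ⦃ >-nonZero 0<n ⦄
        j = fromℕ< {x} (≤-reflexive suc-x)
        j≡ : toℕ j ≡ x
        j≡ = toℕ-fromℕ< (≤-reflexive suc-x)
        n≡ : suc (toℕ j) ≡ n
        n≡ = trans (cong suc j≡) suc-x
        C : Closed 0 x
        C = record { inside = λ dd → ≤-pred (subst (h _ <_) (sym suc-x) (h<n dd)) ; outside = λ _ () ; first = λ () }
          where
          h<n : ∀ {b i} → D 0 b i → h i < n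
          h<n dd with range K (D-Desc (desc dd))
          ... | inj₁ lt = lt
        S = subtree n 0 x j j≡ (≤-reflexive suc-x) z≤n C
        Credit⇔V′ : ∀ {r} → Credit (relabel (tree S)) r ⇔ V c 0 r
        Credit⇔V′ = subst (λ b → (c : Cart 0 b) → ∀ {r} → Credit (relabel (tree S)) r ⇔ V c 0 r) suc-x (Credit⇔V S) c

-- The fertilitope of a sorted permutation.

module Fertilitope (π : List ℕ) (perm : IsPermutation π) (sorted-π : Sorted π) where

  private
    bounded : All (_< suc (sum π)) π
    bounded = All.tabulate λ x∈ → s≤s (∈⇒≤sum x∈)

    p : ℕ → ℕ
    -- The base exceeds every entry, which keeps p injective and makes it increase past the end.
    p = at π (suc (sum π))

    p-inj : ∀ {i j} → p i ≡ p j → i ≡ j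
    p-inj = at-injective (IsPermutation.distinct perm) bounded

  open Plot π p p-inj (at-lookup π) (at-beyond π bounded)

  private
    0<n : 0 < n
    0<n = IsPermutation.nonEmpty perm

    c₀ : Cart 0 n
    c₀ = cart 0 n z≤n

    μ≤0 : μ c₀ ≤ 0
    μ≤0 = sorted-feasible (proj₂ (proj₂ sorted-π)) (Seg-at 0 π λ _ → refl) c₀ 0<n

  construction : Construction π
  construction with canonical-exists c₀ μ≤0
  ... | H , can with Θ-tree H can c₀ 0<n
  ... | t , isΘ , noL , _ with contraction (relabel-NoL noL)
  ... | T , steps , full = record
    { H* = H ; canonical = can ; Θ* = t ; isΘ = isΘ ; T̂ = T ; steps = steps ; full = full }

  module _ (C : Construction π) where

    open Construction C

    -- The right side does not mention the run, so every choice of contractions credits the same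
    -- compositions.
    compositions : ∀ {r} → Credit T̂ r ⇔ V c₀ 0 r
    compositions with Θ-tree H* canonical c₀ 0<n
    ... | t , isΘ′ , _ , Credit⇔V with refl ← IsΘ-unique H* isΘ isΘ′ =
      mk⇔ (Equivalence.to Credit⇔V ∘ Equivalence.from (Credit-⇝* steps))
          (Equivalence.to (Credit-⇝* steps) ∘ Equivalence.from Credit⇔V)

    q∈Credit : ∀ H → Credit T̂ (tabulate (q π H))
    q∈Credit H = Equivalence.from compositions (compositions⁺ c₀ 0<n H)

    -- A single composition decides: it has one part for each leaf and one for each color.
    #leaves≡ : #leaves T̂ ≡ suc (#descents π)
    #leaves≡ = trans (sym (Credit-length T̂ (q∈Credit H*))) (length-tabulate (q π H*))

    embed-q : ∀ H i → embed 0 (tabulate (q π H)) i ≡ q π H i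
    embed-q H i = embed-tabulate 0 (q π H) i i refl

    q∈DiscSum : ∀ H → DiscSum 𝓑 (embed 0 (tabulate (q π H)))
    q∈DiscSum H = DiscSum-positive⁺ (vertices (suc (#descents π)) 0 T̂)
      (Credit⇒DiscSum 0 full (≤-reflexive #leaves≡) (q∈Credit H))

    DiscSum⇒q : ∀ {z} → DiscSum 𝓑 z → ∃[ H ] (∀ i → z i ≡ q π H i)
    DiscSum⇒q s with DiscSum⇒Credit 0 full (DiscSum-positive⁻ (vertices (suc (#descents π)) 0 T̂) s)
    ... | r , m , eq with compositions⁻ c₀ (Equivalence.to compositions m)
    ... | H , refl = H , λ i → trans (eq i) (embed-q H i)

    module _ {c ℓ₁ ℓ₂ ℓ₃} (F : OrderedField c ℓ₁ ℓ₂ ℓ₃) where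

      open Convexity F

      𝓥⊆Lattice : 𝓥 F π ⊆ Lattice (DiscSum 𝓑)
      𝓥⊆Lattice (H , x≈) = _ , q∈DiscSum H
        , ⟦⟧-trans x≈ (λ i → sym (embed-q H i))

      Lattice⊆𝓥 : Lattice (DiscSum 𝓑) ⊆ 𝓥 F π
      Lattice⊆𝓥 (z , s , x≈) with DiscSum⇒q s
      ... | H , eq = H , ⟦⟧-trans x≈ eq

      fertilitope : Fer F π ≐ ΣyΔ F 𝓑
      fertilitope =
          (λ x∈ → conv⊆ΣyΔ (All.all-filter positive? (vertices (suc (#descents π)) 0 T̂))
                    (conv-mono {S = 𝓥 F π} {Lattice (DiscSum 𝓑)} 𝓥⊆Lattice x∈))
        , (λ x∈ → conv-mono {S = Lattice (DiscSum 𝓑)} {𝓥 F π} Lattice⊆𝓥 (ΣyΔ⊆conv 𝓑 x∈))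

theorem4p5 : ∀ {c ℓ₁ ℓ₂ ℓ₃} (F : OrderedField c ℓ₁ ℓ₂ ℓ₃)
    (π : List ℕ) → IsPermutation π → Sorted π →
    Construction π ×
    ((C : Construction π) → Fer F π ≐ ΣyΔ F (Construction.𝓑 C))
theorem4p5 F π perm sorted-π = construction , λ C → fertilitope C F
  where open Fertilitope π perm sorted-π
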